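{- Let $\mathbb{F}$ be an algebraically closed field and $T\in\mathbb{F}^{n_1\times n_2\times n_3}$. Then $\mathrm{GR}(T)\le \mathrm{ZR}(T)\le \mathrm{SR}(T)$.
   Context: For $T\in\mathbb{F}^{n_1\times n_2\times n_3}$ write $T(x,y,z)=\sum_{i,j,k}T_{i,j,k}x_iy_jz_k$ and let $\mathbf{V}(T)=\{(x,y)\in\mathbb{F}^{n_1}\times\mathbb{F}^{n_2}: T(x,y,z)=0 \text{ for all } z\in\mathbb{F}^{n_3}\}$. The geometric rank is $\mathrm{GR}(T)=\operatorname{codim}\mathbf{V}(T)=n_1+n_2-\dim\mathbf{V}(T)$. For polynomials $f_1,\dots,f_s$, $\mathbf{V}(f_1,\dots,f_s)$ denotes their common zero set. Let $P$ be the set of polynomials in $\mathbb{F}[x_1,\dots,x_{n_1},y_1,\dots,y_{n_2}]$ that are bi-homogeneous of bi-degree $(1,0)$, $(0,1)$ or $(1,1)$ (i.e. linear forms in $x$ only, linear forms in $y$ only, or bilinear forms in $(x,y)$). Define $\mathrm{ZR}(T)=\min\{s\in\mathbb{N}: \exists f_1,\dots,f_s\in P \text{ with } \mathbf{V}(f_1,\dots,f_s)\subseteq\mathbf{V}(T)\}$. The slice rank $\mathrm{SR}(T)$ is the smallest $r$ such that $T$ is a sum of $r$ tensors each of the form $(u_iV_{jk})_{i,j,k}$, $(u_jV_{ik})_{i,j,k}$ or $(u_kV_{ij})_{i,j,k}$ for a vector $u$ and matrix $V$. -}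

module Defs where

open import Level using (Level; _⊔_; Lift) renaming (suc to lsuc)
open import Data.Nat using (ℕ; zero; suc; _≤_; _∸_)
import Data.Fin
open import Relation.Binary.PropositionalEquality using (_≡_)
open import Data.Fin using (Fin; inject₁) renaming (zero to fzero; suc to fsuc)
open import Data.Product using (∃; _×_; _,_)
open import Data.Sum using (_⊎_; inj₁; inj₂; [_,_])
open import Relation.Nullary using (¬_)
open import Algebra.Bundles using (CommutativeRing)

record Field (c ℓ : Level) : Set (lsuc (c ⊔ ℓ)) where
  field
    commutativeRing : CommutativeRing c ℓ
  open CommutativeRing commutativeRing public
  field
    1≉0     : ¬ (1# ≈ 0#)
    inverse : ∀ x → ¬ (x ≈ 0#) → ∃ λ y → (x * y) ≈ 1#

module FieldDefs {c ℓ} (F : Field c ℓ) where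
  open Field F

  ∑ : ∀ {n} → (Fin n → Carrier) → Carrier
  ∑ {zero}  f = 0#
  ∑ {suc n} f = f fzero + ∑ (λ i → f (fsuc i))

  pow : Carrier → ℕ → Carrier
  pow x zero    = 1#
  pow x (suc n) = x * pow x n

  AlgebraicallyClosed : Set (c ⊔ ℓ)
  AlgebraicallyClosed =
    ∀ n (a : Fin (suc n) → Carrier) →
    ∃ λ x → (pow x (suc n) + ∑ (λ i → a i * pow x (Data.Fin.toℕ i))) ≈ 0#

  Tensor : ℕ → ℕ → ℕ → Set c
  Tensor n₁ n₂ n₃ = Fin n₁ → Fin n₂ → Fin n₃ → Carrier

  trilinear : ∀ {n₁ n₂ n₃} → Tensor n₁ n₂ n₃ →
              (Fin n₁ → Carrier) → (Fin n₂ → Carrier) → (Fin n₃ → Carrier) → Carrier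
  trilinear T x y z = ∑ λ i → ∑ λ j → ∑ λ k → T i j k * (x i * (y j * z k))

  Point : ℕ → ℕ → Set c
  Point n₁ n₂ = (Fin n₁ → Carrier) × (Fin n₂ → Carrier)

  Subset : ℕ → ℕ → Set (lsuc (c ⊔ ℓ))
  Subset n₁ n₂ = Point n₁ n₂ → Set (c ⊔ ℓ)

  _⊆_ : ∀ {n₁ n₂} → Subset n₁ n₂ → Subset n₁ n₂ → Set (c ⊔ ℓ)
  A ⊆ B = ∀ p → A p → B p

  _⊂_ : ∀ {n₁ n₂} → Subset n₁ n₂ → Subset n₁ n₂ → Set (c ⊔ ℓ)
  A ⊂ B = A ⊆ B × ∃ λ p → B p × ¬ A p

  VT : ∀ {n₁ n₂ n₃} → Tensor n₁ n₂ n₃ → Subset n₁ n₂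
  VT T (x , y) = ∀ z → trilinear T x y z ≈ 0#

  data Poly (n₁ n₂ : ℕ) : Set c where
    const : Carrier → Poly n₁ n₂
    varx  : Fin n₁ → Poly n₁ n₂
    vary  : Fin n₂ → Poly n₁ n₂
    _⊕_   : Poly n₁ n₂ → Poly n₁ n₂ → Poly n₁ n₂
    _⊗_   : Poly n₁ n₂ → Poly n₁ n₂ → Poly n₁ n₂

  eval : ∀ {n₁ n₂} → Poly n₁ n₂ → Point n₁ n₂ → Carrier
  eval (const a) p       = a
  eval (varx i) (x , y)  = x i
  eval (vary j) (x , y)  = y j
  eval (f ⊕ g) p         = eval f p + eval g p
  eval (f ⊗ g) p         = eval f p * eval g p

  V : ∀ {n₁ n₂ s} → (Fin s → Poly n₁ n₂) → Subset n₁ n₂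
  V fs p = Lift c (∀ i → eval (fs i) p ≈ 0#)

  record Closed (n₁ n₂ : ℕ) : Set c where
    constructor closed
    field
      {size} : ℕ
      eqs    : Fin size → Poly n₁ n₂

  ⟦_⟧ : ∀ {n₁ n₂} → Closed n₁ n₂ → Subset n₁ n₂
  ⟦ closed fs ⟧ = V fs

  _∪_ : ∀ {n₁ n₂} → Subset n₁ n₂ → Subset n₁ n₂ → Subset n₁ n₂
  (A ∪ B) p = A p ⊎ B p

  Irreducible : ∀ {n₁ n₂} → Closed n₁ n₂ → Set (c ⊔ ℓ)
  Irreducible Z =
    (∃ λ p → ⟦ Z ⟧ p) ×
    (∀ A B → ⟦ Z ⟧ ⊆ (⟦ A ⟧ ∪ ⟦ B ⟧) → (⟦ Z ⟧ ⊆ ⟦ A ⟧) ⊎ (⟦ Z ⟧ ⊆ ⟦ B ⟧))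

  record Chain {n₁ n₂} (W : Subset n₁ n₂) (d : ℕ) : Set (c ⊔ ℓ) where
    field
      Z      : Fin (suc d) → Closed n₁ n₂
      irred  : ∀ i → Irreducible (Z i)
      inW    : ∀ i → ⟦ Z i ⟧ ⊆ W
      strict : ∀ (i : Fin d) → ⟦ Z (inject₁ i) ⟧ ⊂ ⟦ Z (fsuc i) ⟧

  IsDim : ∀ {n₁ n₂} → Subset n₁ n₂ → ℕ → Set (c ⊔ ℓ)
  IsDim W d = Chain W d × (∀ e → Chain W e → e ≤ d)

  IsGR : ∀ {n₁ n₂ n₃} → Tensor n₁ n₂ n₃ → ℕ → Set (c ⊔ ℓ)
  IsGR {n₁} {n₂} T g = ∃ λ d → IsDim (VT T) d × (g ≡ (n₁ Data.Nat.+ n₂) ∸ d)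

  data PForm (n₁ n₂ : ℕ) : Set c where
    linx : (Fin n₁ → Carrier) → PForm n₁ n₂
    liny : (Fin n₂ → Carrier) → PForm n₁ n₂
    bilin : (Fin n₁ → Fin n₂ → Carrier) → PForm n₁ n₂

  sumP : ∀ {n₁ n₂ n} → (Fin n → Poly n₁ n₂) → Poly n₁ n₂
  sumP {n = zero}  f = const 0#
  sumP {n = suc n} f = f fzero ⊕ sumP (λ i → f (fsuc i))

  toPoly : ∀ {n₁ n₂} → PForm n₁ n₂ → Poly n₁ n₂
  toPoly (linx a)  = sumP λ i → const (a i) ⊗ varx i
  toPoly (liny b)  = sumP λ j → const (b j) ⊗ vary j
  toPoly (bilin m) = sumP λ i → sumP λ j → const (m i j) ⊗ (varx i ⊗ vary j)

  ZRWitness : ∀ {n₁ n₂ n₃} → Tensor n₁ n₂ n₃ → ℕ → Set (c ⊔ ℓ)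
  ZRWitness {n₁} {n₂} T s =
    ∃ λ (fs : Fin s → PForm n₁ n₂) → V (λ i → toPoly (fs i)) ⊆ VT T

  IsZR : ∀ {n₁ n₂ n₃} → Tensor n₁ n₂ n₃ → ℕ → Set (c ⊔ ℓ)
  IsZR T z = ZRWitness T z × (∀ s → ZRWitness T s → z ≤ s)

  data SliceTerm (n₁ n₂ n₃ : ℕ) : Set c where
    slice₁ : (Fin n₁ → Carrier) → (Fin n₂ → Fin n₃ → Carrier) → SliceTerm n₁ n₂ n₃
    slice₂ : (Fin n₂ → Carrier) → (Fin n₁ → Fin n₃ → Carrier) → SliceTerm n₁ n₂ n₃
    slice₃ : (Fin n₃ → Carrier) → (Fin n₁ → Fin n₂ → Carrier) → SliceTerm n₁ n₂ n₃

  sliceTensor : ∀ {n₁ n₂ n₃} → SliceTerm n₁ n₂ n₃ → Tensor n₁ n₂ n₃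
  sliceTensor (slice₁ u M) i j k = u i * M j k
  sliceTensor (slice₂ u M) i j k = u j * M i k
  sliceTensor (slice₃ u M) i j k = u k * M i j

  SRWitness : ∀ {n₁ n₂ n₃} → Tensor n₁ n₂ n₃ → ℕ → Set (c ⊔ ℓ)
  SRWitness {n₁} {n₂} {n₃} T r =
    ∃ λ (ts : Fin r → SliceTerm n₁ n₂ n₃) →
      ∀ i j k → T i j k ≈ ∑ (λ t → sliceTensor (ts t) i j k)

  IsSR : ∀ {n₁ n₂ n₃} → Tensor n₁ n₂ n₃ → ℕ → Set (c ⊔ ℓ)
  IsSR T r = SRWitness T r × (∀ s → SRWitness T s → r ≤ s)

{-# OPTIONS --safe #-}
-- The inequality ZR ≤ SR: the vectors u of the slices of the first two kinds and the matrices of those of the third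
-- kind are linear and bilinear forms whose common zeros annihilate T.
--
-- The inequality GR ≤ ZR: let s forms define a subset of V(T). The forms that are linear in x cut out a linear space,
-- parametrised by u; the others form a linear system in y with coefficients polynomial in u. Fraction-free
-- elimination yields a denominator Δ(u) and a polynomial map φ(u , w), linear in w, from an affine space of dimension
-- at least n₁ + n₂ - s to the zero set, which is inverted by a coordinate projection where Δ ≠ 0. Restricting φ to a
-- flag of affine coordinate subspaces and taking Zariski closures of the images gives a chain of irreducible sets.
--
-- The field has no decidable equality, so the goal, which is stable under double negation, is used to make finitely
-- many case distinctions, while irreducibility itself has to be proved without any. Hence the closure of an image
-- needs finitely many equations that generate exactly the ideal (J : Δ^∞) of all polynomials vanishing on the image.
-- They are found by combining Hilbert's basis theorem, whose conclusion holds only up to double negation, with the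
-- coherence of polynomial rings, whose proof (following Hermann) makes one variable monic and divides by a pivot.
module Submission where

open import Level using (Level; _⊔_)
open import Algebra.Bundles using (CommutativeRing; RawRing)
import Algebra.Properties.AbelianGroup
import Algebra.Properties.CommutativeSemigroup
import Algebra.Properties.Ring
import Algebra.Properties.Semiring.Mult
import Algebra.Properties.Semiring.Sum
import Algebra.Solver.Ring
open import Algebra.Solver.Ring.AlmostCommutativeRing using (fromCommutativeRing; _-Raw-AlmostCommutative⟶_)
open import Data.Bool using (Bool; true; false; if_then_else_)
open import Data.Fin using (Fin; zero; suc; _↑ˡ_; _↑ʳ_; combine; punchIn; toℕ; remQuot; inject₁)
import Data.Fin.Properties as Fin
open import Data.List using (List; []; _∷_; length; map; lookup; tabulate; _++_)
open import Data.List.Membership.Propositional using (_∈_)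
open import Data.List.Membership.Propositional.Properties using (∈-map⁺; ∈-lookup; ∈-tabulate⁺; ∈-++⁺ˡ; ∈-++⁺ʳ)
import Data.List.Properties as List
open import Data.List.Relation.Unary.All as All using (All; []; _∷_)
import Data.List.Relation.Unary.All.Properties as All
open import Data.List.Relation.Unary.AllPairs using (AllPairs; []; _∷_)
open import Data.List.Relation.Unary.Any using (index; here; there)
open import Data.List.Relation.Unary.Any.Properties using (lookup-index)
open import Data.Maybe using (Maybe; just; nothing)
open import Data.Nat as ℕ using (ℕ; zero; suc; _≤_; z≤n; s≤s)
import Data.Nat.Properties as ℕₚ
open import Data.Nat.Tactic.RingSolver using (solve-∀)
open import Data.Product using (∃; _×_; _,_; proj₁; proj₂)
open import Data.Sum using (_⊎_; inj₁; inj₂)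
open import Data.Vec as Vec using (Vec; []; _∷_; _[_]≔_)
import Data.Vec.Properties as Vec
open import Defs
open import Function using (_∘_)
open import Relation.Binary.PropositionalEquality as ≡ using (_≡_)
import Relation.Binary.Reasoning.Setoid
open import Relation.Nullary using (¬_; Dec; yes; no)
open import Relation.Nullary.Decidable using (decidable-stable)
open import Relation.Nullary.Negation using (contradiction)

-- `IsDim` bounds every chain in `VT T` by d, so exhibiting one chain of length at least n₁ + n₂ - s
-- already yields n₁ + n₂ - d ≤ s. The difficulty lies in `Irreducible`, which asks for a decision:
-- given a rule that tells for each point of Z whether A or B contains it, one has to compute which
-- of them contains all of Z. On an affine space this is possible because the field is infinite. The
-- verdict passes from the parameter space to the closure of its image if each polynomial vanishing
-- on the image is an actual, not merely doubly negated, combination of the equations. That (J :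
-- Δ^∞) is the whole vanishing ideal needs an argument, since the projection inverts φ only up to
-- the factor Δ on y, with no factor on x. The image is stable under scaling y, so a vanishing
-- polynomial has vanishing components f of each degree e in y; then Δ^e f(x , y) = f(x , Δ y) is
-- congruent modulo J to f after φ after the projection, which is 0. Hence the weights carried along
-- everywhere, and the base point of the flag: w = 0, which scaling preserves, and a u where Δ does
-- not vanish.

module DoubleNegation where
  infix 3 ¬¬_
  ¬¬_ : ∀ {a} → Set a → Set a
  ¬¬ A = ¬ ¬ A

  infixl 1 _>>=_
  _>>=_ : ∀ {a b} {A : Set a} {B : Set b} → ¬¬ A → (A → ¬¬ B) → ¬¬ B
  (m >>= f) k = m λ x → f x k

  return : ∀ {a} {A : Set a} → A → ¬¬ A
  return x k = k x

  lem : ∀ {a} (A : Set a) → ¬¬ (A ⊎ ¬ A)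
  lem A k = k (inj₂ (k ∘ inj₁))

  -- Finite choice under double negation; it later collects the strata of a whole chain.
  ¬¬-Π : ∀ {p} n {P : Fin n → Set p} → (∀ i → ¬¬ P i) → ¬¬ (∀ i → P i)
  ¬¬-Π zero    h = return λ ()
  ¬¬-Π (suc n) h = h zero >>= λ p₀ → ¬¬-Π n (h ∘ suc) >>= λ ps →
    return λ { zero → p₀ ; (suc i) → ps i }

  ¬¬-All : ∀ {a p} {A : Set a} {P : A → Set p} {xs : List A} → All (λ x → ¬¬ P x) xs → ¬¬ All P xs
  ¬¬-All []       = return []
  ¬¬-All (p ∷ ps) = p >>= λ q → ¬¬-All ps >>= λ qs → return (q ∷ qs)

-- A pair (a , b) of naturals stands for the coefficient a - b.
module RingSolver {c ℓ} (R : CommutativeRing c ℓ) where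
  open CommutativeRing R
  open Algebra.Properties.Ring ring
  open Algebra.Properties.AbelianGroup +-abelianGroup using (⁻¹-∙-comm)
  open Algebra.Properties.CommutativeSemigroup +-commutativeSemigroup using (interchange)
  private
    module M = Algebra.Properties.Semiring.Mult semiring
    open Relation.Binary.Reasoning.Setoid setoid

    coefficients : RawRing _ _
    coefficients = record
      { Carrier = ℕ × ℕ
      ; _≈_ = _≡_
      ; _+_ = λ { (a , b) (c , d) → a ℕ.+ c , b ℕ.+ d }
      ; _*_ = λ { (a , b) (c , d) → a ℕ.* c ℕ.+ b ℕ.* d , a ℕ.* d ℕ.+ b ℕ.* c }
      ; -_ = λ { (a , b) → b , a }
      ; 0# = 0 , 0
      ; 1# = 1 , 0
      }

    -- The case b = 0 is separate so that the coefficient `(0 , 0)` denotes `0#` on the nose and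
    -- solver equations match goals containing `0#`.
    ⟦_⟧ : ℕ × ℕ → Carrier
    ⟦ a , zero ⟧  = a M.× 1#
    ⟦ a , suc b ⟧ = a M.× 1# - suc b M.× 1#

    ⟦⟧-diff : ∀ a b → ⟦ a , b ⟧ ≈ a M.× 1# - b M.× 1#
    ⟦⟧-diff a zero    = sym (trans (+-congˡ -0#≈0#) (+-identityʳ _))
    ⟦⟧-diff a (suc b) = refl

    diff-+ : ∀ a b c d → (a + c) - (b + d) ≈ (a - b) + (c - d)
    diff-+ a b c d = trans (+-congˡ (sym (⁻¹-∙-comm b d))) (interchange a c (- b) (- d))

    neg-diff : ∀ a b → - (a - b) ≈ b - a
    neg-diff a b = trans (sym (⁻¹-∙-comm a (- b))) (trans (+-comm _ _) (+-congʳ (-‿involutive b)))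

    diff-* : ∀ a b c d → (a * c + b * d) - (a * d + b * c) ≈ (a - b) * (c - d)
    diff-* a b c d = begin
      (a * c + b * d) - (a * d + b * c)     ≈⟨ diff-+ _ _ _ _ ⟩
      (a * c - a * d) + (b * d - b * c)     ≈⟨ +-cong (sym (x[y-z]≈xy-xz a c d)) (sym (neg-diff _ _)) ⟩
      a * (c - d) - (b * c - b * d)         ≈⟨ +-congˡ (-‿cong (sym (x[y-z]≈xy-xz b c d))) ⟩
      a * (c - d) - b * (c - d)             ≈⟨ sym ([y-z]x≈yx-zx (c - d) a b) ⟩
      (a - b) * (c - d)                     ∎

    diff-cong : ∀ {a b c d} → a + d ≈ c + b → a - b ≈ c - d
    diff-cong {a} {b} {c} {d} eq = begin
      a - b              ≈⟨ sym (+-identityʳ _) ⟩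
      (a - b) + 0#       ≈⟨ +-congˡ (sym (-‿inverseʳ d)) ⟩
      (a - b) + (d - d)  ≈⟨ interchange a (- b) d (- d) ⟩
      (a + d) + (- b - d) ≈⟨ +-congʳ eq ⟩
      (c + b) + (- b - d) ≈⟨ +-congˡ (+-comm _ _) ⟩
      (c + b) + (- d - b) ≈⟨ sym (interchange c (- d) b (- b)) ⟩
      (c - d) + (b - b)  ≈⟨ +-congˡ (-‿inverseʳ b) ⟩
      (c - d) + 0#       ≈⟨ +-identityʳ _ ⟩
      c - d ∎

    ×-+ : ∀ m n → (m ℕ.+ n) M.× 1# ≈ m M.× 1# + n M.× 1#
    ×-+ m n = M.×-homo-+ 1# m n

    ×-+* : ∀ a b c d → (a ℕ.* c ℕ.+ b ℕ.* d) M.× 1# ≈ (a M.× 1#) * (c M.× 1#) + (b M.× 1#) * (d M.× 1#)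
    ×-+* a b c d = trans (×-+ (a ℕ.* c) (b ℕ.* d)) (+-cong (M.×1-homo-* a c) (M.×1-homo-* b d))

    morphism : coefficients -Raw-AlmostCommutative⟶ fromCommutativeRing R
    morphism = record
      { ⟦_⟧ = ⟦_⟧
      ; +-homo = λ { (a , b) (c , d) → trans (⟦⟧-diff (a ℕ.+ c) (b ℕ.+ d)) (trans (+-cong (×-+ a c) (-‿cong (×-+ b d)))
                     (trans (diff-+ _ _ _ _) (sym (+-cong (⟦⟧-diff a b) (⟦⟧-diff c d))))) }
      ; *-homo = λ { (a , b) (c , d) → trans (⟦⟧-diff (a ℕ.* c ℕ.+ b ℕ.* d) (a ℕ.* d ℕ.+ b ℕ.* c))
                     (trans (+-cong (×-+* a b c d) (-‿cong (×-+* a b d c)))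
                     (trans (diff-* _ _ _ _) (sym (*-cong (⟦⟧-diff a b) (⟦⟧-diff c d))))) }
      ; -‿homo = λ { (a , b) → trans (⟦⟧-diff b a) (sym (trans (-‿cong (⟦⟧-diff a b)) (neg-diff _ _))) }
      ; 0-homo = refl
      ; 1-homo = +-identityʳ 1#
      }

    _≟_ : ∀ p q → Maybe (⟦ p ⟧ ≈ ⟦ q ⟧)
    (a , b) ≟ (c , d) with (a ℕ.+ d) ℕ.≟ (c ℕ.+ b)
    ... | no _   = nothing
    ... | yes eq = just (trans (⟦⟧-diff a b) (trans (diff-cong (trans (sym (×-+ a d)) (trans (reflexive (≡.cong (M._× 1#) eq)) (×-+ c b)))) (sym (⟦⟧-diff c d))))

  open Algebra.Solver.Ring coefficients (fromCommutativeRing R) morphism _≟_ public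
    using (solve; _:=_; _:+_; _:*_; _:-_; :-_; con)

-- Spans and semilinear maps.

record RawModule (r m e : Level) : Set (Level.suc (r ⊔ m ⊔ e)) where
  infix 4 _≈_
  field
    Scalar : Set r
    Vector : Set m
    _≈_    : Vector → Vector → Set e
    0#     : Vector
    _+_    : Vector → Vector → Vector
    _·_    : Scalar → Vector → Vector

data Span {r m e} (X : RawModule r m e) (G : List (RawModule.Vector X)) :
          RawModule.Vector X → Set (r ⊔ m ⊔ e) where
  gen   : ∀ {g} → g ∈ G → Span X G g
  null  : Span X G (RawModule.0# X)
  add   : ∀ {x y} → Span X G x → Span X G y → Span X G (RawModule._+_ X x y)
  scale : ∀ {x} a → Span X G x → Span X G (RawModule._·_ X a x)
  resp  : ∀ {x y} → RawModule._≈_ X x y → Span X G x → Span X G y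

span-⊆ : ∀ {r m e} {X : RawModule r m e} {G H} → (∀ {g} → g ∈ G → Span X H g) →
         ∀ {x} → Span X G x → Span X H x
span-⊆ h (gen g)     = h g
span-⊆ h null        = null
span-⊆ h (add p q)   = add (span-⊆ h p) (span-⊆ h q)
span-⊆ h (scale a p) = scale a (span-⊆ h p)
span-⊆ h (resp e p)  = resp e (span-⊆ h p)

-- The scalars may change along with the vectors: the maps used below include the passage from
-- coefficients to polynomials in one more variable, and substitutions. The equations point in the
-- direction that `resp` consumes.
record Semilinear {r m e r′ m′ e′} (X : RawModule r m e) (Y : RawModule r′ m′ e′) :
                  Set (r ⊔ m ⊔ e ⊔ r′ ⊔ m′ ⊔ e′) where
  private
    module X = RawModule X
    module Y = RawModule Y
  field
    onScalar : X.Scalar → Y.Scalar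
    apply    : X.Vector → Y.Vector
    cong     : ∀ {x y} → x X.≈ y → apply x Y.≈ apply y
    homo-0   : Y.0# Y.≈ apply X.0#
    homo-+   : ∀ x y → (apply x Y.+ apply y) Y.≈ apply (x X.+ y)
    homo-·   : ∀ a x → (onScalar a Y.· apply x) Y.≈ apply (a X.· x)

  span-map : ∀ {G x} → Span X G x → Span Y (map apply G) (apply x)
  span-map (gen g)     = gen (∈-map⁺ apply g)
  span-map null        = resp homo-0 null
  span-map (add p q)   = resp (homo-+ _ _) (add (span-map p) (span-map q))
  span-map (scale a p) = resp (homo-· a _) (scale (onScalar a) (span-map p))
  span-map (resp e p)  = resp (cong e) (span-map p)

-- Finite sums and dot products over a commutative ring.

module Sums {c ℓ} (R : CommutativeRing c ℓ) where
  open CommutativeRing R hiding (zero)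
  open Algebra.Properties.Ring ring using (-0#≈0#)
  private module S = Algebra.Properties.Semiring.Sum semiring
  open RingSolver R

  -- Opaque, so that unification never unfolds a sum.
  abstract
    sum : ∀ {n} → (Fin n → Carrier) → Carrier
    sum = S.sum

    sum-zero : (f : Fin 0 → Carrier) → sum f ≡ 0#
    sum-zero f = ≡.refl

    sum-suc : ∀ {n} (f : Fin (suc n) → Carrier) → sum f ≡ f zero + sum (f ∘ suc)
    sum-suc f = ≡.refl

    sum-cong : ∀ {n} {f g : Fin n → Carrier} → (∀ i → f i ≈ g i) → sum f ≈ sum g
    sum-cong = S.sum-cong-≋

    sum-0 : ∀ {n} {f : Fin n → Carrier} → (∀ i → f i ≈ 0#) → sum f ≈ 0#
    sum-0 {n} h = trans (sum-cong h) (S.sum-replicate-zero n)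

    sum-+ : ∀ {n} (f g : Fin n → Carrier) → sum (λ i → f i + g i) ≈ sum f + sum g
    sum-+ = S.∑-distrib-+

    sum-neg : ∀ {n} (f : Fin n → Carrier) → sum (λ i → - f i) ≈ - sum f
    sum-neg {zero}  f = sym -0#≈0#
    sum-neg {suc n} f = trans (+-congˡ (sum-neg (f ∘ suc)))
      (solve 2 (λ a b → :- a :+ :- b := :- (a :+ b)) refl (f zero) (sum (f ∘ suc)))

    *-distribˡ-sum : ∀ {n} x (f : Fin n → Carrier) → x * sum f ≈ sum (λ i → x * f i)
    *-distribˡ-sum = S.*-distribˡ-sum

    sum-comm : ∀ {m n} (f : Fin m → Fin n → Carrier) → sum (λ i → sum (f i)) ≈ sum (λ j → sum (λ i → f i j))
    sum-comm = S.∑-comm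

    sum-remove : ∀ {n} (i : Fin (suc n)) (f : Fin (suc n) → Carrier) → sum f ≈ f i + sum (λ j → f (punchIn i j))
    sum-remove i f = S.sum-remove {i = i} f

    sum-split : ∀ m {n} (f : Fin (m ℕ.+ n) → Carrier) →
                sum f ≈ sum (λ i → f (i ↑ˡ n)) + sum (λ j → f (m ↑ʳ j))
    sum-split zero    f = sym (+-identityˡ _)
    sum-split (suc m) f = trans (+-congˡ (sum-split m (f ∘ suc))) (sym (+-assoc _ _ _))

    sum-combine : ∀ m {n} (f : Fin (m ℕ.* n) → Carrier) →
                  sum f ≈ sum {m} (λ i → sum (λ (j : Fin n) → f (combine i j)))
    sum-combine zero        f = refl
    sum-combine (suc m) {n} f = trans (sum-split n f) (+-congˡ (sum-combine m (λ j → f (n ↑ʳ j))))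

  sum-- : ∀ {n} (f g : Fin n → Carrier) → sum (λ i → f i - g i) ≈ sum f - sum g
  sum-- f g = trans (sum-+ f (λ i → - g i)) (+-congˡ (sum-neg g))

  δ : ∀ {n} → Fin n → Fin n → Carrier
  δ zero    zero    = 1#
  δ zero    (suc j) = 0#
  δ (suc i) zero    = 0#
  δ (suc i) (suc j) = δ i j

  δ-sym : ∀ {n} (i j : Fin n) → δ i j ≡ δ j i
  δ-sym zero    zero    = ≡.refl
  δ-sym zero    (suc j) = ≡.refl
  δ-sym (suc i) zero    = ≡.refl
  δ-sym (suc i) (suc j) = δ-sym i j

  δ-punchIn : ∀ {n} (i : Fin (suc n)) j k → δ (punchIn i j) (punchIn i k) ≡ δ j k
  δ-punchIn zero    j       k       = ≡.refl
  δ-punchIn (suc i) zero    zero    = ≡.refl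
  δ-punchIn (suc i) zero    (suc k) = ≡.refl
  δ-punchIn (suc i) (suc j) zero    = ≡.refl
  δ-punchIn (suc i) (suc j) (suc k) = δ-punchIn i j k

  δ-punchIn-0 : ∀ {n} (i : Fin (suc n)) j → δ (punchIn i j) i ≡ 0#
  δ-punchIn-0 zero    j       = ≡.refl
  δ-punchIn-0 (suc i) zero    = ≡.refl
  δ-punchIn-0 (suc i) (suc j) = δ-punchIn-0 i j

  sum-δ : ∀ {n} (i : Fin n) (g : Fin n → Carrier) → sum (λ j → δ i j * g j) ≈ g i
  sum-δ zero    g = trans (reflexive (sum-suc _)) (trans (+-cong (*-identityˡ _) (sum-0 (λ j → zeroˡ _)))
      (+-identityʳ _))
  sum-δ (suc i) g = trans (reflexive (sum-suc _)) (trans (+-cong (zeroˡ _) (sum-δ i (g ∘ suc))) (+-identityˡ _))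

  dot : ∀ {n} → (Fin n → Carrier) → (Fin n → Carrier) → Carrier
  dot a b = sum (λ i → a i * b i)

  dot-cong : ∀ {n} {a b a′ b′ : Fin n → Carrier} →
             (∀ i → a i ≈ a′ i) → (∀ i → b i ≈ b′ i) → dot a b ≈ dot a′ b′
  dot-cong p q = sum-cong (λ i → *-cong (p i) (q i))

  dot-comm : ∀ {n} (a b : Fin n → Carrier) → dot a b ≈ dot b a
  dot-comm a b = sum-cong (λ i → *-comm (a i) (b i))

  dot-δ : ∀ {n} (a : Fin n → Carrier) i → dot a (δ i) ≈ a i
  dot-δ a i = trans (dot-comm a (δ i)) (sum-δ i a)

  dot-δʳ : ∀ {n} (a : Fin n → Carrier) i → dot a (λ j → δ j i) ≈ a i
  dot-δʳ a i = trans (dot-cong (λ _ → refl) (λ j → reflexive (δ-sym j i))) (dot-δ a i)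

  dot-0 : ∀ {n} (a : Fin n → Carrier) → dot a (λ _ → 0#) ≈ 0#
  dot-0 a = sum-0 (λ i → zeroʳ (a i))

  dot-+ : ∀ {n} (a u v : Fin n → Carrier) → dot a (λ i → u i + v i) ≈ dot a u + dot a v
  dot-+ a u v = trans (sum-cong (λ i → distribˡ (a i) (u i) (v i))) (sum-+ _ _)

  dot-· : ∀ {n} (a u : Fin n → Carrier) x → dot a (λ i → x * u i) ≈ x * dot a u
  dot-· a u x = trans (sum-cong (λ i → solve 3 (λ a x u → a :* (x :* u) := x :* (a :* u)) refl (a i) x (u i)))
    (sym (*-distribˡ-sum x _))

  dot-0ˡ : ∀ {n} (u : Fin n → Carrier) → dot (λ _ → 0#) u ≈ 0#
  dot-0ˡ u = sum-0 (λ i → zeroˡ (u i))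

  dot-+ˡ : ∀ {n} (a b u : Fin n → Carrier) → dot (λ i → a i + b i) u ≈ dot a u + dot b u
  dot-+ˡ a b u = trans (dot-comm _ u) (trans (dot-+ u a b) (+-cong (dot-comm u a) (dot-comm u b)))

  dot-·ˡ : ∀ {n} (a u : Fin n → Carrier) x → dot (λ i → x * a i) u ≈ x * dot a u
  dot-·ˡ a u x = trans (dot-comm _ u) (trans (dot-· u a x) (*-congˡ (dot-comm u a)))

  dot-- : ∀ {n} (a u v : Fin n → Carrier) → dot a (λ i → u i - v i) ≈ dot a u - dot a v
  dot-- a u v = trans (sum-cong (λ i → solve 3 (λ a u v → a :* (u :- v) := a :* u :- a :* v) refl (a i) (u i) (v i)))
    (sum-- _ _)

  dot-sum : ∀ {n l} (a : Fin n → Carrier) (x : Fin l → Carrier) (G : Fin l → Fin n → Carrier) →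
            dot a (λ i → dot x (λ j → G j i)) ≈ dot x (λ j → dot a (G j))
  dot-sum a x G = trans (sum-cong (λ i → *-distribˡ-sum (a i) _)) (trans (sum-comm _)
    (sum-cong (λ j → dot-· a (G j) (x j))))

-- Finite generation of kernels over a commutative ring.

module Coherence {c ℓ} (R : CommutativeRing c ℓ) where
  open CommutativeRing R hiding (zero)
  open Sums R
  open DoubleNegation
  open RingSolver R

  vectors : ℕ → RawModule c c ℓ
  vectors q = record
    { Scalar = Carrier ; Vector = Fin q → Carrier ; _≈_ = λ u v → ∀ i → u i ≈ v i
    ; 0# = λ _ → 0# ; _+_ = λ u v i → u i + v i ; _·_ = λ a u i → a * u i }

  Kernel : ∀ {q} → (Fin q → Carrier) → (Fin q → Carrier) → Set ℓ
  Kernel c u = dot c u ≈ 0#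

  Generates : ∀ {a q} → List (Fin q → Carrier) → ((Fin q → Carrier) → Set a) → Set (a ⊔ c ⊔ ℓ)
  Generates {q = q} G P = All P G × (∀ u → P u → Span (vectors q) G u)

  -- The double negation covers only the existence of generators, where a pivot has to be searched
  -- for; once they are given, `Generates` yields membership exactly.
  Coherent : Set (c ⊔ ℓ)
  Coherent = ∀ {q} (a : Fin q → Carrier) → ¬¬ (∃ λ G → Generates G (Kernel a))

  span-sum : ∀ {q l G} (x : Fin l → Carrier) (g : Fin l → Fin q → Carrier) → (∀ j → Span (vectors q) G (g j)) →
             Span (vectors q) G (λ i → dot x (λ j → g j i))
  span-sum {l = zero}  x g h = resp (λ i → reflexive (≡.sym (sum-zero _))) null
  span-sum {l = suc l} x g h = resp (λ i → reflexive (≡.sym (sum-suc _)))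
    (add (scale (x zero) (h zero)) (span-sum (x ∘ suc) (g ∘ suc) (h ∘ suc)))

  basis-generates : ∀ {a q} {P : (Fin q → Carrier) → Set a} → (∀ u → P u) →
                    Generates (tabulate δ) P
  basis-generates {q = q} p = All.tabulate⁺ (λ i → p (δ i)) , λ u _ →
    resp (dot-δʳ u) (span-sum u δ (λ i → gen (∈-tabulate⁺ i)))

  comb : ∀ {q} (G : List (Fin q → Carrier)) → (Fin (length G) → Carrier) → Fin q → Carrier
  comb G a i = dot a (λ j → lookup G j i)

  coefficients : ∀ {q} {G : List (Fin q → Carrier)} {u} → Span (vectors q) G u →
                 ∃ λ a → ∀ i → u i ≈ comb G a i
  coefficients (gen g) = δ (index g) , λ i →
    trans (reflexive (≡.cong (λ v → v i) (lookup-index g))) (sym (sum-δ (index g) _))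
  coefficients {G = G} null = (λ _ → 0#) , λ i → sym (dot-0ˡ {length G} _)
  coefficients (add p q) with coefficients p | coefficients q
  ... | a , e | b , f = (λ j → a j + b j) , λ i → trans (+-cong (e i) (f i))
    (sym (dot-+ˡ a b _))
  coefficients (scale x p) with coefficients p
  ... | a , e = (λ j → x * a j) , λ i → trans (*-congˡ (e i))
    (sym (dot-·ˡ a _ x))
  coefficients (resp eq p) with coefficients p
  ... | a , e = a , λ i → trans (sym (eq i)) (e i)

  comb-linear : ∀ {q} (G : List (Fin q → Carrier)) → Semilinear (vectors (length G)) (vectors q)
  comb-linear G = record
    { onScalar = λ a → a
    ; apply = comb G
    ; cong = λ e i → dot-cong e (λ _ → refl)
    ; homo-0 = λ i → sym (dot-0ˡ {length G} _)
    ; homo-+ = λ a b i → sym (dot-+ˡ a b _)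
    ; homo-· = λ x a i → sym (dot-·ˡ a _ x)
    }

  -- The kernel of the first row is spanned by some `G`. Written in coefficients with respect to
  -- `G`, the other rows form a shorter system, whose solutions are carried back by `comb G`.
  coherent-matrix : Coherent → ∀ {p q} (A : Fin p → Fin q → Carrier) →
                    ¬¬ (∃ λ G → Generates G (λ u → ∀ k → Kernel (A k) u))
  coherent-matrix coh {zero}  A = return (tabulate δ , basis-generates (λ u ()))
  coherent-matrix coh {suc p} A =
    coh (A zero) >>= λ { (G , G-ker , G-gen) →
    coherent-matrix coh (λ k j → dot (A (suc k)) (lookup G j)) >>= λ { (H , H-ker , H-gen) →
    return (map (comb G) H
      , All.map⁺ (All.map (λ {h} ker → λ
          { zero    → trans (dot-sum (A zero) h (lookup G))
                      (sum-0 (λ j → trans (*-congˡ (All.lookup G-ker (∈-lookup j))) (zeroʳ _)))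
          ; (suc k) → trans (dot-sum (A (suc k)) h (lookup G)) (trans (dot-comm h _) (ker k)) }) H-ker)
      , λ u ker → let (a , e) = coefficients (G-gen u (ker zero)) in
          resp (λ i → sym (e i)) (Semilinear.span-map (comb-linear G) (H-gen a (λ k →
            trans (dot-comm _ a) (trans (sym (dot-sum (A (suc k)) a (lookup G)))
            (trans (dot-cong (λ _ → refl) (λ i → sym (e i))) (ker (suc k)))))))) }}

-- Multivariate polynomials and their values.

module Polynomials {c ℓ} (F : Field c ℓ) where
  open Field F hiding (zero)
  open Algebra.Properties.Ring ring using (-0#≈0#)
  open RingSolver commutativeRing
  private module SF = Sums commutativeRing

  infixr 5 _◂_
  -- Polynomials in n variables, as lists of coefficients with respect to the first variable.
  data Pol : ℕ → Set c where
    con : Carrier → Pol 0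
    nil : ∀ {n} → Pol (suc n)
    _◂_ : ∀ {n} → Pol n → Pol (suc n) → Pol (suc n)

  ev : ∀ {n} → Pol n → Vec Carrier n → Carrier
  ev (con a) v       = a
  ev nil     v       = 0#
  ev (a ◂ f) (x ∷ v) = ev a v + x * ev f (x ∷ v)

  infix 4 _≋_
  -- Equality of polynomial functions, which reduces every ring law to a law of the field. Over an
  -- infinite field nothing is lost: `◂-zero` recovers the coefficients.
  record _≋_ {n} (f g : Pol n) : Set (c ⊔ ℓ) where
    constructor pw
    field at : ∀ v → ev f v ≈ ev g v
  open _≋_ public

  constant : ∀ {n} → Carrier → Pol n
  constant {zero}  a = con a
  constant {suc n} a = constant a ◂ nil

  0P : ∀ {n} → Pol n
  0P {zero}  = con 0#
  0P {suc n} = nil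

  1P : ∀ {n} → Pol n
  1P = constant 1#

  infixl 6 _⊕_
  infixl 7 _⊛_

  ev-0 : ∀ {n} (v : Vec Carrier n) → ev 0P v ≈ 0#
  ev-0 []      = refl
  ev-0 (x ∷ v) = refl

  ev-shift : ∀ {n} (f : Pol (suc n)) x v → ev (0P ◂ f) (x ∷ v) ≈ x * ev f (x ∷ v)
  ev-shift f x v = trans (+-congʳ (ev-0 v)) (+-identityˡ _)

  -- Opaque, so that unification never unfolds the arithmetic; it is known through its values only.
  abstract
    _⊕_ : ∀ {n} → Pol n → Pol n → Pol n
    con a   ⊕ con b   = con (a + b)
    nil     ⊕ g       = g
    (a ◂ f) ⊕ nil     = a ◂ f
    (a ◂ f) ⊕ (b ◂ g) = (a ⊕ b) ◂ (f ⊕ g)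

    neg : ∀ {n} → Pol n → Pol n
    neg (con a) = con (- a)
    neg nil     = nil
    neg (a ◂ f) = neg a ◂ neg f

    mutual
      _⊛_ : ∀ {n} → Pol n → Pol n → Pol n
      con a   ⊛ con b = con (a * b)
      nil     ⊛ g     = nil
      (a ◂ f) ⊛ g     = (a ∙ g) ⊕ (0P ◂ (f ⊛ g))

      _∙_ : ∀ {n} → Pol n → Pol (suc n) → Pol (suc n)
      a ∙ nil     = nil
      a ∙ (b ◂ g) = (a ⊛ b) ◂ (a ∙ g)

    ev-+ : ∀ {n} (f g : Pol n) v → ev (f ⊕ g) v ≈ ev f v + ev g v
    ev-+ (con a) (con b) v = refl
    ev-+ nil     g       v = sym (+-identityˡ _)
    ev-+ (a ◂ f) nil     v = sym (+-identityʳ _)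
    ev-+ (a ◂ f) (b ◂ g) (x ∷ v) = trans (+-cong (ev-+ a b v) (*-congˡ (ev-+ f g (x ∷ v))))
      (solve 5 (λ a b x f g → (a :+ b) :+ x :* (f :+ g) := (a :+ x :* f) :+ (b :+ x :* g)) refl _ _ x _ _)

    ev-neg : ∀ {n} (f : Pol n) v → ev (neg f) v ≈ - ev f v
    ev-neg (con a) v       = refl
    ev-neg nil     v       = sym -0#≈0#
    ev-neg (a ◂ f) (x ∷ v) = trans (+-cong (ev-neg a v) (*-congˡ (ev-neg f (x ∷ v))))
      (solve 3 (λ a x f → :- a :+ x :* :- f := :- (a :+ x :* f)) refl _ x _)

    mutual
      ev-* : ∀ {n} (f g : Pol n) v → ev (f ⊛ g) v ≈ ev f v * ev g v
      ev-* (con a) (con b) v       = refl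
      ev-* nil     g       v       = sym (zeroˡ _)
      ev-* (a ◂ f) g       (x ∷ v) = trans (ev-+ (a ∙ g) (0P ◂ (f ⊛ g)) (x ∷ v))
        (trans (+-cong (ev-∙ a g x v) (trans (ev-shift (f ⊛ g) x v) (*-congˡ (ev-* f g (x ∷ v)))))
        (solve 4 (λ a x f g → a :* g :+ x :* (f :* g) := (a :+ x :* f) :* g) refl _ x _ _))

      ev-∙ : ∀ {n} (a : Pol n) g x v → ev (a ∙ g) (x ∷ v) ≈ ev a v * ev g (x ∷ v)
      ev-∙ a nil     x v = sym (zeroʳ _)
      ev-∙ a (b ◂ g) x v = trans (+-cong (ev-* a b v) (*-congˡ (ev-∙ a g x v)))
        (solve 4 (λ a b x g → a :* b :+ x :* (a :* g) := a :* (b :+ x :* g)) refl _ _ x _)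

  ι : ∀ {n} → Pol n → Pol (suc n)
  ι a = a ◂ nil

  X : ∀ {n} → Pol (suc n)
  X = 0P ◂ 1P ◂ nil

  var : ∀ {n} → Fin n → Pol n
  var zero    = X
  var (suc i) = ι (var i)

  sub : ∀ {k n} → Pol k → Vec (Pol n) k → Pol n
  sub (con a) gs       = constant a
  sub nil     gs       = 0P
  sub (a ◂ f) (g ∷ gs) = sub a gs ⊕ (g ⊛ sub f (g ∷ gs))

  evs : ∀ {k n} → Vec (Pol n) k → Vec Carrier n → Vec Carrier k
  evs gs v = Vec.map (λ g → ev g v) gs

  ev-constant : ∀ {n} a (v : Vec Carrier n) → ev (constant a) v ≈ a
  ev-constant a []      = refl
  ev-constant a (x ∷ v) = trans (+-cong (ev-constant a v) (zeroʳ x)) (+-identityʳ a)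

  ev-ι : ∀ {n} (a : Pol n) x v → ev (ι a) (x ∷ v) ≈ ev a v
  ev-ι a x v = trans (+-congˡ (zeroʳ x)) (+-identityʳ _)

  ev-var : ∀ {n} (i : Fin n) v → ev (var i) v ≈ Vec.lookup v i
  ev-var zero    (x ∷ v) = trans (ev-shift (1P ◂ nil) x v)
    (trans (*-congˡ (trans (ev-ι 1P x v) (ev-constant 1# v))) (*-identityʳ x))
  ev-var (suc i) (x ∷ v) = trans (ev-ι (var i) x v) (ev-var i v)

  ev-sub : ∀ {k n} (f : Pol k) (gs : Vec (Pol n) k) v → ev (sub f gs) v ≈ ev f (evs gs v)
  ev-sub (con a) gs       v = ev-constant a v
  ev-sub nil     gs       v = ev-0 v
  ev-sub (a ◂ f) (g ∷ gs) v = trans (ev-+ (sub a gs) _ v)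
    (+-cong (ev-sub a gs v) (trans (ev-* g _ v) (*-congˡ (ev-sub f (g ∷ gs) v))))

  infix 4 _≈ᵥ_
  _≈ᵥ_ : ∀ {n} → Vec Carrier n → Vec Carrier n → Set ℓ
  v ≈ᵥ w = ∀ i → Vec.lookup v i ≈ Vec.lookup w i

  ev-cong : ∀ {n} (f : Pol n) {v w} → v ≈ᵥ w → ev f v ≈ ev f w
  ev-cong (con a) e = refl
  ev-cong nil     e = refl
  ev-cong (a ◂ f) {x ∷ v} {y ∷ w} e = +-cong (ev-cong a (e ∘ suc)) (*-cong (e zero) (ev-cong f e))

  lookup-evs : ∀ {k n} (gs : Vec (Pol n) k) v i → Vec.lookup (evs gs v) i ≡ ev (Vec.lookup gs i) v
  lookup-evs gs v i = Vec.lookup-map i (λ g → ev g v) gs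

  polRing : ℕ → CommutativeRing c (c ⊔ ℓ)
  polRing n = record
    { Carrier = Pol n ; _≈_ = _≋_ ; _+_ = _⊕_ ; _*_ = _⊛_ ; -_ = neg ; 0# = 0P ; 1# = 1P
    ; isCommutativeRing = record
      { isRing = record
        { +-isAbelianGroup = record
          { isGroup = record
            { isMonoid = record
              { isSemigroup = record
                { isMagma = record
                  { isEquivalence = record
                    { refl = pw λ v → refl
                    ; sym = λ p → pw λ v → sym (at p v)
                    ; trans = λ p q → pw λ v → trans (at p v) (at q v) }
                  ; ∙-cong = λ {f} {g} {h} {k} p q → pw λ v → trans (ev-+ f h v)
                      (trans (+-cong (at p v) (at q v)) (sym (ev-+ g k v))) }
                ; assoc = λ f g h → pw λ v → trans (ev-+ (f ⊕ g) h v) (trans (+-congʳ (ev-+ f g v))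
                    (trans (+-assoc _ _ _) (sym (trans (ev-+ f (g ⊕ h) v) (+-congˡ (ev-+ g h v)))))) }
              ; identity = (λ f → pw λ v → trans (ev-+ 0P f v) (trans (+-congʳ (ev-0 v)) (+-identityˡ _)))
                         , (λ f → pw λ v → trans (ev-+ f 0P v) (trans (+-congˡ (ev-0 v)) (+-identityʳ _))) }
            ; inverse = (λ f → pw λ v → trans (ev-+ (neg f) f v) (trans (+-congʳ (ev-neg f v))
                          (trans (-‿inverseˡ _) (sym (ev-0 v)))))
                      , (λ f → pw λ v → trans (ev-+ f (neg f) v) (trans (+-congˡ (ev-neg f v))
                          (trans (-‿inverseʳ _) (sym (ev-0 v)))))
            ; ⁻¹-cong = λ {f} {g} p → pw λ v → trans (ev-neg f v) (trans (-‿cong (at p v)) (sym (ev-neg g v))) }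
          ; comm = λ f g → pw λ v → trans (ev-+ f g v) (trans (+-comm _ _) (sym (ev-+ g f v))) }
        ; *-cong = λ {f} {g} {h} {k} p q → pw λ v → trans (ev-* f h v)
            (trans (*-cong (at p v) (at q v)) (sym (ev-* g k v)))
        ; *-assoc = λ f g h → pw λ v → trans (ev-* (f ⊛ g) h v) (trans (*-congʳ (ev-* f g v))
            (trans (*-assoc _ _ _) (sym (trans (ev-* f (g ⊛ h) v) (*-congˡ (ev-* g h v))))))
        ; *-identity = (λ f → pw λ v → trans (ev-* 1P f v) (trans (*-congʳ (ev-constant 1# v)) (*-identityˡ _)))
                     , (λ f → pw λ v → trans (ev-* f 1P v) (trans (*-congˡ (ev-constant 1# v)) (*-identityʳ _)))
        ; distrib = (λ f g h → pw λ v → trans (ev-* f (g ⊕ h) v) (trans (*-congˡ (ev-+ g h v))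
                      (trans (distribˡ _ _ _) (sym
                          (trans (ev-+ (f ⊛ g) (f ⊛ h) v) (+-cong (ev-* f g v) (ev-* f h v)))))))
                  , (λ f g h → pw λ v → trans (ev-* (g ⊕ h) f v) (trans (*-congʳ (ev-+ g h v))
                      (trans (distribʳ _ _ _) (sym
                          (trans (ev-+ (g ⊛ f) (h ⊛ f) v) (+-cong (ev-* g f v) (ev-* h f v)))))))
        }
      ; *-comm = λ f g → pw λ v → trans (ev-* f g v) (trans (*-comm _ _) (sym (ev-* g f v))) } }

  module P {n} = CommutativeRing (polRing n)
  module PS {n} = Sums (polRing n)
  module SolveP {n} = RingSolver (polRing n)

  infixl 6 _⊖_
  _⊖_ : ∀ {n} → Pol n → Pol n → Pol n
  f ⊖ g = f ⊕ neg g

  ev-- : ∀ {n} (f g : Pol n) v → ev (f ⊖ g) v ≈ ev f v - ev g v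
  ev-- f g v = trans (ev-+ f (neg g) v) (+-congˡ (ev-neg g v))

  ev-sum : ∀ {m n} (f : Fin m → Pol n) v → ev (PS.sum f) v ≈ SF.sum (λ i → ev (f i) v)
  ev-sum {zero}  f v = trans (reflexive (≡.cong (λ g → ev g v) (PS.sum-zero f)))
    (trans (ev-0 v) (reflexive (≡.sym (SF.sum-zero _))))
  ev-sum {suc m} f v = trans (reflexive (≡.cong (λ g → ev g v) (PS.sum-suc f)))
    (trans (ev-+ (f zero) _ v) (trans (+-congˡ (ev-sum (f ∘ suc) v)) (reflexive (≡.sym (SF.sum-suc _)))))

  sub-cong : ∀ {k n} {f g : Pol k} (hs : Vec (Pol n) k) → f ≋ g → sub f hs ≋ sub g hs
  sub-cong {f = f} {g} hs e = pw λ v → trans (ev-sub f hs v) (trans (at e (evs hs v)) (sym (ev-sub g hs v)))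

  sub-+ : ∀ {k n} (f g : Pol k) (hs : Vec (Pol n) k) → sub (f ⊕ g) hs ≋ sub f hs ⊕ sub g hs
  sub-+ f g hs = pw λ v → trans (ev-sub (f ⊕ g) hs v) (trans (ev-+ f g _)
    (sym (trans (ev-+ (sub f hs) (sub g hs) v) (+-cong (ev-sub f hs v) (ev-sub g hs v)))))

  sub-* : ∀ {k n} (f g : Pol k) (hs : Vec (Pol n) k) → sub (f ⊛ g) hs ≋ sub f hs ⊛ sub g hs
  sub-* f g hs = pw λ v → trans (ev-sub (f ⊛ g) hs v) (trans (ev-* f g _)
    (sym (trans (ev-* (sub f hs) (sub g hs) v) (*-cong (ev-sub f hs v) (ev-sub g hs v)))))

  sub-0 : ∀ {k n} (hs : Vec (Pol n) k) → sub 0P hs ≋ 0P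
  sub-0 hs = pw λ v → trans (ev-sub 0P hs v) (trans (ev-0 (evs hs v)) (sym (ev-0 v)))

  sub-var : ∀ {k n} (i : Fin k) (hs : Vec (Pol n) k) → sub (var i) hs ≋ Vec.lookup hs i
  sub-var i hs = pw λ v → trans (ev-sub (var i) hs v) (trans (ev-var i _) (reflexive (lookup-evs hs v i)))

  sub-sub : ∀ {k m n} (f : Pol k) (gs : Vec (Pol m) k) (hs : Vec (Pol n) m) →
            sub (sub f gs) hs ≋ sub f (Vec.map (λ g → sub g hs) gs)
  sub-sub f gs hs = pw λ v → trans (ev-sub (sub f gs) hs v) (trans (ev-sub f gs (evs hs v))
    (trans (ev-cong f (λ i → trans (reflexive (lookup-evs gs (evs hs v) i))
       (trans (sym (ev-sub (Vec.lookup gs i) hs v))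
           (reflexive (≡.sym (≡.trans (lookup-evs (Vec.map (λ g → sub g hs) gs) v i)
         (≡.cong (λ g → ev g v) (Vec.lookup-map i (λ g → sub g hs) gs))))))))
      (sym (ev-sub f (Vec.map (λ g → sub g hs) gs) v))))

  ◂-cong : ∀ {n} {a b : Pol n} {f g} → a ≋ b → f ≋ g → (a ◂ f) ≋ (b ◂ g)
  ◂-cong p q = pw λ { (x ∷ v) → +-cong (at p v) (*-congˡ (at q (x ∷ v))) }

  ◂-split : ∀ {n} (a : Pol n) f → (a ◂ f) ≋ ι a ⊕ X ⊛ f
  ◂-split a f = pw λ { (x ∷ v) → sym (trans (ev-+ (ι a) (X ⊛ f) (x ∷ v))
    (+-cong (ev-ι a x v) (trans (ev-* X f (x ∷ v)) (*-congʳ (ev-var zero (x ∷ v)))))) }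

  ◂-+ : ∀ {n} (a b : Pol n) f g → (a ◂ f) ⊕ (b ◂ g) ≋ ((a ⊕ b) ◂ (f ⊕ g))
  ◂-+ a b f g = pw λ { (x ∷ v) → trans (ev-+ (a ◂ f) (b ◂ g) (x ∷ v)) (trans
    (solve 5 (λ a b x f g → (a :+ x :* f) :+ (b :+ x :* g) := (a :+ b) :+ x :* (f :+ g)) refl _ _ x _ _)
    (sym (+-cong (ev-+ a b v) (*-congˡ (ev-+ f g (x ∷ v)))))) }

  ◂-neg : ∀ {n} (a : Pol n) f → neg (a ◂ f) ≋ (neg a ◂ neg f)
  ◂-neg a f = pw λ { (x ∷ v) → trans (ev-neg (a ◂ f) (x ∷ v)) (trans
    (solve 3 (λ a x f → :- (a :+ x :* f) := :- a :+ x :* :- f) refl _ x _)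
    (sym (+-cong (ev-neg a v) (*-congˡ (ev-neg f (x ∷ v)))))) }

-- Consequences of the infinitude of the field.

module InfiniteField {c ℓ} (F : Field c ℓ) (ac : FieldDefs.AlgebraicallyClosed F) where
  open Field F hiding (zero)
  open FieldDefs F using (∑; pow)
  open RingSolver commutativeRing
  open Polynomials F
  open DoubleNegation
  private module SF = Sums commutativeRing

  ∑≈sum : ∀ {n} (f : Fin n → Carrier) → ∑ f ≈ SF.sum f
  ∑≈sum {zero}  f = reflexive (≡.sym (SF.sum-zero f))
  ∑≈sum {suc n} f = trans (+-congˡ (∑≈sum (f ∘ suc))) (reflexive (≡.sym (SF.sum-suc f)))

  cancel : ∀ {x y} → ¬ (x ≈ 0#) → x * y ≈ 0# → y ≈ 0#
  cancel {x} {y} x≉0 e with inverse x x≉0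
  ... | x⁻¹ , inv = trans (sym (*-identityˡ y)) (trans (*-congʳ (sym inv))
    (trans (solve 3 (λ x i y → x :* i :* y := i :* (x :* y)) refl x x⁻¹ y) (trans (*-congˡ e) (zeroʳ _))))

  -≈0 : ∀ {x y} → x - y ≈ 0# → x ≈ y
  -≈0 {x} {y} e = trans (solve 2 (λ x y → x := (x :- y) :+ y) refl x y) (trans (+-congʳ e) (+-identityˡ y))

  monic : ∀ {n} → Vec Carrier n → Carrier → Carrier
  monic []       x = 1#
  monic (b ∷ bs) x = b + x * monic bs x

  monic-pow : ∀ {n} (bs : Vec Carrier n) x →
              monic bs x ≈ pow x n + SF.sum (λ i → Vec.lookup bs i * pow x (toℕ i))
  monic-pow []       x = sym (trans (+-congˡ (reflexive (SF.sum-zero _))) (+-identityʳ _))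
  monic-pow (b ∷ bs) x = trans (+-congˡ (*-congˡ (monic-pow bs x)))
    (trans (solve 4 (λ b x p s → b :+ x :* (p :+ s) := x :* p :+ (b :+ x :* s)) refl b x _ _)
    (+-congˡ (trans (+-cong (sym (*-identityʳ b)) (trans (SF.*-distribˡ-sum x _)
      (SF.sum-cong λ i → solve 3 (λ x b p → x :* (b :* p) := b :* (x :* p)) refl x (Vec.lookup bs i) _)))
      (reflexive (≡.sym (SF.sum-suc _))))))

  monic-root : ∀ {n} (bs : Vec Carrier (suc n)) → ∃ λ x → monic bs x ≈ 0#
  monic-root {n} bs with ac n (Vec.lookup bs)
  ... | x , e = x , trans (monic-pow bs x) (trans (+-congˡ (sym (∑≈sum _))) e)

  -- Multiplication by x - t in one pass: `a` carries the coefficient of the preceding degree, so a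
  -- product starts with `a` = 0.
  monic-step : ∀ {n} → Carrier → Carrier → Vec Carrier n → Vec Carrier (suc n)
  monic-step t a []       = (a - t) ∷ []
  monic-step t a (b ∷ bs) = (a - t * b) ∷ monic-step t b bs

  monic-step-correct : ∀ {n} t a (bs : Vec Carrier n) x → monic (monic-step t a bs) x ≈ a + (x - t) * monic bs x
  monic-step-correct t a []       x = trans (+-congˡ (*-identityʳ x))
    (trans (solve 3 (λ a t x → (a :- t) :+ x := a :+ (x :- t)) refl a t x) (+-congˡ (sym (*-identityʳ _))))
  monic-step-correct t a (b ∷ bs) x = trans (+-congˡ (*-congˡ (monic-step-correct t b bs x)))
    (solve 5 (λ a t b x m → (a :- t :* b) :+ x :* (b :+ (x :- t) :* m) := a :+ (x :- t) :* (b :+ x :* m))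
      refl a t b x (monic bs x))

  rootProduct : List Carrier → Carrier → Carrier
  rootProduct []       x = 1#
  rootProduct (t ∷ ts) x = (x - t) * rootProduct ts x

  rootProduct-monic : ∀ ts → ∃ λ bs → ∀ x → monic {length ts} bs x ≈ rootProduct ts x
  rootProduct-monic []       = [] , λ x → refl
  rootProduct-monic (t ∷ ts) with rootProduct-monic ts
  ... | bs , e = monic-step t 0# bs , λ x →
    trans (monic-step-correct t 0# bs x) (trans (+-identityˡ _) (*-congˡ (e x)))

  -- A root of (x - t₁) ⋯ (x - tₙ) - 1 differs from all tᵢ.
  fresh : ∀ t ts → ∃ λ x → All (λ s → ¬ (x ≈ s)) (t ∷ ts)
  fresh t ts = proj₁ root , avoid (t ∷ ts)
      (λ z → 1≉0 (trans (sym (minus-one (proj₁ product) (proj₂ root))) (trans (proj₂ product _) z)))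
    where
    product = rootProduct-monic (t ∷ ts)
    subtract : ∀ {n} → Vec Carrier (suc n) → Vec Carrier (suc n)
    subtract (b ∷ bs) = (b - 1#) ∷ bs
    minus-one : ∀ {n} (bs : Vec Carrier (suc n)) {x} → monic (subtract bs) x ≈ 0# → monic bs x ≈ 1#
    minus-one (b ∷ bs) {x} r = -≈0 (trans
      (solve 3 (λ b u y → (b :+ y) :- u := (b :- u) :+ y) refl b 1# (x * monic bs x)) r)
    root = monic-root (subtract (proj₁ product))
    avoid : ∀ {x} ts → ¬ (rootProduct ts x ≈ 0#) → All (λ s → ¬ (x ≈ s)) ts
    avoid []       _ = []
    avoid (s ∷ ts) p = (λ x≈s → p (trans (*-congʳ (trans (+-congʳ x≈s) (-‿inverseʳ s))) (zeroˡ _)))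
                     ∷ avoid ts (λ z → p (trans (*-congˡ z) (zeroʳ _)))

  Distinct : List Carrier → Set (c ⊔ ℓ)
  Distinct = AllPairs (λ s t → ¬ (s ≈ t))

  nonzeroPoints : ∀ n → ∃ λ ts → length ts ≡ n × Distinct ts × All (λ t → ¬ (t ≈ 0#)) ts
  nonzeroPoints zero    = [] , ≡.refl , [] , []
  nonzeroPoints (suc n) with nonzeroPoints n
  ... | ts , l , d , z with fresh 0# ts
  ...   | x , x≉0 ∷ x≉ = x ∷ ts , ≡.cong suc l , x≉ ∷ d , x≉0 ∷ z

  horner : List Carrier → Carrier → Carrier
  horner []       x = 0#
  horner (a ∷ as) x = a + x * horner as x

  suffixValues : Carrier → List Carrier → List Carrier
  suffixValues t []       = []
  suffixValues t (a ∷ as) = horner (a ∷ as) t ∷ suffixValues t as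

  length-suffixValues : ∀ t as → length (suffixValues t as) ≡ length as
  length-suffixValues t []       = ≡.refl
  length-suffixValues t (a ∷ as) = ≡.cong suc (length-suffixValues t as)

  -- Synthetic division by x - t.
  horner-divide : ∀ t a as x → horner (a ∷ as) x ≈ horner (a ∷ as) t + (x - t) * horner (suffixValues t as) x
  horner-divide t a []       x = solve 3 (λ a x t → a :+ x :* con (0 , 0) := (a :+ t :* con (0 , 0)) :+
      (x :- t) :* con (0 , 0)) refl a x t
  horner-divide t a (b ∷ as) x = trans (+-congˡ (*-congˡ (horner-divide t b as x)))
    (solve 5 (λ a x t h q → a :+ x :* (h :+ (x :- t) :* q) := (a :+ t :* h) :+ (x :- t) :* (h :+ x :* q))
      refl a x t (horner (b ∷ as) t) (horner (suffixValues t as) x))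

  -- Root counting that never tests a coefficient: after division by x - t the difference s - t is
  -- invertible for each remaining point s, so the quotient vanishes there and is shorter by one.
  horner-zero : ∀ as ts → length as ≤ length ts → Distinct ts → All (λ t → horner as t ≈ 0#) ts →
                ∀ x → horner as x ≈ 0#
  horner-zero []       ts       _         _        _        x = refl
  horner-zero (a ∷ as) (t ∷ ts) (s≤s len) (t≉ ∷ d) (z ∷ zs) x =
    trans (horner-divide t a as x) (trans (+-cong z (trans (*-congˡ
      (horner-zero (suffixValues t as) ts (≡.subst (_≤ length ts) (≡.sym (length-suffixValues t as)) len) d
        (quotient-zero ts t≉ zs) x)) (zeroʳ _))) (+-identityˡ 0#))
    where
    quotient-zero : ∀ ss → All (λ s → ¬ (t ≈ s)) ss → All (λ s → horner (a ∷ as) s ≈ 0#) ss →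
                    All (λ s → horner (suffixValues t as) s ≈ 0#) ss
    quotient-zero []       _          _        = []
    quotient-zero (s ∷ ss) (t≉s ∷ t≉) (w ∷ ws) =
      cancel (λ e → t≉s (sym (-≈0 e)))
        (trans (sym (+-identityˡ _)) (trans (+-congʳ (sym z)) (trans (sym (horner-divide t a as s)) w)))
      ∷ quotient-zero ss t≉ ws

  horner-zero-coefficients : ∀ as → (∀ x → horner as x ≈ 0#) → All (_≈ 0#) as
  horner-zero-coefficients []       z = []
  horner-zero-coefficients (a ∷ as) z = a≈0 ∷ horner-zero-coefficients as rest
    where
    a≈0 = trans (sym (trans (+-congˡ (zeroˡ _)) (+-identityʳ a))) (z 0#)
    rest : ∀ x → horner as x ≈ 0#
    -- Without its constant term the polynomial is x times the rest; x can be cancelled at nonzero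
    -- points, and `length as` of them determine the rest, also at 0.
    rest with nonzeroPoints (length as)
    ... | ts , l , d , nz = horner-zero as ts (ℕₚ.≤-reflexive (≡.sym l)) d
      (All.map (λ {t} t≉0 → cancel t≉0 (trans (sym (+-identityˡ _)) (trans (+-congʳ (sym a≈0)) (z t)))) nz)

  coeffs : ∀ {n} → Pol (suc n) → Vec Carrier n → List Carrier
  coeffs nil     v = []
  coeffs (a ◂ f) v = ev a v ∷ coeffs f v

  size : ∀ {n} → Pol (suc n) → ℕ
  size nil     = 0
  size (a ◂ f) = suc (size f)

  length-coeffs : ∀ {n} (f : Pol (suc n)) v → length (coeffs f v) ≡ size f
  length-coeffs nil     v = ≡.refl
  length-coeffs (a ◂ f) v = ≡.cong suc (length-coeffs f v)

  ev-horner : ∀ {n} (f : Pol (suc n)) x v → ev f (x ∷ v) ≡ horner (coeffs f v) x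
  ev-horner nil     x v = ≡.refl
  ev-horner (a ◂ f) x v = ≡.cong (λ y → ev a v + x * y) (ev-horner f x v)

  -- For fixed `v` a polynomial in one variable vanishes identically, so the values at `v` of all
  -- its coefficients are zero; letting `v` vary gives the identities.
  ◂-zero : ∀ {n} {a : Pol n} {f} → (a ◂ f) ≋ 0P → a ≋ 0P × f ≋ 0P
  ◂-zero {n} {a} {f} e =
      (pw λ v → trans (All.head (zeros v)) (sym (ev-0 v)))
    , (pw λ { (x ∷ v) → trans (reflexive (ev-horner f x v)) (all-zero (All.tail (zeros v))) })
    where
    zeros : ∀ v → All (_≈ 0#) (coeffs (a ◂ f) v)
    zeros v = horner-zero-coefficients _ (λ x → trans (reflexive (≡.sym (ev-horner (a ◂ f) x v))) (at e (x ∷ v)))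
    all-zero : ∀ {as x} → All (_≈ 0#) as → horner as x ≈ 0#
    all-zero []       = refl
    all-zero (p ∷ ps) = trans (+-cong p (trans (*-congˡ (all-zero ps)) (zeroʳ _))) (+-identityˡ _)

  zero-at-points : ∀ {n} (f : Pol (suc n)) v ts → size f ≤ length ts → Distinct ts →
                   All (λ t → ev f (t ∷ v) ≈ 0#) ts → ∀ x → ev f (x ∷ v) ≈ 0#
  zero-at-points f v ts len d zs x = trans (reflexive (ev-horner f x v))
    (horner-zero (coeffs f v) ts (≡.subst (_≤ length ts) (≡.sym (length-coeffs f v)) len) d
      (All.map (λ {t} z → trans (reflexive (≡.sym (ev-horner f t v))) z) zs) x)

  NonZeroAt : ∀ {n} → Pol n → Vec Carrier n → Set ℓ
  NonZeroAt f v = ¬ (ev f v ≈ 0#)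

  -- The positive alternative is a point of nonvanishing, the form in which nonzero polynomials
  -- enter cancellation and normalisation. Finding it requires comparing field elements with 0,
  -- whence the double negation.
  nonzero-or-zero : ∀ {n} (f : Pol n) → ¬¬ (f ≋ 0P ⊎ ∃ (NonZeroAt f))
  nonzero-or-zero (con a) = lem (a ≈ 0#) >>= λ
    { (inj₁ z) → return (inj₁ (pw λ v → z))
    ; (inj₂ nz) → return (inj₂ ([] , nz)) }
  nonzero-or-zero nil     = return (inj₁ (pw λ v → refl))
  nonzero-or-zero (a ◂ f) = nonzero-or-zero a >>= λ
    { (inj₂ (v , nz)) → return (inj₂ (0# ∷ v , λ e → nz (trans (sym (trans (+-congˡ (zeroˡ _)) (+-identityʳ _))) e)))
    ; (inj₁ a≋0) → nonzero-or-zero f >>= λ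
      { (inj₁ f≋0) → return (inj₁ (P.trans (◂-cong a≋0 f≋0) (pw λ { (x ∷ v) → trans (ev-shift nil x v) (zeroʳ x) })))
      ; (inj₂ (x ∷ v , nz)) → case-points a≋0 x v nz } }
    where
    find : ∀ {p} {P : Carrier → Set p} ts → ¬¬ (All P ts ⊎ ∃ λ t → ¬ P t)
    find []       = return (inj₁ [])
    find {P = P} (t ∷ ts) = lem (P t) >>= λ
      { (inj₂ n) → return (inj₂ (t , n))
      ; (inj₁ p) → find ts >>= λ { (inj₁ ps) → return (inj₁ (p ∷ ps)) ; (inj₂ w) → return (inj₂ w) } }
    -- As `a` is zero, the value at t is t times that of `f`, and t cancels when nonzero. If all
    -- `size f` sample points gave 0, then `f` would vanish on the whole line over `v`, against
    -- `nz`.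
    case-points : a ≋ 0P → ∀ x v → NonZeroAt f (x ∷ v) → ¬¬ ((a ◂ f) ≋ 0P ⊎ ∃ (NonZeroAt (a ◂ f)))
    case-points a≋0 x v nz with nonzeroPoints (size f)
    ... | ts , l , d , t≉0 = find ts >>= λ
      { (inj₁ zs) → contradiction (zero-at-points f v ts (ℕₚ.≤-reflexive (≡.sym l)) d (divide-out ts t≉0 zs) x) nz
      ; (inj₂ (t , n)) → return (inj₂ (t ∷ v , n)) }
      where
      divide-out : ∀ ts → All (λ t → ¬ (t ≈ 0#)) ts → All (λ t → ev (a ◂ f) (t ∷ v) ≈ 0#) ts → All
          (λ t → ev f (t ∷ v) ≈ 0#) ts
      divide-out []       _          _        = []
      divide-out (t ∷ ts) (nz ∷ nzs) (z ∷ zs) =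
        cancel nz (trans (sym (trans (+-congʳ (trans (at a≋0 v) (ev-0 v))) (+-identityˡ _))) z) ∷ divide-out ts nzs zs

  -- Since f(0) is invertible, the constant term of the product forces that of `g` to vanish; a
  -- common factor x is then removed and the argument repeats. No coefficient of `g` is compared
  -- with 0.
  univariate-regular : ∀ (f g : Pol 1) → NonZeroAt f (0# ∷ []) → f ⊛ g ≋ 0P → g ≋ 0P
  univariate-regular f nil     nz e = P.refl
  univariate-regular f (con b ◂ g) nz e =
    P.trans (◂-cong b≋0 (univariate-regular f g nz (proj₂ (◂-zero (P.trans shifted e)))))
      (pw λ { (x ∷ v) → trans (ev-shift nil x v) (zeroʳ x) })
    where
    b≈0 : b ≈ 0#
    b≈0 = trans (sym (trans (+-congˡ (zeroˡ _)) (+-identityʳ b)))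
      (cancel nz (trans (sym (ev-* f (con b ◂ g) _)) (at e (0# ∷ []))))
    b≋0 : con b ≋ 0P
    b≋0 = pw λ v → b≈0
    shifted : (0P ◂ (f ⊛ g)) ≋ f ⊛ (con b ◂ g)
    shifted = pw λ { (x ∷ []) → sym (trans (ev-* f (con b ◂ g) (x ∷ [])) (trans (*-congˡ (+-congʳ b≈0))
      (trans (solve 3 (λ f x g → f :* (con (0 , 0) :+ x :* g) := con (0 , 0) :+ x :* (f :* g)) refl _ x _)
      (+-congˡ (*-congˡ (sym (ev-* f g (x ∷ []))))))) ) }

  -- Restrict to the line from v to an arbitrary point.
  regular : ∀ {n} (f g : Pol n) {v} → NonZeroAt f v → f ⊛ g ≋ 0P → g ≋ 0P
  regular {n} f g {v} nz e = pw λ w → trans (sym (on-line g w 1# (λ i →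
        trans (+-congˡ (*-identityˡ _)) (solve 2 (λ v w → v :+ (w :- v) := w) refl _ _))))
      (trans (at (univariate-regular (sub f (line w)) (sub g (line w))
        (λ z → nz (trans (sym (on-line f w 0# λ i → trans (+-congˡ (zeroˡ _)) (+-identityʳ _)) ) z))
        (P.trans (P.sym (sub-* f g (line w))) (P.trans (sub-cong (line w) e) (sub-0 (line w))))) (1# ∷ []))
      (sym (ev-0 w)))
    where
    line : Vec Carrier n → Vec (Pol 1) n
    line w = Vec.zipWith (λ a b → con a ◂ con (b - a) ◂ nil) v w
    on-line : ∀ h w t {p} → (∀ i → Vec.lookup v i + t * (Vec.lookup w i - Vec.lookup v i) ≈ Vec.lookup p i) →
              ev (sub h (line w)) (t ∷ []) ≈ ev h p
    on-line h w t eq = trans (ev-sub h (line w) _)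
        (ev-cong h λ i → trans (reflexive (≡.trans (lookup-evs (line w) _ i)
        (≡.cong (λ q → ev q (t ∷ [])) (Vec.lookup-zipWith _ i v w))))
      (trans (+-congˡ (*-congˡ (trans (+-congˡ (zeroʳ t)) (+-identityʳ _)))) (eq i)))

  lefts : ∀ {a p q} {A : Set a} {P : A → Set p} {Q : A → Set q} {xs} → All (λ x → P x ⊎ Q x) xs → List A
  lefts []                    = []
  lefts (_∷_ {x} (inj₁ _) hs) = x ∷ lefts hs
  lefts (inj₂ _ ∷ hs)         = lefts hs

  rights : ∀ {a p q} {A : Set a} {P : A → Set p} {Q : A → Set q} {xs} → All (λ x → P x ⊎ Q x) xs → List A
  rights []                    = []
  rights (inj₁ _ ∷ hs)         = rights hs
  rights (_∷_ {x} (inj₂ _) hs) = x ∷ rights hs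

  module _ {a p q} {A : Set a} {P : A → Set p} {Q : A → Set q} where

    length-lefts-rights : ∀ {xs} (hs : All (λ x → P x ⊎ Q x) xs) → length (lefts hs) ℕ.+ length
        (rights hs) ≡ length xs
    length-lefts-rights []            = ≡.refl
    length-lefts-rights (inj₁ _ ∷ hs) = ≡.cong suc (length-lefts-rights hs)
    length-lefts-rights (inj₂ _ ∷ hs) = ≡.trans (ℕₚ.+-suc _ _) (≡.cong suc (length-lefts-rights hs))

    all-lefts : ∀ {xs} (hs : All (λ x → P x ⊎ Q x) xs) → All P (lefts hs)
    all-lefts []            = []
    all-lefts (inj₁ p ∷ hs) = p ∷ all-lefts hs
    all-lefts (inj₂ _ ∷ hs) = all-lefts hs

    all-rights : ∀ {xs} (hs : All (λ x → P x ⊎ Q x) xs) → All Q (rights hs)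
    all-rights []            = []
    all-rights (inj₁ _ ∷ hs) = all-rights hs
    all-rights (inj₂ q ∷ hs) = q ∷ all-rights hs

    restrict-lefts : ∀ {r} {R : A → Set r} {xs} (hs : All (λ x → P x ⊎ Q x) xs) → All R xs → All R (lefts hs)
    restrict-lefts []            []       = []
    restrict-lefts (inj₁ _ ∷ hs) (r ∷ rs) = r ∷ restrict-lefts hs rs
    restrict-lefts (inj₂ _ ∷ hs) (r ∷ rs) = restrict-lefts hs rs

    restrict-rights : ∀ {r} {R : A → Set r} {xs} (hs : All (λ x → P x ⊎ Q x) xs) → All R xs → All R (rights hs)
    restrict-rights []            []       = []
    restrict-rights (inj₁ _ ∷ hs) (r ∷ rs) = restrict-rights hs rs
    restrict-rights (inj₂ _ ∷ hs) (r ∷ rs) = r ∷ restrict-rights hs rs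

    pairs-lefts : ∀ {r} {R : A → A → Set r} {xs} (hs : All (λ x → P x ⊎ Q x) xs) → AllPairs R xs → AllPairs R
        (lefts hs)
    pairs-lefts []            []       = []
    pairs-lefts (inj₁ _ ∷ hs) (r ∷ rs) = restrict-lefts hs r ∷ pairs-lefts hs rs
    pairs-lefts (inj₂ _ ∷ hs) (r ∷ rs) = pairs-lefts hs rs

    pairs-rights : ∀ {r} {R : A → A → Set r} {xs} (hs : All (λ x → P x ⊎ Q x) xs) → AllPairs R xs → AllPairs R
        (rights hs)
    pairs-rights []            []       = []
    pairs-rights (inj₁ _ ∷ hs) (r ∷ rs) = pairs-rights hs rs
    pairs-rights (inj₂ _ ∷ hs) (r ∷ rs) = restrict-rights hs r ∷ pairs-rights hs rs

  specialize : ∀ {n} → Carrier → Pol (suc n) → Pol n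
  specialize t nil     = 0P
  specialize t (a ◂ f) = a ⊕ constant t ⊛ specialize t f

  ev-specialize : ∀ {n} t (f : Pol (suc n)) v → ev (specialize t f) v ≈ ev f (t ∷ v)
  ev-specialize t nil     v = ev-0 v
  ev-specialize t (a ◂ f) v = trans (ev-+ a _ v) (+-congˡ (trans (ev-* (constant t) _ v)
    (*-cong (ev-constant t v) (ev-specialize t f v))))

  maxSize : ∀ {n} → List (Pol (suc n)) → ℕ
  maxSize []       = 0
  maxSize (f ∷ fs) = size f ℕ.⊔ maxSize fs

  VanishAt : ∀ {n} → List (Pol n) → Vec Carrier n → Set (c ⊔ ℓ)
  VanishAt fs v = All (λ f → ev f v ≈ 0#) fs

  vanish-slices : ∀ {n} (fs : List (Pol (suc n))) ts → maxSize fs ≤ length ts → Distinct ts →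
                  All (λ t → ∀ v → VanishAt fs (t ∷ v)) ts → ∀ v → VanishAt fs v
  vanish-slices []       ts len d zs v       = []
  vanish-slices (f ∷ fs) ts len d zs (x ∷ v) =
    zero-at-points f v ts (ℕₚ.≤-trans (ℕₚ.m≤m⊔n _ (maxSize fs)) len) d (All.map (λ z → All.head (z v)) zs) x
    ∷ vanish-slices fs ts (ℕₚ.≤-trans (ℕₚ.m≤n⊔m (size f) _) len) d (All.map (λ z v → All.tail (z v)) zs) (x ∷ v)

  specialize-vanish : ∀ {n} t (fs : List (Pol (suc n))) v →
    (VanishAt fs (t ∷ v) → VanishAt (Data.List.map (specialize t) fs) v) ×
    (VanishAt (Data.List.map (specialize t) fs) v → VanishAt fs (t ∷ v))
  specialize-vanish t []       v = (λ _ → []) , (λ _ → [])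
  specialize-vanish t (f ∷ fs) v with specialize-vanish t fs v
  ... | to , from = (λ { (z ∷ zs) → trans (ev-specialize t f v) z ∷ to zs })
                  , (λ { (z ∷ zs) → trans (sym (ev-specialize t f v)) z ∷ from zs })

  -- Decide on the slices at more points than the degrees: by pigeonhole one of the two alternatives occurs often enough.
  affine-irreducible : ∀ {n} (fs gs : List (Pol n)) → (∀ v → VanishAt fs v ⊎ VanishAt gs v) →
                       (∀ v → VanishAt fs v) ⊎ (∀ v → VanishAt gs v)
  affine-irreducible {zero}  fs gs h with h []
  ... | inj₁ z = inj₁ λ { [] → z }
  ... | inj₂ z = inj₂ λ { [] → z }
  affine-irreducible {suc n} fs gs h = choose (ℕₚ.≤-total (maxSize fs) (length (lefts decided)))
    where
    points : ∃ λ ts → length ts ≡ maxSize fs ℕ.+ maxSize gs × Distinct ts × All (λ t → ¬ (t ≈ 0#)) ts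
    points = nonzeroPoints (maxSize fs ℕ.+ maxSize gs)
    ts = proj₁ points
    slice : ∀ t → (∀ v → VanishAt fs (t ∷ v)) ⊎ (∀ v → VanishAt gs (t ∷ v))
    slice t with affine-irreducible (Data.List.map (specialize t) fs) (Data.List.map (specialize t) gs)
                  (λ v → Data.Sum.map (proj₁ (specialize-vanish t fs v)) (proj₁ (specialize-vanish t gs v))
                      (h (t ∷ v)))
    ... | inj₁ z = inj₁ λ v → proj₂ (specialize-vanish t fs v) (z v)
    ... | inj₂ z = inj₂ λ v → proj₂ (specialize-vanish t gs v) (z v)
    decided = All.universal slice ts
    distinct = proj₁ (proj₂ (proj₂ points))
    choose : (maxSize fs ≤ length (lefts decided)) ⊎ (length (lefts decided) ≤ maxSize fs) →
             (∀ v → VanishAt fs v) ⊎ (∀ v → VanishAt gs v)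
    choose (inj₁ le) = inj₁ (vanish-slices fs _ le (pairs-lefts decided distinct) (all-lefts decided))
    choose (inj₂ ge) = inj₂ (vanish-slices gs _
      (ℕₚ.+-cancelˡ-≤ (length (lefts decided)) _ _ (ℕₚ.≤-trans (ℕₚ.+-monoˡ-≤ (maxSize gs) ge)
        (ℕₚ.≤-reflexive (≡.trans (≡.sym (proj₁ (proj₂ points))) (≡.sym (length-lefts-rights decided))))))
      (pairs-rights decided distinct) (all-rights decided))

-- Degree in the first variable and division by monic polynomials.

module Degrees {c ℓ} (F : Field c ℓ) (ac : FieldDefs.AlgebraicallyClosed F) where
  private module F = Field F
  open Polynomials F
  open InfiniteField F ac
  open DoubleNegation

  module S {n} = RingSolver (polRing n)
  open S

  -≋0 : ∀ {n} {f g : Pol n} → f ⊖ g ≋ 0P → f ≋ g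
  -≋0 {f = f} {g} e = P.trans (solve 2 (λ f g → f := (f :- g) :+ g) P.refl f g)
    (P.trans (P.+-congʳ e) (P.+-identityˡ g))

  ≋-0 : ∀ {n} {f g : Pol n} → f ≋ g → f ⊖ g ≋ 0P
  ≋-0 {g = g} e = P.trans (P.+-congʳ e) (P.-‿inverseʳ g)

  X-shift : ∀ {n} (f : Pol (suc n)) → X ⊛ f ≋ (0P ◂ f)
  X-shift f = pw λ { (x ∷ v) → F.trans (ev-* X f (x ∷ v)) (F.trans (F.*-congʳ (ev-var zero (x ∷ v)))
    (F.sym (ev-shift f x v))) }

  0◂0 : ∀ {n} {a : Pol n} {f} → a ≋ 0P → f ≋ 0P → (a ◂ f) ≋ 0P
  0◂0 p q = P.trans (◂-cong p q) (pw λ { (x ∷ v) → F.trans (ev-shift nil x v) (F.zeroʳ x) })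

  ι-∙ : ∀ {n} (a b : Pol n) g → ι a ⊛ (b ◂ g) ≋ ((a ⊛ b) ◂ (ι a ⊛ g))
  ι-∙ a b g = pw λ { (x ∷ v) → F.trans (ev-* (ι a) (b ◂ g) (x ∷ v)) (F.trans (F.*-congʳ (ev-ι a x v))
    (F.sym (F.trans (F.+-cong (ev-* a b v) (F.*-congˡ (F.trans (ev-* (ι a) g (x ∷ v)) (F.*-congʳ (ev-ι a x v)))))
      (solveF 4 (λ a b x g → a F:* b F:+ x F:* (a F:* g) F:= a F:* (b F:+ x F:* g)) F.refl _ _ x _)))) }
    where open RingSolver F.commutativeRing renaming (solve to solveF; _:*_ to _F:*_; _:+_ to _F:+_; _:=_ to _F:=_) hiding (_:-_; :-_; con)

  ◂-injective : ∀ {n} {a b : Pol n} {f g} → (a ◂ f) ≋ (b ◂ g) → a ≋ b × f ≋ g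
  ◂-injective e with ◂-zero (P.trans (P.sym (P.trans (P.+-congˡ (◂-neg _ _)) (◂-+ _ _ _ _))) (≋-0 e))
  ... | p , q = -≋0 p , -≋0 q

  poly : ∀ {n d} → (Fin d → Pol n) → Pol (suc n)
  poly {d = zero}  a = nil
  poly {d = suc d} a = a zero ◂ poly (a ∘ suc)

  poly-cong : ∀ {n d} {a b : Fin d → Pol n} → (∀ i → a i ≋ b i) → poly a ≋ poly b
  poly-cong {d = zero}  e = P.refl
  poly-cong {d = suc d} e = ◂-cong (e zero) (poly-cong (e ∘ suc))

  poly-+ : ∀ {n d} (a b : Fin d → Pol n) → poly a ⊕ poly b ≋ poly (λ i → a i ⊕ b i)
  poly-+ {d = zero}  a b = P.+-identityˡ 0P
  poly-+ {d = suc d} a b = P.trans (◂-+ _ _ _ _) (◂-cong P.refl (poly-+ (a ∘ suc) (b ∘ suc)))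

  poly-neg : ∀ {n d} (a : Fin d → Pol n) → neg (poly a) ≋ poly (λ i → neg (a i))
  poly-neg {d = zero}  a = solve 0 (:- con (0 , 0) := con (0 , 0)) P.refl
  poly-neg {d = suc d} a = P.trans (◂-neg _ _) (◂-cong P.refl (poly-neg (a ∘ suc)))

  poly-· : ∀ {n d} x (a : Fin d → Pol n) → ι x ⊛ poly a ≋ poly (λ i → x ⊛ a i)
  poly-· {d = zero}  x a = P.zeroʳ (ι x)
  poly-· {d = suc d} x a = P.trans (ι-∙ x (a zero) _) (◂-cong P.refl (poly-· x (a ∘ suc)))

  poly-0 : ∀ {n d} {a : Fin d → Pol n} → (∀ i → a i ≋ 0P) → poly a ≋ 0P
  poly-0 {d = zero}  z = P.refl
  poly-0 {d = suc d} z = 0◂0 (z zero) (poly-0 (z ∘ suc))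

  poly-zero : ∀ {n d} {a : Fin d → Pol n} → poly a ≋ 0P → ∀ i → a i ≋ 0P
  poly-zero e zero    = proj₁ (◂-zero e)
  poly-zero e (suc i) = poly-zero (proj₂ (◂-zero e)) i

  -- An upper bound in place of a degree, because it is undecidable which coefficient is the last
  -- nonzero one; equality up to `_≋_` allows padding by zeros.
  deg< : ∀ {n} → ℕ → Pol (suc n) → Set (c ⊔ ℓ)
  deg< {n} d f = ∃ λ (a : Fin d → Pol n) → f ≋ poly a

  deg<-resp : ∀ {n d} {f g : Pol (suc n)} → f ≋ g → deg< d f → deg< d g
  deg<-resp e (a , p) = a , P.trans (P.sym e) p

  deg<-0 : ∀ {n} d {f : Pol (suc n)} → f ≋ 0P → deg< d f
  deg<-0 d z = (λ _ → 0P) , P.trans z (P.sym (poly-0 (λ _ → P.refl)))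

  deg<-+ : ∀ {n d} {f g : Pol (suc n)} → deg< d f → deg< d g → deg< d (f ⊕ g)
  deg<-+ (a , p) (b , q) = _ , P.trans (P.+-cong p q) (poly-+ a b)

  deg<-· : ∀ {n d} x {f : Pol (suc n)} → deg< d f → deg< d (ι x ⊛ f)
  deg<-· x (a , p) = _ , P.trans (P.*-congˡ p) (poly-· x a)

  deg<-neg : ∀ {n d} {f : Pol (suc n)} → deg< d f → deg< d (neg f)
  deg<-neg (a , p) = _ , P.trans (P.-‿cong p) (poly-neg a)

  deg<-cons : ∀ {n d} a {f : Pol (suc n)} → deg< d f → deg< (suc d) (a ◂ f)
  deg<-cons a (b , p) = (λ { zero → a ; (suc i) → b i }) , ◂-cong P.refl p

  deg<-X : ∀ {n d} {f : Pol (suc n)} → deg< d f → deg< (suc d) (X ⊛ f)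
  deg<-X {f = f} p = deg<-resp (P.sym (X-shift f)) (deg<-cons 0P p)

  deg<-mono : ∀ {n d e} {f : Pol (suc n)} → d ≤ e → deg< d f → deg< e f
  deg<-mono {e = e} z≤n     (a , p) = deg<-0 e p
  deg<-mono         (s≤s l) (a , p) = deg<-resp (P.sym p) (deg<-cons (a zero) (deg<-mono l (a ∘ suc , P.refl)))

  deg<-ι : ∀ {n d} (a : Pol n) → deg< (suc d) (ι a)
  deg<-ι {d = d} a = deg<-cons a (deg<-0 d P.refl)

  deg<-size : ∀ {n} (f : Pol (suc n)) → deg< (size f) f
  deg<-size nil     = (λ ()) , P.refl
  deg<-size (a ◂ f) = deg<-cons a (deg<-size f)

  deg<-sum : ∀ {n m d} {f : Fin m → Pol (suc n)} → (∀ i → deg< d (f i)) → deg< d (PS.sum f)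
  deg<-sum {m = zero}  {d} h = deg<-0 d (P.reflexive (PS.sum-zero _))
  deg<-sum {m = suc m} {d} h = deg<-resp (P.reflexive (≡.sym (PS.sum-suc _))) (deg<-+ (h zero) (deg<-sum (h ∘ suc)))

  deg<-* : ∀ {n d e} {f g : Pol (suc n)} → deg< d f → deg< e g → deg< (d ℕ.+ e) (f ⊛ g)
  deg<-* {d = zero}  {e} {g = g} (a , p) q = deg<-0 e (P.trans (P.*-congʳ p) (P.zeroˡ g))
  deg<-* {d = suc d} {e} {g = g} (a , p) q = deg<-resp
    (P.sym (P.trans (P.*-congʳ (P.trans p (◂-split (a zero) (poly (a ∘ suc)))))
      (solve 4 (λ a x f g → (a :+ x :* f) :* g := a :* g :+ x :* (f :* g)) P.refl _ X _ g)))
    (deg<-+ (deg<-mono (ℕₚ.m≤n+m e (suc d)) (deg<-· (a zero) q)) (deg<-X (deg<-* {d = d} (a ∘ suc , P.refl) q)))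

  monomial : ∀ {n} → ℕ → Pol n → Pol (suc n)
  monomial zero    a = ι a
  monomial (suc d) a = 0P ◂ monomial d a

  monomial-cong : ∀ {n} d {a b : Pol n} → a ≋ b → monomial d a ≋ monomial d b
  monomial-cong zero    e = ◂-cong e P.refl
  monomial-cong (suc d) e = ◂-cong P.refl (monomial-cong d e)

  monomial-0 : ∀ {n} d {a : Pol n} → a ≋ 0P → monomial d a ≋ 0P
  monomial-0 zero    z = 0◂0 z P.refl
  monomial-0 (suc d) z = 0◂0 P.refl (monomial-0 d z)

  monomial-+ : ∀ {n} d (a b : Pol n) → monomial d a ⊕ monomial d b ≋ monomial d (a ⊕ b)
  monomial-+ zero    a b = P.trans (◂-+ _ _ _ _) (◂-cong P.refl (P.+-identityˡ 0P))
  monomial-+ (suc d) a b = P.trans (◂-+ _ _ _ _) (◂-cong (P.+-identityˡ 0P) (monomial-+ d a b))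

  monomial-· : ∀ {n} d (x a : Pol n) → ι x ⊛ monomial d a ≋ monomial d (x ⊛ a)
  monomial-· zero    x a = P.trans (ι-∙ x a nil) (◂-cong P.refl (P.zeroʳ (ι x)))
  monomial-· (suc d) x a = P.trans (ι-∙ x 0P _) (◂-cong (P.zeroʳ x) (monomial-· d x a))

  deg<-monomial : ∀ {n} d (a : Pol n) → deg< (suc d) (monomial d a)
  deg<-monomial zero    a = deg<-ι {d = 0} a
  deg<-monomial (suc d) a = deg<-cons 0P (deg<-monomial d a)

  deg<-monomial-zero : ∀ {n} d {a : Pol n} → deg< d (monomial d a) → a ≋ 0P
  deg<-monomial-zero zero    (b , e) = proj₁ (◂-zero e)
  deg<-monomial-zero (suc d) (b , e) = deg<-monomial-zero d (b ∘ suc , proj₂ (◂-injective e))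

  -- The coefficient `a` at degree d may be zero. This makes the relation linear in the pair of `a`
  -- and `f`, so that leading coefficients form ideals.
  Top : ∀ {n} → ℕ → Pol n → Pol (suc n) → Set (c ⊔ ℓ)
  Top d a f = deg< d (f ⊖ monomial d a)

  Top-resp : ∀ {n d} {a b : Pol n} {f g} → a ≋ b → f ≋ g → Top d a f → Top d b g
  Top-resp {d = d} p q = deg<-resp (P.+-cong q (P.-‿cong (monomial-cong d p)))

  Top-monomial : ∀ {n} d (a : Pol n) → Top d a (monomial d a)
  Top-monomial d a = deg<-0 d (P.-‿inverseʳ _)

  Top-+ : ∀ {n d} {a b : Pol n} {f g} → Top d a f → Top d b g → Top d (a ⊕ b) (f ⊕ g)
  Top-+ {d = d} {a} {b} {f} {g} p q = deg<-resp
    (P.trans (solve 4 (λ f a g b → (f :- a) :+ (g :- b) := (f :+ g) :- (a :+ b)) P.refl f (monomial d a) g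
        (monomial d b))
      (P.+-congˡ (P.-‿cong (monomial-+ d a b))))
    (deg<-+ p q)

  Top-· : ∀ {n d} x {a : Pol n} {f} → Top d a f → Top d (x ⊛ a) (ι x ⊛ f)
  Top-· {d = d} x {a} {f} p = deg<-resp
    (P.trans (solve 3 (λ x f a → x :* (f :- a) := x :* f :- x :* a) P.refl (ι x) f (monomial d a))
      (P.+-congˡ (P.-‿cong (monomial-· d x a))))
    (deg<-· x p)

  Top-X : ∀ {n d} {a : Pol n} {f} → Top d a f → Top (suc d) a (X ⊛ f)
  Top-X {d = d} {a} {f} p = deg<-resp
    (P.trans (solve 3 (λ x f a → x :* (f :- a) := x :* f :- x :* a) P.refl X f (monomial d a))
      (P.+-congˡ (P.-‿cong (X-shift _))))
    (deg<-X p)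

  deg<⇒Top : ∀ {n d} {f : Pol (suc n)} → deg< d f → Top d 0P f
  deg<⇒Top {d = d} {f} p = deg<-resp (P.sym (P.trans (P.+-congˡ (P.-‿cong (monomial-0 d P.refl)))
    (solve 1 (λ f → f :- con (0 , 0) := f) P.refl f))) p

  Top⇒deg< : ∀ {n d} {a : Pol n} {f} → Top d a f → deg< (suc d) f
  Top⇒deg< {d = d} {a} {f} p = deg<-resp (solve 2 (λ f a → (f :- a) :+ a := f) P.refl f (monomial d a))
    (deg<-+ (deg<-mono (ℕₚ.n≤1+n d) p) (deg<-monomial d a))

  leading : ∀ {n} d {f : Pol (suc n)} → deg< (suc d) f → ∃ λ a → Top d a f
  leading zero    (a , e) = a zero , deg<-0 0 (≋-0 e)
  leading (suc d) (a , e) with leading d (a ∘ suc , P.refl)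
  ... | b , p = b , deg<-resp (P.trans (P.sym (P.trans (P.+-congˡ (◂-neg _ _)) (◂-+ _ _ _ _))) (P.+-congʳ (P.sym e)))
      (deg<-cons (a zero ⊖ 0P) p)

  Monic : ∀ {n} → ℕ → Pol (suc n) → Set (c ⊔ ℓ)
  Monic d = Top d 1P

  -- Horner's scheme: if f′ = w δ + r, then in a + x f′ only x r + a remains to be reduced. Its
  -- degree is at most d, so subtracting one multiple of δ suffices.
  divide : ∀ {n d} {δ : Pol (suc n)} → Monic d δ → ∀ k {f} → deg< k f →
           ∃ λ w → ∃ λ r → deg< k w × deg< d r × f ≋ w ⊛ δ ⊕ r
  divide {d = d} {δ} m zero    (a , e) = 0P , 0P , deg<-0 0 P.refl , deg<-0 d P.refl ,
    P.trans e (solve 1 (λ δ → con (0 , 0) := con (0 , 0) :* δ :+ con (0 , 0)) P.refl δ)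
  divide {d = d} {δ} m (suc k) {f} (a , e) with divide m k (a ∘ suc , P.refl)
  ... | w , r , dw , dr , eq with leading d (deg<-+ (deg<-X dr) (deg<-ι (a zero)))
  ...   | b , t = X ⊛ w ⊕ ι b , (X ⊛ r ⊕ ι (a zero)) ⊖ ι b ⊛ δ
        , deg<-+ (deg<-X dw) (deg<-ι b)
        , deg<-resp (solve 3 (λ h m e → (h :- m) :+ :- (e :- m) := h :- e) P.refl _ (monomial d b) (ι b ⊛ δ))
            (deg<-+ t (deg<-neg (Top-resp (P.*-identityʳ b) P.refl (Top-· b m))))
        , P.trans e (P.trans (◂-split (a zero) _) (P.trans (P.+-congˡ (P.*-congˡ eq))
            (solve 6 (λ a x w δ r b → a :+ x :* (w :* δ :+ r) := (x :* w :+ b) :* δ :+ ((x :* r :+ a) :- b :* δ))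
              P.refl (ι (a zero)) X w δ r (ι b))))

  -- Uniqueness of division. For z = a + x z′ put h = a δ + r = h₀ + x h′, where h′ has degree below
  -- d. Then h₀ = 0 and δ z′ + h′ = 0, so z′ = 0 by induction; hence h = 0, and with it the
  -- coefficient `a` of h at degree d.
  monic-regular : ∀ {n d} {δ : Pol (suc n)} → Monic d δ → ∀ z {r} → deg< d r → δ ⊛ z ⊕ r ≋ 0P → z ≋ 0P
  monic-regular         m nil     dr e = P.refl
  monic-regular {d = d} {δ} m (a ◂ z) {r} dr e = 0◂0 a≋0 z≋0
    where
    h = ι a ⊛ δ ⊕ r
    top : Top d a h
    top = Top-resp (P.trans (P.+-identityʳ _) (P.*-identityʳ a)) P.refl (Top-+ (Top-· a m) (deg<⇒Top dr))
    h-coeffs = proj₁ (Top⇒deg< top)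
    h-poly = proj₂ (Top⇒deg< top)
    h′ = poly (h-coeffs ∘ suc)
    expand : δ ⊛ (a ◂ z) ⊕ r ≋ h ⊕ X ⊛ (δ ⊛ z)
    expand = P.trans (P.+-congʳ (P.*-congˡ (◂-split a z)))
      (solve 5 (λ δ a x z r → δ :* (a :+ x :* z) :+ r := (a :* δ :+ r) :+ x :* (δ :* z)) P.refl δ (ι a) X z r)
    split : (h-coeffs zero ◂ (δ ⊛ z ⊕ h′)) ≋ 0P
    split = P.trans (◂-split _ _) (P.trans
      (solve 4 (λ a x d h → a :+ x :* (d :+ h) := (a :+ x :* h) :+ x :* d) P.refl (ι (h-coeffs zero)) X (δ ⊛ z) h′)
      (P.trans (P.+-congʳ (P.trans (P.sym (◂-split _ _)) (P.sym h-poly))) (P.trans (P.sym expand) e)))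
    z≋0 : z ≋ 0P
    z≋0 = monic-regular m z (h-coeffs ∘ suc , P.refl) (proj₂ (◂-zero split))
    h≋0 : h ≋ 0P
    h≋0 = P.trans h-poly (0◂0 (proj₁ (◂-zero split)) (P.trans
      (P.trans (P.sym (P.+-identityˡ h′)) (P.+-congʳ (P.sym (P.trans (P.*-congˡ z≋0) (P.zeroʳ δ)))))
      (proj₂ (◂-zero split))))
    a≋0 : a ≋ 0P
    a≋0 = deg<-monomial-zero d (deg<-resp (P.trans (P.-‿cong (P.+-congʳ h≋0))
      (solve 1 (λ m → :- (con (0 , 0) :- m) := m) P.refl (monomial d a))) (deg<-neg top))

-- Hilbert's basis theorem up to double negation.

module HilbertBasis {c ℓ} (F : Field c ℓ) (ac : FieldDefs.AlgebraicallyClosed F) where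
  open Field F using (_≈_; 0#; inverse)
  private module F = Field F
  open Polynomials F
  open InfiniteField F ac
  open Degrees F ac
  open DoubleNegation
  open S

  polynomials : ∀ n → RawModule c c (c ⊔ ℓ)
  polynomials n = record
    { Scalar = Pol n ; Vector = Pol n ; _≈_ = _≋_ ; 0# = 0P ; _+_ = _⊕_ ; _·_ = _⊛_ }

  ⟨_⟩ : ∀ {n} → List (Pol n) → Pol n → Set (c ⊔ ℓ)
  ⟨ G ⟩ = Span (polynomials _) G

  record IsIdeal {n} (I : Pol n → Set (c ⊔ ℓ)) : Set (c ⊔ ℓ) where
    field
      ideal-resp : ∀ {f g} → f ≋ g → I f → I g
      ideal-0    : I 0P
      ideal-+    : ∀ {f g} → I f → I g → I (f ⊕ g)
      ideal-*    : ∀ a {f} → I f → I (a ⊛ f)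

    ideal-neg : ∀ {f} → I f → I (neg f)
    ideal-neg {f} p = ideal-resp (P.trans (solve 2 (λ u f → :- u :* f := :- (u :* f)) P.refl 1P f)
      (P.-‿cong (P.*-identityˡ f))) (ideal-* (neg 1P) p)

    ideal-- : ∀ {f g} → I f → I g → I (f ⊖ g)
    ideal-- p q = ideal-+ p (ideal-neg q)

    span-⊆-ideal : ∀ {G} → All I G → ∀ {f} → ⟨ G ⟩ f → I f
    span-⊆-ideal h (gen g)     = All.lookup h g
    span-⊆-ideal h null        = ideal-0
    span-⊆-ideal h (add p q)   = ideal-+ (span-⊆-ideal h p) (span-⊆-ideal h q)
    span-⊆-ideal h (scale a p) = ideal-* a (span-⊆-ideal h p)
    span-⊆-ideal h (resp e p)  = ideal-resp e (span-⊆-ideal h p)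

  open IsIdeal

  span-isIdeal : ∀ {n} (G : List (Pol n)) → IsIdeal ⟨ G ⟩
  span-isIdeal G = record { ideal-resp = resp ; ideal-0 = null ; ideal-+ = add ; ideal-* = λ a p → scale a p }

  -- Ideals are arbitrary predicates here, so even membership in the span is doubly negated. Exact
  -- membership is regained in `saturation-generated`.
  Noetherian : ℕ → Set (Level.suc (c ⊔ ℓ))
  Noetherian n = ∀ (I : Pol n → Set (c ⊔ ℓ)) → IsIdeal I →
                 ¬¬ (∃ λ G → All I G × (∀ f → I f → ¬¬ ⟨ G ⟩ f))

  -- Each operation that combines leading coefficients is mirrored on polynomials having them. All
  -- lifts share the degree d, so no cancellation of degrees has to be tracked.
  lift-generators : ∀ {n} d {I : Pol (suc n) → Set (c ⊔ ℓ)} {G} → All (λ a → ∃ λ f → I f × Top d a f) G →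
    ∃ λ H → All I H × (∀ {a} → ⟨ G ⟩ a → ∃ λ f → ⟨ H ⟩ f × Top d a f)
  lift-generators d {I} {G} hs = lifts hs , lifts-in hs , span-lift
    where
    lifts : ∀ {G} → All (λ a → ∃ λ f → I f × Top d a f) G → List (Pol _)
    lifts []             = []
    lifts ((f , _) ∷ hs) = f ∷ lifts hs
    lifts-in : ∀ {G} (hs : All (λ a → ∃ λ f → I f × Top d a f) G) → All I (lifts hs)
    lifts-in []                 = []
    lifts-in ((f , p , _) ∷ hs) = p ∷ lifts-in hs
    lift : ∀ {G} (hs : All (λ a → ∃ λ f → I f × Top d a f) G) {a} → a ∈ G → ∃ λ f → f ∈ lifts hs × Top d a f
    lift ((f , _ , t) ∷ hs) (here ≡.refl) = f , here ≡.refl , t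
    lift (_ ∷ hs)           (there a∈)    with lift hs a∈
    ... | f , f∈ , t = f , there f∈ , t
    span-lift : ∀ {a} → ⟨ G ⟩ a → ∃ λ f → ⟨ lifts hs ⟩ f × Top d a f
    span-lift (gen g)     with lift hs g
    ... | f , f∈ , t = f , gen f∈ , t
    span-lift null        = 0P , null , deg<⇒Top (deg<-0 d P.refl)
    span-lift (add p q)   with span-lift p | span-lift q
    ... | f , f∈ , t | g , g∈ , u = f ⊕ g , add f∈ g∈ , Top-+ t u
    span-lift (scale x p) with span-lift p
    ... | f , f∈ , t = ι x ⊛ f , scale (ι x) f∈ , Top-· x t
    span-lift (resp e p)  with span-lift p
    ... | f , f∈ , t = f , f∈ , Top-resp e P.refl t

  Top-raise : ∀ {n} {I : Pol (suc n) → Set (c ⊔ ℓ)} → IsIdeal I → ∀ {d e a f} → d ≤ e →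
              I f → Top d a f → ∃ λ g → I g × Top e a g
  Top-raise {I = I} ideal {d} {e} {a} {f} d≤e p t = ≡.subst (λ e → ∃ λ g → I g × Top e a g) (ℕₚ.m∸n+n≡m d≤e)
      (raise (e ℕ.∸ d))
    where
    raise : ∀ k → ∃ λ g → I g × Top (k ℕ.+ d) a g
    raise zero    = f , p , t
    raise (suc k) with raise k
    ... | g , q , u = X ⊛ g , ideal-* ideal X q , Top-X u

  Top-cancel : ∀ {n d} {a : Pol n} {f g} → Top d a f → Top d a g → deg< d (f ⊖ g)
  Top-cancel {d = d} {a} {f} {g} t u = deg<-resp
    (solve 3 (λ f g m → (f :- m) :+ :- (g :- m) := f :- g) P.refl f g (monomial d a)) (deg<-+ t (deg<-neg u))

  -- The ideals of leading coefficients of the classical proof.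
  module LeadingCoefficients {n} (noetherian-n : Noetherian n)
                             {I : Pol (suc n) → Set (c ⊔ ℓ)} (ideal : IsIdeal I) where

    Leading : ℕ → Pol n → Set (c ⊔ ℓ)
    Leading d a = ∃ λ f → I f × Top d a f

    leading-isIdeal : ∀ d → IsIdeal (Leading d)
    leading-isIdeal d = record
      { ideal-resp = λ { e (f , p , t) → f , p , Top-resp e P.refl t }
      ; ideal-0    = 0P , ideal-0 ideal , deg<⇒Top (deg<-0 d P.refl)
      ; ideal-+    = λ { (f , p , t) (g , q , u) → f ⊕ g , ideal-+ ideal p q , Top-+ t u }
      ; ideal-*    = λ { x (f , p , t) → ι x ⊛ f , ideal-* ideal (ι x) p , Top-· x t } }

    -- The union of the ascending chain `Leading`; persistence in all higher degrees is built in,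
    -- which makes closure under addition immediate.
    Eventually : Pol n → Set (c ⊔ ℓ)
    Eventually a = ∃ λ d → ∀ e → d ≤ e → Leading e a

    eventually-isIdeal : IsIdeal Eventually
    eventually-isIdeal = record
      { ideal-resp = λ { e (d , h) → d , λ k l → ideal-resp (leading-isIdeal k) e (h k l) }
      ; ideal-0    = 0 , λ k _ → ideal-0 (leading-isIdeal k)
      ; ideal-+    = λ { (d , h) (d′ , h′) → d ℕ.⊔ d′ , λ k l → ideal-+ (leading-isIdeal k)
                       (h k (ℕₚ.≤-trans (ℕₚ.m≤m⊔n d d′) l)) (h′ k (ℕₚ.≤-trans (ℕₚ.m≤n⊔m d d′) l)) }
      ; ideal-*    = λ { x (d , h) → d , λ k l → ideal-* (leading-isIdeal k) x (h k l) } }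

    common-degree : ∀ {G} → All Eventually G → ∃ λ d → ∀ e → d ≤ e → All (Leading e) G
    common-degree []             = 0 , λ e _ → []
    common-degree ((d , h) ∷ hs) with common-degree hs
    ... | d′ , h′ = d ℕ.⊔ d′ , λ e l →
      h e (ℕₚ.≤-trans (ℕₚ.m≤m⊔n d d′) l) ∷ h′ e (ℕₚ.≤-trans (ℕₚ.m≤n⊔m d d′) l)

    reduce : ∀ {d a f H K} → All I H → (∀ f → I f → deg< d f → ¬¬ ⟨ K ⟩ f) →
             I f → Top d a f → (∃ λ g → ⟨ H ⟩ g × Top d a g) → ¬¬ ⟨ H ++ K ⟩ f
    reduce {f = f} {H = H} inH low p t (g , g∈ , u) =
      low (f ⊖ g) (ideal-- ideal p (span-⊆-ideal ideal inH g∈)) (Top-cancel t u) >>= λ d∈ →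
      return (resp (solve 2 (λ f g → g :+ (f :- g) := f) P.refl f g)
        (add (span-⊆ (gen ∘ ∈-++⁺ˡ) g∈) (span-⊆ (gen ∘ ∈-++⁺ʳ H) d∈)))

    -- One degree at a time: lifts of generators of `Leading d` remove the coefficient of x^d and
    -- leave a member of the ideal of degree below d.
    low-degree : ∀ d → ¬¬ (∃ λ G → All I G × (∀ f → I f → deg< d f → ¬¬ ⟨ G ⟩ f))
    low-degree zero    = return ([] , [] , λ f _ p → return (resp (P.sym (proj₂ p)) null))
    low-degree (suc d) =
      low-degree d >>= λ { (K , inK , genK) →
      noetherian-n (Leading d) (leading-isIdeal d) >>= λ { (G , inG , genG) →
      let (H , inH , lift) = lift-generators d inG in
      return (H ++ K , All.++⁺ inH inK , λ f p df → let (a , t) = leading d df in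
        genG a (f , p , t) >>= λ a∈ → reduce inH genK p t (lift a∈)) }}

    basis : ¬¬ (∃ λ G → All I G × (∀ f → I f → ¬¬ ⟨ G ⟩ f))
    basis =
      noetherian-n Eventually eventually-isIdeal >>= λ { (G , inG , genG) →
      let (d , leads) = common-degree inG
          (H , inH , lift) = lift-generators d (leads d ℕₚ.≤-refl)
      in low-degree d >>= λ { (K , inK , genK) →
      return (H ++ K , All.++⁺ inH inK , λ f p →
        high inH lift genG genK (size f) f p (deg<-mono (ℕₚ.m≤m+n (size f) d) (deg<-size f))) }}
      where
      -- Induction on the excess k. Multiples of `f` by powers of x show that its leading
      -- coefficient lies in `Eventually`; the lift in degree d of that coefficient, multiplied by
      -- x^k, then cancels it.
      high : ∀ {d G H K} → All I H → (∀ {a} → ⟨ G ⟩ a → ∃ λ f → ⟨ H ⟩ f × Top d a f) →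
             (∀ a → Eventually a → ¬¬ ⟨ G ⟩ a) → (∀ f → I f → deg< d f → ¬¬ ⟨ K ⟩ f) →
             ∀ k f → I f → deg< (k ℕ.+ d) f → ¬¬ ⟨ H ++ K ⟩ f
      high {H = H} inH lift genG genK zero    f p df =
        genK f p df >>= λ f∈ → return (span-⊆ (gen ∘ ∈-++⁺ʳ H) f∈)
      high {d} {H = H} {K} inH lift genG genK (suc k) f p df =
        let (a , t) = leading (k ℕ.+ d) df in
        genG a (k ℕ.+ d , λ e l → Top-raise ideal l p t) >>= λ a∈ →
        let (g , g∈ , u) = lift a∈
            (h , h∈ , w) = Top-raise (span-isIdeal H) (ℕₚ.m≤n+m d k) g∈ u
        in high inH lift genG genK k (f ⊖ h) (ideal-- ideal p (span-⊆-ideal ideal inH h∈)) (Top-cancel t w) >>= λ r∈ →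
        return (resp (solve 2 (λ f g → g :+ (f :- g) := f) P.refl f h) (add (span-⊆ (gen ∘ ∈-++⁺ˡ) h∈) r∈))

  noetherian : ∀ n → Noetherian n
  noetherian zero    I ideal = lem (∃ λ a → I (con a) × ¬ (a ≈ 0#)) >>= λ
    { (inj₁ (a , p , a≉0)) → return (con a ∷ [] , p ∷ [] , λ { (con b) _ →
        let (a⁻¹ , inv) = inverse a a≉0 in
        return (resp (pw λ v → F.trans (ev-* (con (b F.* a⁻¹)) (con a) v)
          (F.trans (F.*-assoc b a⁻¹ a) (F.trans (F.*-congˡ (F.trans (F.*-comm a⁻¹ a) inv)) (F.*-identityʳ b))))
          (scale (con (b F.* a⁻¹)) (gen (here ≡.refl)))) })
    -- If no member is nonzero, each member fails to be nonzero, which is enough for doubly negated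
    -- membership in the zero ideal.
    ; (inj₂ none) → return ([] , [] , λ { (con b) p → λ k →
        none (b , p , λ b≈0 → k (resp (pw λ v → F.sym b≈0) null)) }) }
  noetherian (suc n) I ideal = LeadingCoefficients.basis (noetherian n) ideal

-- Weighted homogeneous components and coordinate changes.

module Homogeneous {c ℓ} (F : Field c ℓ) (ac : FieldDefs.AlgebraicallyClosed F) where
  open Field F hiding (zero)
  private module F = Field F
  open RingSolver commutativeRing
  open Polynomials F
  open InfiniteField F ac
  open Degrees F ac
  open DoubleNegation

  -- component f ws d: the part of f of degree d in the variables marked true.
  component : ∀ {n} → Pol n → Vec Bool n → ℕ → Pol n
  component (con a) ws           zero    = con a
  component (con a) ws           (suc d) = con 0#
  component nil     ws           d       = nil
  component (a ◂ f) (true ∷ ws)  zero    = component a ws zero ◂ nil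
  component (a ◂ f) (true ∷ ws)  (suc d) = component a ws (suc d) ◂ component f (true ∷ ws) d
  component (a ◂ f) (false ∷ ws) d       = component a ws d ◂ component f (false ∷ ws) d

  rescale : ∀ {n} → Vec Bool n → Carrier → Vec Carrier n → Vec Carrier n
  rescale ws t v = Vec.zipWith (λ b x → if b then t * x else x) ws v

  lookup-rescale : ∀ {n} (ws : Vec Bool n) t v i →
    Vec.lookup (rescale ws t v) i ≡ (if Vec.lookup ws i then t * Vec.lookup v i else Vec.lookup v i)
  lookup-rescale ws t v i = Vec.lookup-zipWith _ i ws v

  powerSum : ℕ → (ℕ → Carrier) → Carrier → Carrier
  powerSum zero    h t = 0#
  powerSum (suc e) h t = h 0 + t * powerSum e (h ∘ suc) t

  powerSum-cong : ∀ e {h k} t → (∀ d → h d ≈ k d) → powerSum e h t ≈ powerSum e k t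
  powerSum-cong zero    t eq = refl
  powerSum-cong (suc e) t eq = +-cong (eq 0) (*-congˡ (powerSum-cong e t (eq ∘ suc)))

  powerSum-0 : ∀ e t → powerSum e (λ _ → 0#) t ≈ 0#
  powerSum-0 zero    t = refl
  powerSum-0 (suc e) t = trans (+-identityˡ _) (trans (*-congˡ (powerSum-0 e t)) (zeroʳ t))

  powerSum-linear : ∀ e h k x t → powerSum e (λ d → h d + x * k d) t ≈ powerSum e h t + x * powerSum e k t
  powerSum-linear zero    h k x t = solve 1 (λ x → con (0 , 0) := con (0 , 0) :+ x :* con (0 , 0)) refl x
  powerSum-linear (suc e) h k x t = trans (+-congˡ (*-congˡ (powerSum-linear e (h ∘ suc) (k ∘ suc) x t)))
    (solve 6 (λ h x k t p q → (h :+ x :* k) :+ t :* (p :+ x :* q) := (h :+ t :* p) :+ x :* (k :+ t :* q)) refl _ x _ t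
        _ _)

  component-sum : ∀ {n} (f : Pol n) ws → ∃ λ D → ∀ e → D ≤ e → ∀ t v →
    ev f (rescale ws t v) ≈ powerSum e (λ d → ev (component f ws d) v) t
  component-sum (con a) ws = 1 , λ { (suc e) l t v →
    sym (trans (+-congˡ (trans (*-congˡ (powerSum-0 e t)) (zeroʳ t))) (+-identityʳ a)) }
  component-sum nil     ws = 0 , λ e l t v → sym (powerSum-0 e t)
  component-sum (a ◂ f) (true ∷ ws) with component-sum a ws | component-sum f (true ∷ ws)
  ... | D , p | E , q = suc (D ℕ.⊔ E) , λ { (suc e) (s≤s l) t (x ∷ v) → sym (trans
    (+-cong (trans (+-congˡ (zeroʳ x)) (+-identityʳ _)) (*-congˡ (powerSum-linear e _ _ x t)))
    (trans (solve 5 (λ a t p x q → a :+ t :* (p :+ x :* q) := (a :+ t :* p) :+ (t :* x) :* q) refl _ t _ x _)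
    (sym (+-cong (p (suc e) (ℕₚ.≤-trans (ℕₚ.m≤m⊔n D E) (ℕₚ.m≤n⇒m≤1+n l)) t v)
      (*-congˡ (q e (ℕₚ.≤-trans (ℕₚ.m≤n⊔m D E) l) t (x ∷ v))))))) }
  component-sum (a ◂ f) (false ∷ ws) with component-sum a ws | component-sum f (false ∷ ws)
  ... | D , p | E , q = D ℕ.⊔ E , λ { e l t (x ∷ v) → sym (trans (powerSum-linear e _ _ x t)
    (sym (+-cong (p e (ℕₚ.≤-trans (ℕₚ.m≤m⊔n D E) l) t v)
      (*-congˡ (q e (ℕₚ.≤-trans (ℕₚ.m≤n⊔m D E) l) t (x ∷ v)))))) }

  allTrue : ∀ {n} → Vec Bool n
  allTrue = Vec.replicate _ true

  rescale-1 : ∀ {n} (ws : Vec Bool n) v → rescale ws 1# v ≈ᵥ v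
  rescale-1 (true ∷ ws)  (x ∷ v) zero    = *-identityˡ x
  rescale-1 (false ∷ ws) (x ∷ v) zero    = refl
  rescale-1 (b ∷ ws)     (x ∷ v) (suc i) = rescale-1 ws v i

  constant-0 : ∀ {n a} → a ≈ 0# → constant {n} a ≋ 0P
  constant-0 z = pw λ v → trans (ev-constant _ v) (trans z (sym (ev-0 v)))

  constant-cong : ∀ {n a b} → a ≈ b → constant {n} a ≋ constant b
  constant-cong e = pw λ v → trans (ev-constant _ v) (trans e (sym (ev-constant _ v)))

  constant-+ : ∀ {n} a b → constant {n} a ⊕ constant b ≋ constant (a + b)
  constant-+ a b = pw λ v → trans (ev-+ _ _ v) (trans (+-cong (ev-constant a v) (ev-constant b v))
      (sym (ev-constant _ v)))

  constant-* : ∀ {n} a b → constant {n} a ⊛ constant b ≋ constant (a * b)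
  constant-* a b = pw λ v → trans (ev-* _ _ v) (trans (*-cong (ev-constant a v) (ev-constant b v))
      (sym (ev-constant _ v)))

  Top-* : ∀ {n d} {a b : Pol n} {f g} → Top 1 a f → Top d b g → Top (suc d) (a ⊛ b) (f ⊛ g)
  Top-* {d = d} {a} {b} {f} {g} (e , p) t =
    Top-resp (P.+-identityˡ _)
        (P.trans (S.solve 4 (λ e x a g → e S.:* g S.:+ x S.:* (a S.:* g) S.:= (e S.:+ x S.:* a) S.:* g) P.refl
        (ι (e zero)) X (ι a) g)
        (P.*-congʳ (P.sym f-split)))
      (Top-+ (deg<⇒Top (deg<-· (e zero) (Top⇒deg< t))) (Top-X (Top-· a t)))
    where
    f-split : f ≋ ι (e zero) ⊕ X ⊛ ι a
    f-split = P.trans (S.solve 2 (λ f m → f S.:= (f S.:- m) S.:+ m) P.refl f (monomial 1 a))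
      (P.+-cong p (P.sym (X-shift (ι a))))

  -- Each variable is replaced by wᵢ X plus terms free of X. A product of d such factors contributes
  -- to X^d only through the wᵢ, so the part of degree d gets its value at `w` as coefficient.
  component-top : ∀ {k n} (f : Pol k) (gs : Vec (Pol (suc n)) k) (w : Vec Carrier k) →
    (∀ i → Top 1 (constant (Vec.lookup w i)) (Vec.lookup gs i)) → ∀ d →
    Top d (constant (ev (component f allTrue d) w)) (sub (component f allTrue d) gs)
  component-top (con a) gs w h zero    = Top-monomial 0 (constant a)
  component-top (con a) gs w h (suc d) = deg<-0 (suc d) (P.trans (P.+-cong (constant-0 refl)
    (P.-‿cong (monomial-0 (suc d) (constant-0 refl)))) (P.-‿inverseʳ 0P))
  component-top nil     gs w h d       = deg<-0 d (P.trans (P.+-congˡ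
    (P.-‿cong (monomial-0 d (constant-0 refl)))) (P.-‿inverseʳ 0P))
  component-top (a ◂ f) (g ∷ gs) (x ∷ w) h zero    = Top-resp
    (constant-cong (sym (trans (+-congˡ (zeroʳ x)) (+-identityʳ _))))
    (P.sym (P.trans (P.+-congˡ (P.zeroʳ g)) (P.+-identityʳ _)))
    (component-top a gs w (h ∘ suc) zero)
  component-top (a ◂ f) (g ∷ gs) (x ∷ w) h (suc d) = Top-resp
    (P.trans (P.+-congˡ (constant-* _ _)) (constant-+ _ _)) P.refl
    (Top-+ (component-top a gs w (h ∘ suc) (suc d)) (Top-* (h zero) (component-top f (g ∷ gs) (x ∷ w) h d)))

  record CoordinateChange (n : ℕ) : Set (c ⊔ ℓ) where
    field
      to from : Vec (Pol n) n
      to-from : ∀ v → evs to (evs from v) ≈ᵥ v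

    sub-to-from : ∀ f → sub (sub f to) from ≋ f
    sub-to-from f = pw λ v → trans (ev-sub (sub f to) from v) (trans (ev-sub f to _) (ev-cong f (to-from v)))

  -- The linear change of coordinates taking the first basis vector to (w₀ , w).
  module Shear {n} (w₀ : Carrier) (w₀≉0 : ¬ (w₀ ≈ 0#)) (w : Vec Carrier n) where
    private
      w₀⁻¹ = proj₁ (inverse w₀ w₀≉0)
      inv  = proj₂ (inverse w₀ w₀≉0)
      column : Carrier → (Fin n → Carrier) → Vec (Pol (suc n)) (suc n)
      column x y = X ⊛ constant x ∷ Vec.tabulate (λ i → ι (var i) ⊕ X ⊛ constant (y i))

      ev-X-constant : ∀ a x (v : Vec Carrier n) → ev (X ⊛ constant a) (x ∷ v) ≈ x * a
      ev-X-constant a x v = trans (ev-* X _ (x ∷ v)) (*-cong (ev-var zero (x ∷ v)) (ev-constant a (x ∷ v)))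

      ev-column : ∀ x y t v i → Vec.lookup (evs (column x y) (t ∷ v)) (suc i) ≈ Vec.lookup v i + t * y i
      ev-column x y t v i = trans (reflexive (≡.trans (lookup-evs (column x y) (t ∷ v) (suc i))
          (≡.cong (λ f → ev f (t ∷ v)) (Vec.lookup∘tabulate _ i))))
        (trans (ev-+ _ _ (t ∷ v)) (+-cong (trans (ev-ι (var i) t v) (ev-var i v)) (ev-X-constant (y i) t v)))

      inverse-columns : ∀ x y x′ y′ → x′ * x ≈ 1# → (∀ i → y′ i + x′ * y i ≈ 0#) →
        ∀ v → evs (column x y) (evs (column x′ y′) v) ≈ᵥ v
      inverse-columns x y x′ y′ p q (t ∷ v) zero = trans (ev-X-constant x _ _)
        (trans (*-congʳ (ev-X-constant x′ t v)) (trans (*-assoc t x′ x) (trans (*-congˡ p) (*-identityʳ t))))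
      inverse-columns x y x′ y′ p q (t ∷ v) (suc i) = trans (ev-column x y _ _ i)
        (trans (+-cong (ev-column x′ y′ t v i) (*-congʳ (ev-X-constant x′ t v)))
        (trans (solve 5 (λ v t a x b → (v :+ t :* a) :+ (t :* x) :* b := v :+ t :* (a :+ x :* b)) refl
          (Vec.lookup v i) t (y′ i) x′ (y i))
        (trans (+-congˡ (trans (*-congˡ (q i)) (zeroʳ t))) (+-identityʳ _))))

    change : CoordinateChange (suc n)
    change = record
      { to = column w₀ (Vec.lookup w)
      ; from = column w₀⁻¹ (λ i → - (w₀⁻¹ * Vec.lookup w i))
      ; to-from = inverse-columns _ _ _ _ (trans (*-comm _ _) inv) (λ i → -‿inverseˡ _)
      }

    to-top : ∀ i → Top 1 (constant (Vec.lookup (w₀ ∷ w) i)) (Vec.lookup (CoordinateChange.to change) i)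
    to-top zero    = deg<-0 1 (≋-0 (X-shift _))
    to-top (suc i) = deg<-resp
        (P.sym (P.trans (P.+-congʳ (P.trans (P.reflexive (Vec.lookup∘tabulate _ i)) (P.+-congˡ (X-shift _))))
        (S.solve 2 (λ v m → (v S.:+ m) S.:- m S.:= v) P.refl (ι (var i)) _)))
      (deg<-ι {d = 0} (var i))

  record MadeMonic {n} (f : Pol (suc n)) : Set (c ⊔ ℓ) where
    field
      change : CoordinateChange (suc n)
      degree : ℕ
      lead   : Carrier
      lead≉0 : ¬ (lead ≈ 0#)
      top    : Top degree (constant lead) (sub f (CoordinateChange.to change))

  -- Let d be the highest degree with a nonzero component and (w₀ , w) a point where it does not
  -- vanish. Sending the first basis vector there makes that value the coefficient of x^d, and
  -- nothing of higher degree appears.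
  make-monic : ∀ {n} (f : Pol (suc n)) → ∃ (NonZeroAt f) → ¬¬ MadeMonic f
  make-monic {n} f (v , nz) = search D 0 >>= λ
    { (inj₁ z) → contradiction (trans (f≈tail v) (trans (at z v) (ev-0 v))) nz
    ; (inj₂ (d , _ , w₀ , w , w₀≉0 , nzd , t)) → return (record
        { change = Shear.change w₀ w₀≉0 w ; degree = d ; lead = ev (comp d) (w₀ ∷ w) ; lead≉0 = nzd
        ; top = Top-resp P.refl (sub-cong {f = tail D 0} {f} (CoordinateChange.to (Shear.change w₀ w₀≉0 w))
            (P.sym (pw f≈tail)))
            (t {CoordinateChange.to (Shear.change w₀ w₀≉0 w)} (Shear.to-top w₀ w₀≉0 w)) }) }
    where
    comp = component f allTrue
    D = proj₁ (component-sum f allTrue)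
    tail : ℕ → ℕ → Pol (suc n)
    tail zero    d = 0P
    tail (suc k) d = comp d ⊕ tail k (suc d)
    ev-tail : ∀ k d v → powerSum k (λ e → ev (comp (e ℕ.+ d)) v) 1# ≈ ev (tail k d) v
    ev-tail zero    d v = sym (ev-0 v)
    ev-tail (suc k) d v = trans (+-congˡ (trans (*-identityˡ _) (trans
        (powerSum-cong k 1# (λ e → reflexive (≡.cong (λ j → ev (comp j) v) (≡.sym (ℕₚ.+-suc e d)))))
        (ev-tail k (suc d) v))))
      (sym (ev-+ (comp d) _ v))
    f≈tail : ∀ v → ev f v ≈ ev (tail D 0) v
    f≈tail v = trans (ev-cong f (λ i → sym (rescale-1 allTrue v i)))
      (trans (proj₂ (component-sum f allTrue) D ℕₚ.≤-refl 1# v)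
      (trans (powerSum-cong D 1# (λ e → reflexive (≡.cong (λ j → ev (comp j) v) (≡.sym (ℕₚ.+-identityʳ e)))))
      (ev-tail D 0 v)))
    Found : Pol (suc n) → ℕ → Set (c ⊔ ℓ)
    Found g d₀ = ∃ λ d → d₀ ≤ d × ∃ λ w₀ → ∃ λ w → ¬ (w₀ ≈ 0#) × NonZeroAt (comp d) (w₀ ∷ w) ×
      -- The shear depends on the point that is found, so the conclusion is stated for every
      -- substitution with the right leading terms.
      (∀ {gs : Vec (Pol (suc n)) (suc n)} → (∀ i → Top 1 (constant (Vec.lookup (w₀ ∷ w) i)) (Vec.lookup gs i)) →
       Top d (constant (ev (comp d) (w₀ ∷ w))) (sub g gs))
    search : ∀ k d → ¬¬ (tail k d ≋ 0P ⊎ Found (tail k d) d)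
    search zero    d = return (inj₁ P.refl)
    search (suc k) d = search k (suc d) >>= λ
      { (inj₂ (e , d<e , w₀ , w , w₀≉0 , nze , t)) → return (inj₂ (e , ℕₚ.<⇒≤ d<e , w₀ , w , w₀≉0 , nze , λ {gs} h →
          Top-resp (P.+-identityˡ _) (P.sym (sub-+ (comp d) (tail k (suc d)) gs))
            (Top-+ (deg<⇒Top (deg<-mono d<e (Top⇒deg< (component-top f gs (w₀ ∷ w) h d)))) (t h))))
      -- The component is multiplied by the first variable so that a point of nonvanishing also has
      -- w₀ ≠ 0, which the shear inverts.
      ; (inj₁ z) → nonzero-or-zero (0P ◂ comp d) >>= λ
        { (inj₁ z′) → return (inj₁ (P.trans (P.+-cong (proj₂ (◂-zero z′)) z) (P.+-identityˡ 0P)))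
        ; (inj₂ (w₀ ∷ w , nzd)) → return (inj₂ (d , ℕₚ.≤-refl , w₀ , w
            , (λ e → nzd (trans (ev-shift (comp d) w₀ w) (trans (*-congʳ e) (zeroˡ _))))
            , (λ e → nzd (trans (ev-shift (comp d) w₀ w) (trans (*-congˡ e) (zeroʳ _))))
            , λ {gs} h → Top-resp P.refl (sub-cong gs (P.sym (P.trans (P.+-congˡ z) (P.+-identityʳ (comp d)))))
                (component-top f gs (w₀ ∷ w) h d))) } }

-- Coherence of polynomial rings.

module CoherentPolynomials {c ℓ} (F : Field c ℓ) (ac : FieldDefs.AlgebraicallyClosed F) where
  open Field F using (inverse)
  private module F = Field F
  open Polynomials F
  open InfiniteField F ac
  open Degrees F ac
  open Homogeneous F ac
  open DoubleNegation
  open S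
  module C {n} = Coherence (polRing n)
  open PS using (sum; dot; δ)

  cons : ∀ {a q} {A : Set a} → A → (Fin q → A) → Fin (suc q) → A
  cons x f zero    = x
  cons x f (suc i) = f i

  dot-cons : ∀ {n q} (x : Pol n) (a : Fin q → Pol n) u → dot (cons x a) u ≋ x ⊛ u zero ⊕ dot a (u ∘ suc)
  dot-cons x a u = P.reflexive (PS.sum-suc _)

  poly-sum : ∀ {n l K} (x : Fin l → Pol n) (M : Fin l → Fin K → Pol n) →
             sum (λ j → ι (x j) ⊛ poly (M j)) ≋ poly (λ k → dot x (λ j → M j k))
  poly-sum {l = zero}  x M = P.trans (P.reflexive (PS.sum-zero _))
      (P.sym (poly-0 (λ k → P.reflexive (PS.sum-zero _))))
  poly-sum {l = suc l} x M = P.trans (P.reflexive (PS.sum-suc _)) (P.trans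
    (P.+-cong (poly-· (x zero) (M zero)) (poly-sum (x ∘ suc) (M ∘ suc)))
    (P.trans (poly-+ _ _) (poly-cong (λ k → P.reflexive (≡.sym (PS.sum-suc _))))))

  bounded : ∀ {n m} (f : Fin m → Pol (suc n)) → ∃ λ d → ∀ i → deg< d (f i)
  bounded {m = zero}  f = 0 , λ ()
  bounded {m = suc m} f with bounded (f ∘ suc)
  ... | d , h = size (f zero) ℕ.⊔ d , λ
    { zero    → deg<-mono (ℕₚ.m≤m⊔n _ d) (deg<-size (f zero))
    ; (suc i) → deg<-mono (ℕₚ.m≤n⊔m (size (f zero)) d) (h i) }

  -- Vectors with q entries of degree below d are identified with vectors of q d coefficients, so
  -- the bounded part of a kernel becomes a kernel over the ring with one variable less.
  assemble : ∀ {n} q d → Semilinear (C.vectors {n} (q ℕ.* d)) (C.vectors {suc n} q)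
  assemble q d = record
    { onScalar = ι
    ; apply = λ U j → poly (λ e → U (combine j e))
    ; cong = λ e j → poly-cong (λ k → e (combine j k))
    ; homo-0 = λ j → P.sym (poly-0 (λ k → P.refl))
    ; homo-+ = λ U V j → poly-+ _ _
    ; homo-· = λ a U j → poly-· a _ }

  assemble-onto : ∀ {n q d} (u : Fin q → Pol (suc n)) → (∀ j → deg< d (u j)) →
                  ∃ λ U → ∀ j → u j ≋ Semilinear.apply (assemble q d) U j
  assemble-onto {q = q} {d} u h = (λ t → coefficient (remQuot d t)) , λ j →
    P.trans (proj₂ (h j)) (poly-cong (λ e → P.reflexive (≡.cong coefficient (≡.sym (Fin.remQuot-combine j e)))))
    where
    coefficient : Fin q × Fin d → Pol _
    coefficient (j , e) = proj₁ (h j) e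

  -- A map linear over the coefficient ring is determined by its values on unit vectors. These have
  -- a common degree bound K, and the K coefficients of the value are the rows of a matrix.
  functional-matrix : ∀ {n T} (ψ : (Fin T → Pol n) → Pol (suc n)) →
    (∀ {U V} → (∀ t → U t ≋ V t) → ψ U ≋ ψ V) → ψ (λ _ → 0P) ≋ 0P →
    (∀ U V → ψ (λ t → U t ⊕ V t) ≋ ψ U ⊕ ψ V) → (∀ x U → ψ (λ t → x ⊛ U t) ≋ ι x ⊛ ψ U) →
    ∃ λ K → ∃ λ (M : Fin K → Fin T → Pol n) → ∀ U → ψ U ≋ poly (λ k → dot (M k) U)
  functional-matrix {n} {T} ψ ψ-cong ψ-0 ψ-+ ψ-· = K , (λ k t → M t k) , λ U →
    P.trans (ψ-cong (λ t → P.sym (PS.dot-δʳ U t)))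
    (P.trans (ψ-sum U δ)
    (P.trans (PS.sum-cong (λ t → P.*-congˡ (proj₂ (proj₂ (bounded (λ t → ψ (δ t))) t))))
    (P.trans (poly-sum U M) (poly-cong (λ k → PS.dot-comm U _)))))
    where
    K = proj₁ (bounded (λ t → ψ (δ t)))
    M : Fin T → Fin K → Pol n
    M t = proj₁ (proj₂ (bounded (λ t → ψ (δ t))) t)
    ψ-sum : ∀ {l} (x : Fin l → Pol n) (g : Fin l → Fin T → Pol n) →
            ψ (λ t → dot x (λ j → g j t)) ≋ sum (λ j → ι (x j) ⊛ ψ (g j))
    ψ-sum {zero}  x g = P.trans (P.trans (ψ-cong (λ t → P.reflexive (PS.sum-zero _))) ψ-0)
        (P.reflexive (≡.sym (PS.sum-zero _)))
    ψ-sum {suc l} x g = P.trans (ψ-cong (λ t → P.reflexive (PS.sum-suc _))) (P.trans (ψ-+ _ _)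
      (P.trans (P.+-cong (ψ-· _ _) (ψ-sum (x ∘ suc) (g ∘ suc))) (P.reflexive (≡.sym (PS.sum-suc _)))))

  -- Division by m reduces an element of the kernel modulo the relations m eⱼ - aⱼ e₀ to one with bounded
  -- entries at the aⱼ; its entry at m is then bounded as well, because m is monic.
  module MonicRow {n} (coherent-n : C.Coherent {n}) {d q} (m : Pol (suc n)) (monic-m : Monic d m)
                  (a : Fin q → Pol (suc n)) where

    row = cons m a

    relation : Fin q → Fin (suc q) → Pol (suc n)
    relation j = cons (neg (a j)) (λ i → m ⊛ δ j i)

    relation-kernel : ∀ j → C.Kernel row (relation j)
    relation-kernel j = P.trans (dot-cons m a (relation j)) (P.trans (P.+-congˡ
        (P.trans (PS.dot-· a (δ j) m) (P.*-congˡ (PS.dot-δ a j))))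
      (solve 2 (λ m a → m :* :- a :+ m :* a := con (0 , 0)) P.refl m (a j)))

    -- The products aⱼ rⱼ stay below the common bound of the aⱼ plus d; dividing their sum by `m`
    -- does not raise this bound, and it exceeds the bound d of the remainders.
    E : ℕ
    E = proj₁ (bounded a) ℕ.+ d

    lift = assemble {n} (suc q) E
    module L = Semilinear lift

    constraints : ∃ λ K → ∃ λ (M : Fin K → Fin (suc q ℕ.* E) → Pol n) → ∀ U → dot row (L.apply U) ≋ poly
        (λ k → dot (M k) U)
    constraints = functional-matrix (λ U → dot row (L.apply U))
      (λ e → PS.dot-cong (λ _ → P.refl) (L.cong e))
      (P.trans (PS.dot-cong (λ _ → P.refl) (λ i → P.sym (L.homo-0 i))) (PS.dot-0 row))
      (λ U V → P.trans (PS.dot-cong (λ _ → P.refl) (λ i → P.sym (L.homo-+ U V i))) (PS.dot-+ row _ _))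
      (λ x U → P.trans (PS.dot-cong (λ _ → P.refl) (λ i → P.sym (L.homo-· x U i))) (PS.dot-· row _ (ι x)))

    module Reduce (u : Fin (suc q) → Pol (suc n)) (ker : C.Kernel row u) where
      division = λ j → divide monic-m (size (u (suc j))) (deg<-size (u (suc j)))
      w = λ j → proj₁ (division j)
      r = λ j → proj₁ (proj₂ (division j))
      r-deg : ∀ j → deg< d (r j)
      r-deg j = proj₁ (proj₂ (proj₂ (proj₂ (division j))))
      u-split : ∀ j → u (suc j) ≋ w j ⊛ m ⊕ r j
      u-split j = proj₂ (proj₂ (proj₂ (proj₂ (division j))))

      z = u zero ⊕ dot a w
      s = dot a r

      z-equation : m ⊛ z ⊕ s ≋ 0P
      z-equation = P.trans (P.trans
        (solve 4 (λ m u a s → m :* (u :+ a) :+ s := m :* u :+ (m :* a :+ s)) P.refl m (u zero) (dot a w) s)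
        (P.+-congˡ (P.sym (P.trans
            (PS.dot-cong (λ _ → P.refl) (λ j → P.trans (u-split j) (P.+-congʳ (P.*-comm (w j) m))))
          (P.trans (PS.dot-+ a _ r) (P.+-congʳ (PS.dot-· a w m)))))))
        (P.trans (P.sym (dot-cons m a u)) ker)

      s-deg : deg< E s
      s-deg = deg<-sum (λ j → deg<-* (proj₂ (bounded a) j) (r-deg j))

      -- Since m z = - s, dividing s = v m + t gives m (z + v) + t = 0, and uniqueness of division
      -- yields z = - v, so `z` inherits the bound of the quotient.
      z-deg : deg< E z
      z-deg with divide monic-m E s-deg
      ... | v , t , v-deg , t-deg , eq = deg<-resp
        (P.sym (-≋0 (P.trans (solve 2 (λ z v → z :- :- v := z :+ v) P.refl z v)
          (monic-regular monic-m (z ⊕ v) t-deg (P.trans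
            (solve 4 (λ m z v t → m :* (z :+ v) :+ t := m :* z :+ (v :* m :+ t)) P.refl m z v t)
            (P.trans (P.+-congˡ (P.sym eq)) z-equation))))))
        (deg<-neg v-deg)

      small : Fin (suc q) → Pol (suc n)
      small = cons z r

      small-kernel : C.Kernel row small
      small-kernel = P.trans (dot-cons m a small) z-equation

      coefficients : ∃ λ U → ∀ j → small j ≋ L.apply U j
      coefficients = assemble-onto small (λ { zero → z-deg ; (suc j) → deg<-mono (ℕₚ.m≤n+m d _) (r-deg j) })

      recombine : ∀ i → dot w (λ j → relation j i) ⊕ small i ≋ u i
      recombine zero = P.trans (P.+-cong
          (P.trans (PS.sum-cong (λ j → solve 2 (λ w a → w :* :- a := :- (a :* w)) P.refl (w j) (a j)))
          (PS.sum-neg _)) P.refl)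
        (solve 2 (λ a u → :- a :+ (u :+ a) := u) P.refl (dot a w) (u zero))
      recombine (suc i) = P.trans (P.+-congʳ (P.trans (PS.dot-· w (λ j → δ j i) m) (P.*-congˡ (PS.dot-δʳ w i))))
        (P.trans (P.+-congʳ (P.*-comm m (w i))) (P.sym (u-split i)))

    kernel-generated : ¬¬ (∃ λ G → C.Generates G (C.Kernel row))
    kernel-generated = let (K , M , eq) = constraints in
      C.coherent-matrix coherent-n M >>= λ { (H , H-ker , H-gen) →
      return (tabulate relation ++ map L.apply H
        , All.++⁺ (All.tabulate⁺ relation-kernel)
            (All.map⁺ (All.map (λ {U} ker → P.trans (eq U) (poly-0 ker)) H-ker))
        , λ u ker → let open Reduce u ker
                        (U , small≋) = coefficients in
            resp recombine (add
              (C.span-sum w relation (λ j → gen (∈-++⁺ˡ (∈-tabulate⁺ j))))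
              (resp (λ i → P.sym (small≋ i)) (span-⊆ (gen ∘ ∈-++⁺ʳ (tabulate relation)) (L.span-map (H-gen U
                (poly-zero (P.trans (P.sym (eq U))
                    (P.trans (PS.dot-cong (λ _ → P.refl) (λ i → P.sym (small≋ i))) small-kernel)))))))) ) }

  -- Lets one assume that the pivot comes first and is monic.
  prepend : ∀ {n q} (a : Fin q → Pol n) i x → (∃ λ G → C.Generates G (C.Kernel (cons (x ⊛ a i) a))) →
            ∃ λ G → C.Generates G (C.Kernel a)
  prepend {n} {q} a i x (G , G-ker , G-gen) = map (apply fold) G
    , All.map⁺ (All.map (λ {u} ker → P.trans (dot-fold u) ker) G-ker)
    , λ u ker → resp (λ j → solve 2 (λ u y → u :+ con (0 , 0) :* y := u) P.refl (u j) (x ⊛ δ i j))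
        (span-map fold (G-gen (cons 0P u)
            (P.trans (dot-cons _ a _) (P.trans (P.+-congʳ (P.zeroʳ _)) (P.trans (P.+-identityˡ _) ker)))))
    where
    open Semilinear
    fold : Semilinear (C.vectors {n} (suc q)) (C.vectors q)
    fold = record
      { onScalar = λ a → a
      ; apply = λ u j → u (suc j) ⊕ u zero ⊛ (x ⊛ δ i j)
      ; cong = λ e j → P.+-cong (e (suc j)) (P.*-congʳ (e zero))
      ; homo-0 = λ j → solve 1 (λ y → con (0 , 0) := con (0 , 0) :+ con (0 , 0) :* y) P.refl (x ⊛ δ i j)
      ; homo-+ = λ u v j → solve 5 (λ u v u₀ v₀ y → (u :+ u₀ :* y) :+ (v :+ v₀ :* y) := (u :+ v) :+ (u₀ :+ v₀) :* y)
          P.refl (u (suc j)) (v (suc j)) (u zero) (v zero) (x ⊛ δ i j)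
      ; homo-· = λ b u j → solve 4 (λ b u u₀ y → b :* (u :+ u₀ :* y) := b :* u :+ (b :* u₀) :* y)
          P.refl b (u (suc j)) (u zero) (x ⊛ δ i j) }
    dot-fold : ∀ u → dot a (apply fold u) ≋ dot (cons (x ⊛ a i) a) u
    dot-fold u = P.trans (PS.dot-+ a (u ∘ suc) _) (P.trans (P.+-congˡ
        (P.trans (PS.dot-· a _ (u zero)) (P.*-congˡ (P.trans (PS.dot-· a _ x) (P.*-congˡ (PS.dot-δ a i))))))
      (P.trans (solve 3 (λ s u y → s :+ u :* y := y :* u :+ s) P.refl (dot a (u ∘ suc)) (u zero) (x ⊛ a i))
        (P.sym (dot-cons _ a u))))

  sub-sum : ∀ {k n m} (f : Fin m → Pol k) (hs : Vec (Pol n) k) → sub (sum f) hs ≋ sum (λ i → sub (f i) hs)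
  sub-sum {m = zero}  f hs = P.trans (P.reflexive (≡.cong (λ g → sub g hs) (PS.sum-zero f)))
    (P.trans (sub-0 hs) (P.reflexive (≡.sym (PS.sum-zero _))))
  sub-sum {m = suc m} f hs = P.trans (P.reflexive (≡.cong (λ g → sub g hs) (PS.sum-suc f)))
    (P.trans (sub-+ (f zero) _ hs) (P.trans (P.+-congˡ (sub-sum (f ∘ suc) hs)) (P.reflexive (≡.sym (PS.sum-suc _)))))

  sub-dot : ∀ {k n m} (a u : Fin m → Pol k) (hs : Vec (Pol n) k) →
            sub (dot a u) hs ≋ dot (λ i → sub (a i) hs) (λ i → sub (u i) hs)
  sub-dot a u hs = P.trans (sub-sum _ hs) (PS.sum-cong (λ i → sub-* (a i) (u i) hs))

  -- Substituting `to` carries the kernel of `a` into that of the transformed row, and `from` brings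
  -- the generators back. The scalars are substituted too, so the map back is semilinear.
  transport : ∀ {n q} (a : Fin q → Pol n) (φ : CoordinateChange n) →
              (∃ λ G → C.Generates G (C.Kernel (λ i → sub (a i) (CoordinateChange.to φ)))) →
              ∃ λ G → C.Generates G (C.Kernel a)
  transport {n} {q} a φ (G , G-ker , G-gen) = map (apply back) G
    , All.map⁺ (All.map (λ {u} ker → P.trans (PS.dot-cong (λ i → P.sym (sub-to-from (a i))) (λ _ → P.refl))
        (P.trans (P.sym (sub-dot _ u from)) (P.trans (sub-cong from ker) (sub-0 from)))) G-ker)
    , λ u ker → resp (λ i → sub-to-from (u i)) (span-map back (G-gen (λ i → sub (u i) to)
        (P.trans (P.sym (sub-dot a u to)) (P.trans (sub-cong to ker) (sub-0 to)))))
    where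
    open CoordinateChange φ
    open Semilinear
    back : Semilinear (C.vectors {n} q) (C.vectors q)
    back = record
      { onScalar = λ a → sub a from
      ; apply = λ u i → sub (u i) from
      ; cong = λ e i → sub-cong from (e i)
      ; homo-0 = λ i → P.sym (sub-0 from)
      ; homo-+ = λ u v i → P.sym (sub-+ (u i) (v i) from)
      ; homo-· = λ a u i → P.sym (sub-* a (u i) from) }

  zeros-or-pivot : ∀ {n q} (a : Fin q → Pol n) → ¬¬ ((∀ i → a i ≋ 0P) ⊎ ∃ λ i → ∃ (NonZeroAt (a i)))
  zeros-or-pivot {q = zero}  a = return (inj₁ λ ())
  zeros-or-pivot {q = suc q} a = nonzero-or-zero (a zero) >>= λ
    { (inj₂ nz) → return (inj₂ (zero , nz))
    ; (inj₁ z) → zeros-or-pivot (a ∘ suc) >>= λ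
      { (inj₁ zs) → return (inj₁ λ { zero → z ; (suc i) → zs i })
      ; (inj₂ (i , nz)) → return (inj₂ (suc i , nz)) } }

  dot-zeros : ∀ {n q} {a : Fin q → Pol n} → (∀ i → a i ≋ 0P) → ∀ u → dot a u ≋ 0P
  dot-zeros zs u = PS.sum-0 (λ i → P.trans (P.*-congʳ (zs i)) (P.zeroˡ (u i)))

  coherent : ∀ n → C.Coherent {n}
  coherent zero a = zeros-or-pivot a >>= λ
    { (inj₁ zs) → return (tabulate δ , C.basis-generates (dot-zeros zs))
    ; (inj₂ (i , [] , nz)) → return (unit-row i nz) }
    where
    unit-row : ∀ i → NonZeroAt (a i) [] → ∃ λ G → C.Generates G (C.Kernel a)
    unit-row i nz = tabulate relation , All.tabulate⁺ relation-kernel , λ u ker →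
        resp (recombine u ker) (C.span-sum u relation (λ j → gen (∈-tabulate⁺ j)))
      where
      x = con (proj₁ (inverse (ev (a i) []) nz))
      x-inverse : a i ⊛ x ≋ 1P
      x-inverse = pw λ { [] → F.trans (ev-* (a i) x []) (proj₂ (inverse (ev (a i) []) nz)) }
      -- e_j - (a_j / a_i) e_i
      relation : Fin _ → Fin _ → Pol 0
      relation j k = δ j k ⊖ (x ⊛ a j) ⊛ δ i k
      relation-kernel : ∀ j → C.Kernel a (relation j)
      relation-kernel j = P.trans (PS.dot-- a (δ j) _) (P.trans (P.+-cong (PS.dot-δ a j)
          (P.-‿cong (P.trans (PS.dot-· a (δ i) _) (P.*-congˡ (PS.dot-δ a i)))))
        (P.trans (solve 3 (λ b x a → b :- (x :* b) :* a := b :- (a :* x) :* b) P.refl (a j) x (a i))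
          (≋-0 (P.sym (P.trans (P.*-congʳ x-inverse) (P.*-identityˡ (a j)))))))
      recombine : ∀ u → C.Kernel a u → ∀ k → dot u (λ j → relation j k) ≋ u k
      recombine u ker k = P.trans (PS.dot-- u _ _) (P.trans (P.+-cong
          (PS.dot-δʳ u k)
          (P.-‿cong (P.trans (PS.sum-cong
              (λ j → solve 4 (λ u x a d → u :* ((x :* a) :* d) := (x :* d) :* (a :* u)) P.refl (u j) x (a j) (δ i k)))
            (P.trans (P.sym (PS.*-distribˡ-sum _ _)) (P.*-congˡ ker)))))
        (solve 2 (λ u y → u :- y :* con (0 , 0) := u) P.refl (u k) (x ⊛ δ i k)))
  coherent (suc n) a = zeros-or-pivot a >>= λ
    { (inj₁ zs) → return (tabulate δ , C.basis-generates (dot-zeros zs))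
    ; (inj₂ (i , nz)) → make-monic (a i) nz >>= λ made →
        -- After the change of coordinates the pivot is monic up to the unit `lead`. A normalised
        -- copy is placed in front of the row, so no permutation of entries is involved.
        let open MadeMonic made
            b = λ j → sub (a j) (CoordinateChange.to change)
            x = constant (proj₁ (inverse lead lead≉0))
        in MonicRow.kernel-generated (coherent n) (ι x ⊛ b i)
             (Top-resp (P.trans (constant-* _ _)
                 (constant-cong (F.trans (F.*-comm _ _) (proj₂ (inverse lead lead≉0))))) P.refl (Top-· x top)) b
                 >>= λ gens →
           return (transport a change (prepend b i (ι x) gens)) }

-- Saturation and vanishing ideals of images.

module Saturation {c ℓ} (F : Field c ℓ) (ac : FieldDefs.AlgebraicallyClosed F) where
  open Field F using (Carrier; _≈_; 0#; 1#; inverse)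
  private module F = Field F
  open Polynomials F
  open InfiniteField F ac
  open Degrees F ac
  open HilbertBasis F ac
  open Homogeneous F ac
  open CoherentPolynomials F ac
  open DoubleNegation
  open S
  open PS using (sum; dot; δ)
  open IsIdeal

  ideal-coefficients : ∀ {n} {G : List (Pol n)} {f} → ⟨ G ⟩ f → ∃ λ a → f ≋ dot a (lookup G)
  ideal-coefficients (gen g) = δ (index g) , P.trans (P.reflexive (lookup-index g)) (P.sym (PS.sum-δ (index g) _))
  ideal-coefficients {G = G} null = (λ _ → 0P) , P.sym (PS.dot-0ˡ {_} {length G} _)
  ideal-coefficients (add p q) with ideal-coefficients p | ideal-coefficients q
  ... | a , e | b , f = (λ j → a j ⊕ b j) , P.trans (P.+-cong e f)
    (P.sym (PS.dot-+ˡ a b _))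
  ideal-coefficients (scale x p) with ideal-coefficients p
  ... | a , e = (λ j → x ⊛ a j) , P.trans (P.*-congˡ e)
    (P.sym (PS.dot-·ˡ a _ x))
  ideal-coefficients (resp eq p) with ideal-coefficients p
  ... | a , e = a , P.trans (P.sym eq) e

  ideal-sum : ∀ {n m} {I : Pol n → Set (c ⊔ ℓ)} → IsIdeal I → {f : Fin m → Pol n} → (∀ i → I (f i)) → I (sum f)
  ideal-sum {m = zero}  ideal h = ideal-resp ideal (P.reflexive (≡.sym (PS.sum-zero _))) (ideal-0 ideal)
  ideal-sum {m = suc m} ideal h = ideal-resp ideal (P.reflexive (≡.sym (PS.sum-suc _)))
    (ideal-+ ideal (h zero) (ideal-sum ideal (h ∘ suc)))

  infixr 8 _^_
  _^_ : ∀ {n} → Pol n → ℕ → Pol n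
  f ^ zero  = 1P
  f ^ suc k = f ⊛ f ^ k

  ^-+ : ∀ {n} (f : Pol n) k l → f ^ (k ℕ.+ l) ≋ f ^ k ⊛ f ^ l
  ^-+ f zero    l = P.sym (P.*-identityˡ _)
  ^-+ f (suc k) l = P.trans (P.*-congˡ (^-+ f k l)) (P.sym (P.*-assoc f _ _))

  module _ {n} (J : List (Pol n)) (Δ : Pol n) where

    Colon : ℕ → Pol n → Set (c ⊔ ℓ)
    Colon k g = ⟨ J ⟩ (Δ ^ k ⊛ g)

    colon-isIdeal : ∀ k → IsIdeal (Colon k)
    colon-isIdeal k = record
      { ideal-resp = λ e p → resp (P.*-congˡ e) p
      ; ideal-0 = resp (P.sym (P.zeroʳ _)) null
      ; ideal-+ = λ p q → resp (P.sym (P.distribˡ _ _ _)) (add p q)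
      ; ideal-* = λ a {f} p → resp (solve 3 (λ a x f → a :* (x :* f) := x :* (a :* f)) P.refl a (Δ ^ k) f)
          (scale a p) }

    colon-raise : ∀ m k {g} → Colon k g → Colon (m ℕ.+ k) g
    colon-raise m k p = resp (P.trans (P.sym (P.*-assoc _ _ _)) (P.*-congʳ (P.sym (^-+ Δ m k)))) (scale (Δ ^ m) p)

    -- That Δ^k g lies in ⟨ J ⟩ means that `g` is the first entry of a syzygy of Δ^k followed by
    -- `J`; coherence supplies finitely many such syzygies.
    colon-generated : ∀ k → ¬¬ (∃ λ G → All (Colon k) G × (∀ g → Colon k g → ⟨ G ⟩ g))
    colon-generated k = coherent n (cons (Δ ^ k) (lookup J)) >>= λ { (G , G-ker , G-gen) →
      return (map (λ u → u zero) G
        , All.map⁺ (All.map (λ {u} ker → ideal-resp (span-isIdeal J)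
            (P.sym (-≋0 (P.trans (solve 2 (λ x s → x :- :- s := x :+ s) P.refl (Δ ^ k ⊛ u zero)
                (dot (lookup J) (u ∘ suc)))
              (P.trans (P.sym (dot-cons _ (lookup J) u)) ker))))
            (ideal-neg (span-isIdeal J)
                (ideal-sum (span-isIdeal J) (λ j → resp (P.*-comm _ _) (scale (u (suc j)) (gen (∈-lookup j)))))))
          G-ker)
        , λ g p → let (a , e) = ideal-coefficients p in
            Semilinear.span-map first (G-gen (cons g (λ j → neg (a j))) (P.trans (dot-cons _ (lookup J) _)
              (P.trans (P.+-cong e (P.trans (PS.sum-cong (λ j → solve 2 (λ x a → x :* :- a := :- (a :* x)) P.refl
                  (lookup J j) (a j))) (PS.sum-neg _)))
                (P.-‿inverseʳ _)))) ) }
      where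
      first : ∀ {q} → Semilinear (C.vectors {n} (suc q)) (polynomials n)
      first = record
        { onScalar = λ a → a ; apply = λ u → u zero ; cong = λ e → e zero
        ; homo-0 = P.refl ; homo-+ = λ u v → P.refl ; homo-· = λ a u → P.refl }

    Saturated : Pol n → Set (c ⊔ ℓ)
    Saturated g = ∃ λ k → Colon k g

    saturated-isIdeal : IsIdeal Saturated
    saturated-isIdeal = record
      { ideal-resp = λ { e (k , p) → k , ideal-resp (colon-isIdeal k) e p }
      ; ideal-0 = 0 , ideal-0 (colon-isIdeal 0)
      ; ideal-+ = λ { {f} {g} (k , p) (l , q) → l ℕ.+ k , ideal-+ (colon-isIdeal (l ℕ.+ k)) (colon-raise l k p)
          (≡.subst (λ m → Colon m g) (ℕₚ.+-comm k l) (colon-raise k l q)) }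
      ; ideal-* = λ { a (k , p) → k , ideal-* (colon-isIdeal k) a p } }

    common-exponent : ∀ {G} → All Saturated G → ∃ λ k → All (Colon k) G
    common-exponent []             = 0 , []
    common-exponent ((k , p) ∷ ps) with common-exponent ps
    ... | l , qs = l ℕ.+ k , colon-raise l k p ∷ All.map (λ {g} q → ≡.subst (λ m → Colon m g) (ℕₚ.+-comm k l)
        (colon-raise k l q)) qs

    -- By Hilbert's basis theorem the chain of ideals (J : Δ^k) becomes stationary; since each of them is
    -- finitely generated by coherence, this is a finite statement and the generators are exact.
    saturation-generated : ¬¬ (∃ λ G → All Saturated G × (∀ g → Saturated g → ⟨ G ⟩ g))
    saturation-generated =
      noetherian n Saturated saturated-isIdeal >>= λ { (B , B-in , B-gen) →
      let (K , B-colon) = common-exponent B-in in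
      colon-generated (suc K) >>= λ { (H , H-colon , H-gen) →
      ¬¬-All (All.map (λ {h} p → B-gen h (suc K , p) >>= λ q → return (span-⊆-ideal (colon-isIdeal K) B-colon q))
          H-colon) >>= λ stable →
      colon-generated K >>= λ { (G , G-colon , G-gen) →
      return (G , All.map (λ p → K , p) G-colon , λ { g (k , p) →
        G-gen g (descend K (λ f q → span-⊆-ideal (colon-isIdeal K) stable (H-gen f q)) k g
          (≡.subst (λ m → Colon m g) (ℕₚ.+-comm K k) (colon-raise K k p))) }) }}}
      where
      -- Regrouping the power applies stability to Δ^m g in place of g, which removes one factor Δ
      -- at a time until Δ^K is left.
      descend : ∀ K → (∀ f → Colon (suc K) f → Colon K f) → ∀ m g → Colon (m ℕ.+ K) g → Colon K g
      descend K step zero    g p = p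
      descend K step (suc m) g p = descend K step m g (resp (P.trans
          (solve 3 (λ x y g → x :* (y :* g) := (y :* x) :* g) P.refl (Δ ^ K) (Δ ^ m) g)
              (P.*-congʳ (P.sym (^-+ Δ m K))))
        (step (Δ ^ m ⊛ g) (resp (P.trans (P.*-congʳ (P.*-congˡ (^-+ Δ m K)))
          (solve 4 (λ d x y g → (d :* (y :* x)) :* g := (d :* x) :* (y :* g)) P.refl Δ (Δ ^ K) (Δ ^ m) g)) p)))

  sub-congruence : ∀ {k n} {I : Pol n → Set (c ⊔ ℓ)} → IsIdeal I → (f : Pol k) {gs hs : Vec (Pol n) k} →
    (∀ i → I (Vec.lookup gs i ⊖ Vec.lookup hs i)) → I (sub f gs ⊖ sub f hs)
  sub-congruence ideal (con a) e = ideal-resp ideal (P.sym (P.-‿inverseʳ _)) (ideal-0 ideal)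
  sub-congruence ideal nil     e = ideal-resp ideal (P.sym (P.-‿inverseʳ _)) (ideal-0 ideal)
  sub-congruence ideal (a ◂ f) {g ∷ gs} {h ∷ hs} e = ideal-resp ideal
    (solve 6 (λ a b g h x y → (a :- b) :+ (x :* (g :- h) :+ h :* (x :- y)) := (a :+ g :* x) :- (b :+ h :* y)) P.refl
      (sub a gs) (sub a hs) g h (sub f (g ∷ gs)) (sub f (h ∷ hs)))
    (ideal-+ ideal (sub-congruence ideal a (e ∘ suc))
      (ideal-+ ideal (ideal-* ideal _ (e zero)) (ideal-* ideal h (sub-congruence ideal f {g ∷ gs} {h ∷ hs} e))))

  vanishing-isIdeal : ∀ {k n} (φ : Vec (Pol n) k) → IsIdeal (λ f → sub f φ ≋ 0P)
  vanishing-isIdeal φ = record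
    { ideal-resp = λ e p → P.trans (sub-cong φ (P.sym e)) p
    ; ideal-0 = sub-0 φ
    ; ideal-+ = λ {f} {g} p q → P.trans (sub-+ f g φ) (P.trans (P.+-cong p q) (P.+-identityˡ 0P))
    ; ideal-* = λ a {f} p → P.trans (sub-* a f φ) (P.trans (P.*-congˡ p) (P.zeroʳ _)) }

  -- The scaling factor is itself the value of a polynomial at the same point; with Δ in this role
  -- the pointwise identity becomes one between polynomials.
  component-homogeneous : ∀ {n} (f : Pol n) ws d (g : Pol n) v →
    ev (component f ws d) (rescale ws (ev g v) v) ≈ ev (g ^ d ⊛ component f ws d) v
  component-homogeneous f ws d g v = F.trans (homogeneous f ws d v)
    (F.sym (F.trans (ev-* (g ^ d) _ v) (F.*-congʳ (ev-^ d))))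
    where
    open RingSolver F.commutativeRing renaming (solve to solveF; _:*_ to _F:*_; _:+_ to _F:+_; _:=_ to _F:=_) hiding (_:-_; :-_; con)
    s = ev g v
    power : ℕ → Carrier
    power zero    = 1#
    power (suc k) = s F.* power k
    ev-^ : ∀ k → ev (g ^ k) v ≈ power k
    ev-^ zero    = ev-constant 1# v
    ev-^ (suc k) = F.trans (ev-* g _ v) (F.*-congˡ (ev-^ k))
    homogeneous : ∀ {n} (f : Pol n) ws d v → ev (component f ws d) (rescale ws s v) ≈ power d F.* ev
        (component f ws d) v
    homogeneous (con a) ws           zero    v       = F.sym (F.*-identityˡ a)
    homogeneous (con a) ws           (suc d) v       = F.sym (F.zeroʳ _)
    homogeneous nil     ws           d       v       = F.sym (F.zeroʳ _)
    homogeneous (a ◂ f) (true ∷ ws)  zero    (x ∷ v) = F.trans (F.+-cong (homogeneous a ws zero v) (F.zeroʳ _))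
      (F.trans (F.+-identityʳ _) (F.*-congˡ (F.sym (F.trans (F.+-congˡ (F.zeroʳ x)) (F.+-identityʳ _)))))
    homogeneous (a ◂ f) (true ∷ ws)  (suc d) (x ∷ v) =
      F.trans (F.+-cong (homogeneous a ws (suc d) v) (F.*-congˡ (homogeneous f (true ∷ ws) d (x ∷ v))))
        (solveF 5 (λ s p a x f → (s F:* p) F:* a F:+ (s F:* x) F:* (p F:* f) F:= (s F:* p) F:* (a F:+ x F:* f)) F.refl
            s (power d) _ x _)
    homogeneous (a ◂ f) (false ∷ ws) d       (x ∷ v) =
      F.trans (F.+-cong (homogeneous a ws d v) (F.*-congˡ (homogeneous f (false ∷ ws) d (x ∷ v))))
        (solveF 4 (λ p a x f → p F:* a F:+ x F:* (p F:* f) F:= p F:* (a F:+ x F:* f)) F.refl (power d) _ x _)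

  powerSum-zero : ∀ e h → (∀ t → powerSum e h t ≈ 0#) → ∀ d → suc d ≤ e → h d ≈ 0#
  powerSum-zero e h z d = at-index e h (horner-zero-coefficients (list e h) (λ t → F.trans (as-horner e h t) (z t))) d
    where
    list : ℕ → (ℕ → Carrier) → List Carrier
    list zero    h = []
    list (suc e) h = h 0 ∷ list e (h ∘ suc)
    as-horner : ∀ e h t → horner (list e h) t ≈ powerSum e h t
    as-horner zero    h t = F.refl
    as-horner (suc e) h t = F.+-congˡ (F.*-congˡ (as-horner e (h ∘ suc) t))
    at-index : ∀ e h → All (_≈ 0#) (list e h) → ∀ d → suc d ≤ e → h d ≈ 0#
    at-index (suc e) h (p ∷ ps) zero    l       = p
    at-index (suc e) h (p ∷ ps) (suc d) (s≤s l) = at-index e (h ∘ suc) ps d l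

  -- The Zariski closure of the image of φ, for a map φ that up to the denominator Δ is inverse to sel on the zero set of J.
  module Closure {N D} (ws : Vec Bool N) (J : List (Pol N)) (Δ : Pol N)
    (φ : Vec (Pol D) N) (sel : Vec (Pol N) D)
    (inverts : ∀ i → ⟨ J ⟩ ((if Vec.lookup ws i then Δ ⊛ var i else var i) ⊖ sub (Vec.lookup φ i) sel))
    (J-vanishes : All (λ f → sub f φ ≋ 0P) J)
    (closed-under-scaling : ∀ t q → ∃ λ q′ → evs φ q′ ≈ᵥ rescale ws t (evs φ q))
    (Δ-nonzero : ∃ (NonZeroAt (sub Δ φ))) where

    -- Scaling moves φ(q) within the image, so the sum of t^e times the values of the components is
    -- zero for all t, and an infinite field separates the powers of t. The number of terms is
    -- raised to at least d + 1 so that index d occurs.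
    component-vanishes : ∀ g → sub g φ ≋ 0P → ∀ d → sub (component g ws d) φ ≋ 0P
    component-vanishes g z d = pw λ q → F.trans (ev-sub (component g ws d) φ q) (F.trans
      (powerSum-zero (B ℕ.⊔ suc d) (λ e → ev (component g ws e) (evs φ q)) (λ t →
        let (q′ , e) = closed-under-scaling t q in
        F.trans (F.sym (proj₂ (component-sum g ws) (B ℕ.⊔ suc d) (ℕₚ.m≤m⊔n B (suc d)) t (evs φ q)))
          (F.trans (F.sym (ev-cong g e)) (F.trans (F.sym (ev-sub g φ q′)) (F.trans (at z q′) (ev-0 q′)))))
        d (ℕₚ.m≤n⊔m B (suc d)))
      (F.sym (ev-0 q)))
      where B = proj₁ (component-sum g ws)

    scaled : Vec (Pol N) N
    scaled = Vec.tabulate (λ i → if Vec.lookup ws i then Δ ⊛ var i else var i)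

    scaled-rescale : ∀ v → evs scaled v ≈ᵥ rescale ws (ev Δ v) v
    scaled-rescale v i = F.trans
        (F.reflexive (≡.trans (lookup-evs scaled v i) (≡.cong (λ f → ev f v) (Vec.lookup∘tabulate _ i))))
      (F.trans (by-weight (Vec.lookup ws i)) (F.reflexive (≡.sym (lookup-rescale ws (ev Δ v) v i))))
      where
      by-weight : ∀ b → ev (if b then Δ ⊛ var i else var i) v ≈
          (if b then ev Δ v F.* Vec.lookup v i else Vec.lookup v i)
      by-weight true  = F.trans (ev-* Δ _ v) (F.*-congˡ (ev-var i v))
      by-weight false = ev-var i v

    -- The exponent is d because multiplying the weighted variables by Δ multiplies the component by
    -- Δ^d; modulo `J` the result may be evaluated at φ after `sel`, where it is 0.
    component-saturated : ∀ g → sub g φ ≋ 0P → ∀ d → Saturated J Δ (component g ws d)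
    component-saturated g z d = d , resp
      (P.trans (P.+-congˡ (P.-‿cong (P.trans (P.sym (sub-sub f φ sel))
          (P.trans (sub-cong sel (component-vanishes g z d)) (sub-0 sel)))))
        (P.trans (solve 1 (λ x → x :- con (0 , 0) := x) P.refl _)
          (pw λ v → F.trans (ev-sub f scaled v) (F.trans (ev-cong f (scaled-rescale v))
              (component-homogeneous g ws d Δ v)))))
      (sub-congruence (span-isIdeal J) f {scaled} {Vec.map (λ p → sub p sel) φ} (λ i → resp
        (P.+-cong (P.reflexive (≡.sym (Vec.lookup∘tabulate _ i)))
            (P.-‿cong (P.reflexive (≡.sym (Vec.lookup-map i _ φ))))) (inverts i)))
      where f = component g ws d

    kernel-saturated : ∀ g → sub g φ ≋ 0P → Saturated J Δ g
    kernel-saturated g z = ideal-resp (saturated-isIdeal J Δ)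
      (pw λ v → F.trans (ev-total B _ v) (F.trans (F.sym (proj₂ (component-sum g ws) B ℕₚ.≤-refl 1# v))
          (ev-cong g (rescale-1 ws v))))
      (total-saturated B (component g ws) (component-saturated g z))
      where
      B = proj₁ (component-sum g ws)
      total : ℕ → (ℕ → Pol N) → Pol N
      total zero    h = 0P
      total (suc e) h = h 0 ⊕ total e (h ∘ suc)
      ev-total : ∀ e h v → ev (total e h) v ≈ powerSum e (λ d → ev (h d) v) 1#
      ev-total zero    h v = ev-0 v
      ev-total (suc e) h v = F.trans (ev-+ (h 0) _ v)
          (F.+-congˡ (F.trans (ev-total e (h ∘ suc) v) (F.sym (F.*-identityˡ _))))
      total-saturated : ∀ e h → (∀ d → Saturated J Δ (h d)) → Saturated J Δ (total e h)
      total-saturated zero    h s = ideal-0 (saturated-isIdeal J Δ)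
      total-saturated (suc e) h s = ideal-+ (saturated-isIdeal J Δ) (s 0) (total-saturated e (h ∘ suc) (s ∘ suc))

    -- After substituting φ a power of Δ times `g` is zero, and Δ composed with φ, being nonzero
    -- somewhere, can be cancelled.
    saturated-vanishes : ∀ {g} → Saturated J Δ g → sub g φ ≋ 0P
    saturated-vanishes {g} (k , p) = cancel-power k (P.trans (P.sym (sub-* (Δ ^ k) g φ))
        (span-⊆-ideal (vanishing-isIdeal φ) J-vanishes p))
      where
      cancel-power : ∀ k → sub (Δ ^ k) φ ⊛ sub g φ ≋ 0P → sub g φ ≋ 0P
      cancel-power zero    z = P.trans (P.sym (P.trans (P.*-congʳ
        (pw λ q → F.trans (ev-sub 1P φ q) (F.trans (ev-constant 1# (evs φ q)) (F.sym (ev-constant 1# q)))))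
            (P.*-identityˡ _))) z
      cancel-power (suc k) z = cancel-power k (regular (sub Δ φ) _ (proj₂ Δ-nonzero)
        (P.trans (P.sym (P.*-assoc _ _ _)) (P.trans (P.*-congʳ (P.sym (sub-* Δ (Δ ^ k) φ))) z)))

    closure : ¬¬ (∃ λ G → (∀ {f} → f ∈ J → ⟨ G ⟩ f) × All (λ g → sub g φ ≋ 0P) G × (∀ g → sub g φ ≋ 0P → ⟨ G ⟩ g))
    closure = saturation-generated J Δ >>= λ { (G , G-sat , G-gen) →
      return (G
        , (λ {f} f∈ → G-gen f (0 , resp (P.sym (P.*-identityˡ f)) (gen f∈)))
        , All.map saturated-vanishes G-sat
        , λ g z → G-gen g (kernel-saturated g z)) }

-- Fraction-free elimination.

module Elimination {c ℓ} (F : Field c ℓ) (ac : FieldDefs.AlgebraicallyClosed F) where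
  open Field F using (0#; 1#; 1≉0)
  private module F = Field F
  open Polynomials F
  open InfiniteField F ac
  open Degrees F ac
  open HilbertBasis F ac
  open CoherentPolynomials F ac
  open Saturation F ac
  open DoubleNegation
  open S
  open PS using (dot; δ)
  open IsIdeal

  nonzero-product : ∀ {n} {f g : Pol n} → ∃ (NonZeroAt f) → ∃ (NonZeroAt g) → ¬¬ (∃ (NonZeroAt (f ⊛ g)))
  nonzero-product {f = f} {g} (v , nf) (w , ng) = nonzero-or-zero (f ⊛ g) >>= λ
    { (inj₁ z) → contradiction (F.trans (at (regular f g nf z) w) (ev-0 w)) ng
    ; (inj₂ nz) → return nz }

  sub-1 : ∀ {k n} (hs : Vec (Pol n) k) → sub 1P hs ≋ 1P
  sub-1 hs = pw λ v → F.trans (ev-sub 1P hs v) (F.trans (ev-constant 1# (evs hs v)) (F.sym (ev-constant 1# v)))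

  sub-neg : ∀ {k n} (f : Pol k) (hs : Vec (Pol n) k) → sub (neg f) hs ≋ neg (sub f hs)
  sub-neg f hs = pw λ v → F.trans (ev-sub (neg f) hs v) (F.trans (ev-neg f (evs hs v))
    (F.sym (F.trans (ev-neg (sub f hs) v) (F.-‿cong (ev-sub f hs v)))))

  -- Fraction-free elimination: the kernel of the rows is parametrised, up to the denominator,
  -- by the coordinates selected by τ.
  module _ {m N} (us : Vec (Pol N) m) {I : Pol N → Set (c ⊔ ℓ)} (ideal : IsIdeal I) {n} (y : Fin n → Pol N) where

    private
      ρ : Pol m → Pol N
      ρ f = sub f us

    -- By `selects` the columns of Φ are the unit vectors times the denominator in the selected
    -- coordinates. Conversely `inverts` says, as in Cramer's rule, that modulo `I` the vector `y`
    -- times the denominator is the combination of these columns with coefficients `y ∘ τ`.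
    record Solution (rows : List (Fin n → Pol m)) (n′ : ℕ) : Set (c ⊔ ℓ) where
      field
        denominator : Pol m
        nonzero     : ∃ (NonZeroAt denominator)
        Φ           : Fin n → Fin n′ → Pol m
        τ           : Fin n′ → Fin n
        solves      : All (λ h → ∀ l → dot h (λ i → Φ i l) ≋ 0P) rows
        selects     : ∀ l l′ → Φ (τ l) l′ ≋ denominator ⊛ δ l l′
        inverts     : ∀ i → I (ρ denominator ⊛ y i ⊖ dot (y ∘ τ) (λ l → ρ (Φ i l)))

    initial : Solution [] n
    initial = record
      { denominator = 1P
      ; nonzero = Vec.replicate m 0# , λ e → 1≉0 (F.trans (F.sym (ev-constant 1# (Vec.replicate m 0#))) e)
      ; Φ = δ ; τ = λ i → i ; solves = []
      ; selects = λ l l′ → P.sym (P.*-identityˡ _)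
      ; inverts = λ i → ideal-resp ideal (P.sym (≋-0 (P.trans (P.trans (P.*-congʳ (sub-1 us)) (P.*-identityˡ _))
          (P.sym (P.trans (PS.dot-comm y _) (P.trans (PS.dot-cong (λ l → ρ-δ i l) (λ _ → P.refl)) (PS.sum-δ i y)))))))
              (ideal-0 ideal) }
      where
      ρ-δ : ∀ {k} (i j : Fin k) → ρ (δ i j) ≋ δ i j
      ρ-δ zero    zero    = sub-1 us
      ρ-δ zero    (suc j) = sub-0 us
      ρ-δ (suc i) zero    = sub-0 us
      ρ-δ (suc i) (suc j) = ρ-δ i j

    module Step {rows n′} (s : Solution rows n′) (h : Fin n → Pol m) (h-in : I (dot (ρ ∘ h) y)) where
      open Solution s

      -- The condition that the new row imposes on the parameters.
      η : Fin n′ → Pol m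
      η l = dot h (λ i → Φ i l)

      unchanged : (∀ l → η l ≋ 0P) → Solution (h ∷ rows) n′
      unchanged zs = record
        { denominator = denominator ; nonzero = nonzero ; Φ = Φ ; τ = τ
        ; solves = zs ∷ solves ; selects = selects ; inverts = inverts }

      -- The relation h · y, multiplied by the denominator, is rewritten through `inverts` as a
      -- relation between the selected coordinates alone.
      η-in : I (dot (y ∘ τ) (ρ ∘ η))
      η-in = ideal-resp ideal
        (P.trans (P.+-congˡ (P.-‿cong
            (P.trans (PS.dot-- (ρ ∘ h) _ _) (P.+-congʳ (PS.dot-· (ρ ∘ h) y (ρ denominator))))))
          (P.trans (solve 2 (λ a b → a :- (a :- b) := b) P.refl _ _)
          (P.trans (PS.dot-sum (ρ ∘ h) (y ∘ τ) (λ l i → ρ (Φ i l)))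
            (PS.dot-cong (λ _ → P.refl) (λ l → P.sym (sub-dot h (λ i → Φ i l) us))))))
        (ideal-- ideal (ideal-* ideal (ρ denominator) h-in)
          (ideal-sum ideal (λ i → ideal-* ideal (ρ (h i)) (inverts i))))

    -- The relation between the parameters is solved for the one with index `j` by
    -- cross-multiplication, as in Φ′. Its coefficient enters the denominator, and the contributions
    -- of parameter `j` cancel in `identity`.
    pivot : ∀ {rows n′} (s : Solution rows (suc n′)) (h : Fin n → Pol m) (h-in : I (dot (ρ ∘ h) y)) →
            ∀ j → ∃ (NonZeroAt (Step.η s h h-in j)) → ¬¬ Solution (h ∷ rows) n′
    pivot {rows} {n′} s h h-in j nz = nonzero-product nz nonzero >>= λ nz′ → return (record
      { denominator = η j ⊛ denominator ; nonzero = nz′ ; Φ = Φ′ ; τ = τ ∘ punchIn j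
      ; solves = (λ l → P.trans (row-Φ′ h l) (P.trans (P.+-congʳ (P.*-comm (η j) _)) (P.-‿inverseʳ _)))
               ∷ All.map (λ {g} zs l → P.trans (row-Φ′ g l)
                   (P.trans (P.+-cong (P.*-congˡ (zs (punchIn j l))) (P.-‿cong (P.*-congˡ (zs j))))
                   (solve 2 (λ a b → a :* con (0 , 0) :- b :* con (0 , 0) := con (0 , 0)) P.refl (η j)
                       (η (punchIn j l))))) solves
      ; selects = λ l l′ → P.trans (P.+-cong
            (P.*-congˡ (P.trans (selects (punchIn j l) (punchIn j l′))
                (P.*-congˡ (P.reflexive (PS.δ-punchIn j l l′)))))
            (P.-‿cong (P.*-congˡ (P.trans (selects (punchIn j l) j) (P.*-congˡ (P.reflexive (PS.δ-punchIn-0 j l)))))))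
          (solve 4 (λ a d x b → a :* (d :* x) :- b :* (d :* con (0 , 0)) := (a :* d) :* x) P.refl (η j) denominator
              (δ l l′) (η (punchIn j l′)))
      ; inverts = λ i → ideal-resp ideal (identity i)
          (ideal-+ ideal (ideal-* ideal (ρ (η j)) (inverts i)) (ideal-* ideal (ρ (Φ i j)) η-in)) })
      where
      open Solution s
      open Step s h h-in
      Φ′ : Fin n → Fin n′ → Pol m
      Φ′ i l = η j ⊛ Φ i (punchIn j l) ⊖ η (punchIn j l) ⊛ Φ i j
      row-Φ′ : ∀ g l → dot g (λ i → Φ′ i l) ≋ η j ⊛ dot g (λ i → Φ i (punchIn j l)) ⊖ η (punchIn j l) ⊛ dot g
          (λ i → Φ i j)
      row-Φ′ g l = P.trans (PS.dot-- g _ _) (P.+-cong (PS.dot-· g _ (η j)) (P.-‿cong (PS.dot-· g _ _)))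
      Y = y ∘ τ
      Y′ = y ∘ τ ∘ punchIn j
      ρ-Φ′ : ∀ i l → ρ (Φ′ i l) ≋ ρ (η j) ⊛ ρ (Φ i (punchIn j l)) ⊖ ρ (Φ i j) ⊛ ρ (η (punchIn j l))
      ρ-Φ′ i l = P.trans (sub-+ _ _ us) (P.+-cong (sub-* (η j) _ us)
        (P.trans (sub-neg _ us) (P.-‿cong (P.trans (sub-* _ _ us) (P.*-comm _ _)))))
      identity : ∀ i → ρ (η j) ⊛ (ρ denominator ⊛ y i ⊖ dot Y (λ l → ρ (Φ i l))) ⊕ ρ (Φ i j) ⊛ dot Y (ρ ∘ η)
                     ≋ ρ (η j ⊛ denominator) ⊛ y i ⊖ dot Y′ (λ l → ρ (Φ′ i l))
      identity i = P.trans (P.+-cong (P.*-congˡ (P.+-congˡ (P.-‿cong (PS.sum-remove j _))))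
          (P.*-congˡ (PS.sum-remove j _)))
        (P.trans (solve 7 (λ e d y Y f s t → e :* (d :* y :- (Y :* f :+ s)) :+ f :* (Y :* e :+ t) := (e :* d) :* y :-
            (e :* s :- f :* t))
            P.refl (ρ (η j)) (ρ denominator) (y i) (Y j) (ρ (Φ i j)) (dot Y′ (λ l → ρ (Φ i (punchIn j l))))
                (dot Y′ (λ l → ρ (η (punchIn j l)))))
          (P.sym (P.+-cong (P.*-congʳ (sub-* (η j) denominator us)) (P.-‿cong
            (P.trans (PS.dot-cong (λ _ → P.refl) (ρ-Φ′ i))
                (P.trans (PS.dot-- Y′ _ _) (P.+-cong (PS.dot-· Y′ _ _) (P.-‿cong (PS.dot-· Y′ _ _)))))))))

    -- A row costs at most one parameter: either all solutions so far satisfy it, or a nonzero η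
    -- serves as pivot.
    eliminate : ∀ rows → All (λ h → I (dot (ρ ∘ h) y)) rows → ¬¬ (∃ λ n′ → n ≤ n′ ℕ.+ length rows × Solution rows n′)
    eliminate []         []       = return (n , ℕₚ.m≤m+n n 0 , initial)
    eliminate (h ∷ rows) (p ∷ ps) = eliminate rows ps >>= λ { (n′ , le , s) → extend n′ le s }
      where
      extend : ∀ n′ → n ≤ n′ ℕ.+ length rows → Solution rows n′ → ¬¬ (∃ λ n′ → n ≤ n′ ℕ.+ length (h ∷ rows) × Solution
          (h ∷ rows) n′)
      extend n′ le s = zeros-or-pivot (Step.η s h p) >>= λ
        { (inj₁ zs) → return (n′ , ℕₚ.≤-trans le (ℕₚ.+-monoʳ-≤ n′ (ℕₚ.n≤1+n _)) , Step.unchanged s h p zs)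
        ; (inj₂ (j , nz)) → use-pivot n′ le s j nz }
        where
        use-pivot : ∀ n′ → n ≤ n′ ℕ.+ length rows → (s : Solution rows n′) → ∀ j → ∃ (NonZeroAt (Step.η s h p j)) →
                    ¬¬ (∃ λ n′ → n ≤ n′ ℕ.+ length (h ∷ rows) × Solution (h ∷ rows) n′)
        use-pivot (suc k) le s j nz = pivot s h p j nz >>= λ s′ →
          return (k , ℕₚ.≤-trans le (ℕₚ.≤-reflexive (≡.sym (ℕₚ.+-suc k (length rows)))) , s′)

-- Flags of irreducible strata.

module Flags {c ℓ} (F : Field c ℓ) (ac : FieldDefs.AlgebraicallyClosed F) where
  open Field F using (Carrier; _≈_; 0#; 1#; 1≉0)
  private module F = Field F
  open Polynomials F
  open InfiniteField F ac
  open Degrees F ac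
  open HilbertBasis F ac
  open Homogeneous F ac
  open Saturation F ac
  open DoubleNegation
  open S
  open IsIdeal

  -- A rational parametrisation of a part of the zero set of J. The weights mark the variables
  -- (before and after parametrisation) that are scaled simultaneously.
  record Parametrization {N} (weight : Vec Bool N) (J : List (Pol N)) (D : ℕ) : Set (c ⊔ ℓ) where
    field
      φ          : Vec (Pol D) N
      sel        : Vec (Pol N) D
      Δ          : Pol N
      weight′    : Vec Bool D
      base       : Vec Carrier D
      inverts    : ∀ i → ⟨ J ⟩ ((if Vec.lookup weight i then Δ ⊛ var i else var i) ⊖ sub (Vec.lookup φ i) sel)
      vanishes   : All (λ f → sub f φ ≋ 0P) J
      scales     : ∀ t q → evs φ (rescale weight′ t q) ≈ᵥ rescale weight t (evs φ q)
      selects    : ∀ l q → ev (Vec.lookup sel l) (evs φ q) ≈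
                   (if Vec.lookup weight′ l then ev Δ (evs φ q) F.* Vec.lookup q l else Vec.lookup q l)
      base-zero  : ∀ l → Vec.lookup weight′ l ≡ true → Vec.lookup base l ≈ 0#
      Δ-nonzero  : ∀ q → (∀ l → Vec.lookup weight′ l ≡ false → Vec.lookup q l ≈ Vec.lookup base l) → ¬
          (ev Δ (evs φ q) ≈ 0#)

  evs-cong : ∀ {k n} (gs : Vec (Pol n) k) {v w} → v ≈ᵥ w → evs gs v ≈ᵥ evs gs w
  evs-cong gs {v} {w} e i = F.trans (F.reflexive (lookup-evs gs v i))
    (F.trans (ev-cong (Vec.lookup gs i) e) (F.reflexive (≡.sym (lookup-evs gs w i))))

  evs-sub : ∀ {k m n} (gs : Vec (Pol m) k) (hs : Vec (Pol n) m) v →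
            evs (Vec.map (λ g → sub g hs) gs) v ≈ᵥ evs gs (evs hs v)
  evs-sub gs hs v i = F.trans (F.reflexive (≡.trans (lookup-evs (Vec.map (λ g → sub g hs) gs) v i)
      (≡.cong (λ g → ev g v) (Vec.lookup-map i _ gs))))
    (F.trans (ev-sub (Vec.lookup gs i) hs v) (F.reflexive (≡.sym (lookup-evs gs (evs hs v) i))))

  span-vanishes : ∀ {n} {G : List (Pol n)} {v} → All (λ g → ev g v ≈ 0#) G → ∀ {f} → ⟨ G ⟩ f → ev f v ≈ 0#
  span-vanishes         zs (gen g)     = All.lookup zs g
  span-vanishes {v = v} zs null        = ev-0 v
  span-vanishes {v = v} zs (add p q)   = F.trans (ev-+ _ _ v)
    (F.trans (F.+-cong (span-vanishes zs p) (span-vanishes zs q)) (F.+-identityˡ 0#))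
  span-vanishes {v = v} zs (scale a p) = F.trans (ev-* a _ v) (F.trans (F.*-congˡ (span-vanishes zs p)) (F.zeroʳ _))
  span-vanishes {v = v} zs (resp e p)  = F.trans (F.sym (at e v)) (span-vanishes zs p)

  module Strata {N} {weight : Vec Bool N} {J : List (Pol N)} {D} (π : Parametrization weight J D) where
    open Parametrization π

    free : ℕ → Fin D → Bool
    free i l = toℕ l ℕ.<ᵇ i

    <ᵇ-true : ∀ {m n} → m ℕ.< n → (m ℕ.<ᵇ n) ≡ true
    <ᵇ-true {zero}  {suc n} l       = ≡.refl
    <ᵇ-true {suc m} {suc n} (s≤s l) = <ᵇ-true l

    <ᵇ-false : ∀ {m n} → n ℕ.≤ m → (m ℕ.<ᵇ n) ≡ false
    <ᵇ-false {m}     {zero}  l       = ≡.refl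
    <ᵇ-false {suc m} {suc n} (s≤s l) = <ᵇ-false l

    clamp : ℕ → Vec (Pol D) D
    clamp i = Vec.tabulate (λ l → if free i l then var l else constant (Vec.lookup base l))

    clamp-value : ∀ i q l → Vec.lookup (evs (clamp i) q) l ≈ (if free i l then Vec.lookup q l else Vec.lookup base l)
    clamp-value i q l = F.trans
        (F.reflexive (≡.trans (lookup-evs (clamp i) q l) (≡.cong (λ g → ev g q) (Vec.lookup∘tabulate _ l))))
        (by-case (free i l))
      where
      by-case : ∀ b → ev (if b then var l else constant (Vec.lookup base l)) q ≈
          (if b then Vec.lookup q l else Vec.lookup base l)
      by-case true  = ev-var l q
      by-case false = ev-constant _ q

    φᵢ : ℕ → Vec (Pol D) N
    φᵢ i = Vec.map (λ g → sub g (clamp i)) φ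

    -- These equations hold coordinate `l` at its base value; added to `J` they make `sel` invert
    -- the clamped map as well. Free coordinates receive the trivial equation so that the list is
    -- indexed by all of `Fin D`.
    fixing : ℕ → Fin D → Pol N
    fixing i l = if free i l then 0P else Vec.lookup sel l ⊖ constant (Vec.lookup base l)

    Jᵢ : ℕ → List (Pol N)
    Jᵢ i = J ++ tabulate (fixing i)

    ev-φᵢ : ∀ i q → evs (φᵢ i) q ≈ᵥ evs φ (evs (clamp i) q)
    ev-φᵢ i q = evs-sub φ (clamp i) q

    sel-clamp : ∀ i l → ⟨ Jᵢ i ⟩ (Vec.lookup sel l ⊖ Vec.lookup (Vec.map (λ g → sub g sel) (clamp i)) l)
    sel-clamp i l = resp (P.+-congˡ (P.-‿cong (P.reflexive (≡.sym (≡.trans (Vec.lookup-map l _ (clamp i))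
        (≡.cong (λ g → sub g sel) (Vec.lookup∘tabulate _ l)))))))
      (by-case (free i l) ≡.refl)
      where
      by-case : ∀ b → free i l ≡ b → ⟨ Jᵢ i ⟩
          (Vec.lookup sel l ⊖ sub (if b then var l else constant (Vec.lookup base l)) sel)
      by-case true  eq = resp (P.sym (≋-0 (P.sym (sub-var l sel)))) null
      by-case false eq = resp (P.trans
          (P.reflexive (≡.cong (λ b → if b then 0P else Vec.lookup sel l ⊖ constant (Vec.lookup base l)) eq))
          (P.+-congˡ (P.-‿cong (pw λ v → F.trans (ev-constant _ v)
              (F.sym (F.trans (ev-sub (constant (Vec.lookup base l)) sel v) (ev-constant _ (evs sel v))))))))
        (gen (∈-++⁺ʳ J (∈-tabulate⁺ l)))

    invertsᵢ : ∀ i k → ⟨ Jᵢ i ⟩ ((if Vec.lookup weight k then Δ ⊛ var k else var k) ⊖ sub (Vec.lookup (φᵢ i) k) sel)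
    invertsᵢ i k = resp (P.trans (solve 3 (λ x y z → (x :- y) :+ (y :- z) := x :- z) P.refl _ (sub f sel)
        (sub f (Vec.map (λ g → sub g sel) (clamp i))))
        (P.+-congˡ (P.-‿cong (P.trans (P.sym (sub-sub f (clamp i) sel))
            (P.reflexive (≡.cong (λ g → sub g sel) (≡.sym (Vec.lookup-map k _ φ))))))))
      (add (span-⊆ (gen ∘ ∈-++⁺ˡ) (inverts k)) (sub-congruence (span-isIdeal (Jᵢ i)) f (sel-clamp i)))
      where f = Vec.lookup φ k

    vanishesᵢ : ∀ i → All (λ f → sub f (φᵢ i) ≋ 0P) (Jᵢ i)
    vanishesᵢ i = All.++⁺ (All.map (λ {f} z → P.trans (P.sym (sub-sub f φ (clamp i)))
        (P.trans (sub-cong (clamp i) z) (sub-0 (clamp i)))) vanishes)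
      (All.tabulate⁺ (λ l → by-case l (free i l) ≡.refl))
      where
      -- A weighted coordinate is recovered only up to the factor Δ, which is harmless because its
      -- base value is 0.
      fixed-value : ∀ l b → Vec.lookup weight′ l ≡ b → ∀ x y → y ≈ Vec.lookup base l → (if b then x F.* y else y) ≈
          Vec.lookup base l
      fixed-value l true  eq x y e = F.trans (F.*-congˡ (F.trans e (base-zero l eq)))
          (F.trans (F.zeroʳ x) (F.sym (base-zero l eq)))
      fixed-value l false eq x y e = e
      by-case : ∀ l b → free i l ≡ b → sub (if b then 0P else Vec.lookup sel l ⊖ constant (Vec.lookup base l))
          (φᵢ i) ≋ 0P
      by-case l true  eq = sub-0 (φᵢ i)
      by-case l false eq = pw λ q → F.trans (ev-sub (Vec.lookup sel l ⊖ constant (Vec.lookup base l)) (φᵢ i) q)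
        (F.trans (ev-- (Vec.lookup sel l) _ (evs (φᵢ i) q)) (F.trans (F.+-cong
          (F.trans (ev-cong (Vec.lookup sel l) (ev-φᵢ i q)) (F.trans (selects l (evs (clamp i) q))
            (fixed-value l (Vec.lookup weight′ l) ≡.refl _ _ (F.trans (clamp-value i q l)
              (F.reflexive (≡.cong (λ b → if b then Vec.lookup q l else Vec.lookup base l) eq))))))
          (F.-‿cong (ev-constant _ (evs (φᵢ i) q)))) (F.trans (F.-‿inverseʳ _) (F.sym (ev-0 q)))))

    rescale-cong : ∀ {n} (ws : Vec Bool n) t {v w} → v ≈ᵥ w → rescale ws t v ≈ᵥ rescale ws t w
    rescale-cong ws t {v} {w} e i = F.trans (F.reflexive (lookup-rescale ws t v i))
      (F.trans (by-weight (Vec.lookup ws i)) (F.reflexive (≡.sym (lookup-rescale ws t w i))))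
      where
      by-weight : ∀ b → (if b then t F.* Vec.lookup v i else Vec.lookup v i) ≈
          (if b then t F.* Vec.lookup w i else Vec.lookup w i)
      by-weight true  = F.*-congˡ (e i)
      by-weight false = e i

    -- Clamping commutes with scaling because scaled coordinates are clamped to 0 and the others are
    -- not scaled.
    clamp-rescale : ∀ i t q → evs (clamp i) (rescale weight′ t q) ≈ᵥ rescale weight′ t (evs (clamp i) q)
    clamp-rescale i t q l = F.trans (clamp-value i (rescale weight′ t q) l)
        (F.trans (by-case (free i l) (Vec.lookup weight′ l) ≡.refl)
        (F.sym (F.trans (F.reflexive (lookup-rescale weight′ t (evs (clamp i) q) l))
            (by-weight (Vec.lookup weight′ l)))))
      where
      by-weight : ∀ b → (if b then t F.* Vec.lookup (evs (clamp i) q) l else Vec.lookup (evs (clamp i) q) l) ≈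
                  (if b then t F.* (if free i l then Vec.lookup q l else Vec.lookup base l) else
                      (if free i l then Vec.lookup q l else Vec.lookup base l))
      by-weight true  = F.*-congˡ (clamp-value i q l)
      by-weight false = clamp-value i q l
      by-case : ∀ f b → Vec.lookup weight′ l ≡ b → (if f then Vec.lookup
          (rescale weight′ t q) l else Vec.lookup base l) ≈
                (if b then t F.* (if f then Vec.lookup q l else Vec.lookup base l) else
                    (if f then Vec.lookup q l else Vec.lookup base l))
      by-case true  b     eq = F.reflexive (≡.trans (lookup-rescale weight′ t q l)
          (≡.cong (λ b → if b then t F.* Vec.lookup q l else Vec.lookup q l) eq))
      by-case false true  eq = F.trans (base-zero l eq) (F.sym (F.trans (F.*-congˡ (base-zero l eq)) (F.zeroʳ t)))
      by-case false false eq = F.refl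

    scalesᵢ : ∀ i t q → evs (φᵢ i) (rescale weight′ t q) ≈ᵥ rescale weight t (evs (φᵢ i) q)
    scalesᵢ i t q k = F.trans (ev-φᵢ i (rescale weight′ t q) k) (F.trans (evs-cong φ (clamp-rescale i t q) k)
      (F.trans (scales t (evs (clamp i) q) k) (rescale-cong weight t (λ k → F.sym (ev-φᵢ i q k)) k)))

    clamp-base : ∀ i l → Vec.lookup (evs (clamp i) base) l ≈ Vec.lookup base l
    clamp-base i l = F.trans (clamp-value i base l) (same (free i l))
      where
      same : ∀ b → (if b then Vec.lookup base l else Vec.lookup base l) ≈ Vec.lookup base l
      same true  = F.refl
      same false = F.refl

    -- `hold` and `dense` together identify the ideal of the equations with the vanishing ideal of
    -- the clamped image, so the zero set is its Zariski closure.
    record Stratum (i : ℕ) : Set (c ⊔ ℓ) where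
      field
        equations : List (Pol N)
        extends   : ∀ {f} → f ∈ Jᵢ i → ⟨ equations ⟩ f
        hold      : All (λ g → sub g (φᵢ i) ≋ 0P) equations
        dense     : ∀ g → sub g (φᵢ i) ≋ 0P → ⟨ equations ⟩ g

    stratum : ∀ i → ¬¬ Stratum i
    stratum i = Closure.closure weight (Jᵢ i) Δ (φᵢ i) sel (invertsᵢ i) (vanishesᵢ i)
        (λ t q → rescale weight′ t q , scalesᵢ i t q)
        (base , λ z → Δ-nonzero (evs (clamp i) base) (λ l _ → clamp-base i l)
          (F.trans (ev-cong Δ (λ k → F.sym (ev-φᵢ i base k))) (F.trans (F.sym (ev-sub Δ (φᵢ i) base)) z))) >>= λ
      { (G , ext , hold , dense) → return (record { equations = G ; extends = ext ; hold = hold ; dense = dense }) }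

    open Stratum

    OnStratum : ∀ {i} → Stratum i → Vec Carrier N → Set (c ⊔ ℓ)
    OnStratum s v = VanishAt (equations s) v

    image-on : ∀ {i} (s : Stratum i) q → OnStratum s (evs (φᵢ i) q)
    image-on {i} s q = All.map (λ {g} z → F.trans (F.sym (ev-sub g (φᵢ i) q)) (F.trans (at z q) (ev-0 q))) (hold s)

    on-cong : ∀ {i} (s : Stratum i) {v w} → v ≈ᵥ w → OnStratum s v → OnStratum s w
    on-cong s e = All.map (λ {g} z → F.trans (F.sym (ev-cong g e)) z)

    on-J : ∀ {i} (s : Stratum i) {v} → OnStratum s v → VanishAt J v
    on-J s on = All.tabulate (λ f∈ → span-vanishes on (extends s (∈-++⁺ˡ f∈)))

    -- The covering is consulted at image points only. Pulled back, it covers an affine space, and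
    -- `dense` extends the verdict from the image to the closure.
    stratum-irreducible : ∀ {i} (s : Stratum i) (fs gs : List (Pol N)) →
      (∀ v → OnStratum s v → VanishAt fs v ⊎ VanishAt gs v) →
      (∀ v → OnStratum s v → VanishAt fs v) ⊎ (∀ v → OnStratum s v → VanishAt gs v)
    stratum-irreducible {i} s fs gs h with affine-irreducible (map pull fs) (map pull gs) (λ q →
        Data.Sum.map (vanish-pull fs q) (vanish-pull gs q) (h (evs (φᵢ i) q) (image-on s q)))
      where
      pull : Pol N → Pol D
      pull f = sub f (φᵢ i)
      vanish-pull : ∀ fs q → VanishAt fs (evs (φᵢ i) q) → VanishAt (map pull fs) q
      vanish-pull fs q zs = All.map⁺ (All.map (λ {f} z → F.trans (ev-sub f (φᵢ i) q) z) zs)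
    ... | inj₁ z = inj₁ λ v on → All.tabulate
        (λ {f} f∈ → span-vanishes on (dense s f (pw λ q → F.trans (All.lookup (All.map⁻ (z q)) f∈) (F.sym (ev-0 q)))))
    ... | inj₂ z = inj₂ λ v on → All.tabulate
        (λ {f} f∈ → span-vanishes on (dense s f (pw λ q → F.trans (All.lookup (All.map⁻ (z q)) f∈) (F.sym (ev-0 q)))))

    clamp-clamp : ∀ {i j} → i ≤ j → ∀ q → evs (clamp j) (evs (clamp i) q) ≈ᵥ evs (clamp i) q
    clamp-clamp {i} {j} i≤j q l = F.trans (clamp-value j (evs (clamp i) q) l) (by-case (toℕ l ℕ.<? j))
      where
      by-case : Dec (toℕ l ℕ.< j) → (if free j l then Vec.lookup (evs (clamp i) q) l else Vec.lookup base l) ≈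
          Vec.lookup (evs (clamp i) q) l
      by-case (yes l<j) = F.reflexive (≡.cong (λ b → if b then Vec.lookup (evs (clamp i) q) l else Vec.lookup base l)
          (<ᵇ-true l<j))
      by-case (no l≮j)  = F.trans
          (F.reflexive (≡.cong (λ b → if b then Vec.lookup (evs (clamp i) q) l else Vec.lookup base l)
          (<ᵇ-false (ℕₚ.≮⇒≥ l≮j))))
        (F.sym (F.trans (clamp-value i q l)
            (F.reflexive (≡.cong (λ b → if b then Vec.lookup q l else Vec.lookup base l)
            (<ᵇ-false (ℕₚ.≤-trans i≤j (ℕₚ.≮⇒≥ l≮j)))))))

    -- Points clamped at `i` are unchanged by clamping at `j`, so the equations of the larger
    -- stratum vanish on the smaller image and belong to its ideal by `dense`.
    strata-increase : ∀ {i j} → i ≤ j → (s : Stratum i) (t : Stratum j) → ∀ v → OnStratum s v → OnStratum t v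
    strata-increase {i} {j} i≤j s t v on = All.map (λ {g} z → span-vanishes on (dense s g (pw λ q →
        F.trans (ev-sub g (φᵢ i) q) (F.trans (ev-cong g (λ k → F.trans (ev-φᵢ i q k)
            (F.trans (evs-cong φ (λ l → F.sym (clamp-clamp i≤j q l)) k) (F.sym (ev-φᵢ j (evs (clamp i) q) k)))))
          (F.trans (F.sym (ev-sub g (φᵢ j) (evs (clamp i) q)))
              (F.trans (at z (evs (clamp i) q)) (F.trans (ev-0 (evs (clamp i) q)) (F.sym (ev-0 q)))))))))
      (hold t)

    -- Coordinate `l` of the base point is raised by one. If it is weighted, the unweighted
    -- coordinates still agree with the base, so Δ is nonzero there and `sel` takes the value Δ
    -- instead of 0; otherwise `sel` sees the shift by 1 directly. Either way an equation of the
    -- smaller stratum fails.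
    strata-strict : ∀ (l : Fin D) {i} → i ≡ toℕ l → (s : Stratum i) (t : Stratum (suc (toℕ l))) →
      ∃ λ v → OnStratum t v × ¬ OnStratum s v
    strata-strict l ≡.refl s t = evs φ q , on-cong t (λ k → F.trans (ev-φᵢ (suc (toℕ l)) q k) (evs-cong φ clamped k))
        (image-on t q) , off
      where
      q : Vec Carrier D
      q = base [ l ]≔ (Vec.lookup base l F.+ 1#)
      q-l : Vec.lookup q l ≡ Vec.lookup base l F.+ 1#
      q-l = Vec.lookup∘update l base _
      q-other : ∀ k → ¬ (k ≡ l) → Vec.lookup q k ≡ Vec.lookup base k
      q-other k k≢l = Vec.lookup∘update′ k≢l base _
      clamped : evs (clamp (suc (toℕ l))) q ≈ᵥ q
      clamped k = F.trans (clamp-value (suc (toℕ l)) q k) (by-case (toℕ k ℕ.<? suc (toℕ l)))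
        where
        by-case : Dec (toℕ k ℕ.< suc (toℕ l)) → (if free (suc (toℕ l)) k then Vec.lookup q k else Vec.lookup base k) ≈
            Vec.lookup q k
        by-case (yes k<) = F.reflexive (≡.cong (λ b → if b then Vec.lookup q k else Vec.lookup base k) (<ᵇ-true k<))
        by-case (no k≮)  = F.trans (F.reflexive (≡.cong (λ b → if b then Vec.lookup q k else Vec.lookup base k)
            (<ᵇ-false (ℕₚ.≮⇒≥ k≮))))
          (F.reflexive (≡.sym (q-other k (λ k≡l → k≮ (ℕₚ.≤-reflexive (≡.cong (suc ∘ toℕ) k≡l))))))
      off : ¬ OnStratum s (evs φ q)
      off on = by-weight (Vec.lookup weight′ l) ≡.refl (F.trans (F.sym (selects l q)) sel≈base)
        where
        sel≈base : ev (Vec.lookup sel l) (evs φ q) ≈ Vec.lookup base l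
        sel≈base = -≈0 (F.trans (F.+-congˡ (F.-‿cong (F.sym (ev-constant _ (evs φ q)))))
            (F.trans (F.sym (ev-- _ _ (evs φ q)))
          (span-vanishes on (resp (P.reflexive
              (≡.cong (λ b → if b then 0P else Vec.lookup sel l ⊖ constant (Vec.lookup base l))
              (<ᵇ-false {toℕ l} ℕₚ.≤-refl)))
            (extends s (∈-++⁺ʳ J (∈-tabulate⁺ l)))))))
        by-weight : ∀ b → Vec.lookup weight′ l ≡ b → ¬
            ((if b then ev Δ (evs φ q) F.* Vec.lookup q l else Vec.lookup q l) ≈ Vec.lookup base l)
        by-weight true  eq e = Δ-nonzero q
            (λ k k-false → F.reflexive (q-other k (λ { ≡.refl → contradiction (≡.trans (≡.sym eq) k-false) (λ ()) })))
          (F.trans (F.sym (F.trans (F.*-congˡ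
              (F.trans (F.reflexive q-l) (F.trans (F.+-congʳ (base-zero l eq)) (F.+-identityˡ 1#))))
              (F.*-identityʳ _)))
            (F.trans e (base-zero l eq)))
        by-weight false eq e = 1≉0 (F.trans (F.sym (F.trans (F.+-congʳ (F.-‿inverseˡ _)) (F.+-identityˡ 1#)))
          (F.trans (F.+-assoc _ _ _) (F.trans (F.+-congˡ (F.trans (F.reflexive (≡.sym q-l)) e))
              (F.-‿inverseˡ (Vec.lookup base l)))))

-- Parametrising the zero set of a system of forms.

module BilinearSystem {c ℓ} (F : Field c ℓ) (ac : FieldDefs.AlgebraicallyClosed F) where
  open Field F using (Carrier; _≈_; 0#; 1#; inverse)
  private
    module F = Field F
    module SF = Sums F.commutativeRing
  open Polynomials F
  open InfiniteField F ac
  open Degrees F ac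
  open HilbertBasis F ac
  open Homogeneous F ac
  open CoherentPolynomials F ac
  open Saturation F ac
  open Elimination F ac
  open Flags F ac
  open DoubleNegation
  open S
  open PS using (dot; δ)
  open IsIdeal

  ev-dot : ∀ {n m} (f g : Fin m → Pol n) v → ev (dot f g) v ≈ SF.dot (λ i → ev (f i) v) (λ i → ev (g i) v)
  ev-dot f g v = F.trans (ev-sum _ v) (SF.sum-cong (λ i → ev-* (f i) (g i) v))

  ev-δ : ∀ {n m} (i j : Fin m) (v : Vec Carrier n) → ev (δ i j) v ≈ SF.δ i j
  ev-δ zero    zero    v = ev-constant 1# v
  ev-δ zero    (suc j) v = ev-0 v
  ev-δ (suc i) zero    v = ev-0 v
  ev-δ (suc i) (suc j) v = ev-δ i j v

  split : ∀ m {n} (k : Fin (m ℕ.+ n)) → (∃ λ i → i ↑ˡ n ≡ k) ⊎ (∃ λ j → m ↑ʳ j ≡ k)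
  split zero    k       = inj₂ (k , ≡.refl)
  split (suc m) zero    = inj₁ (zero , ≡.refl)
  split (suc m) (suc k) with split m k
  ... | inj₁ (i , ≡.refl) = inj₁ (suc i , ≡.refl)
  ... | inj₂ (j , ≡.refl) = inj₂ (j , ≡.refl)

  append : ∀ {a m n} {A : Set a} → (Fin m → A) → (Fin n → A) → Vec A (m ℕ.+ n)
  append f g = Vec.tabulate f Vec.++ Vec.tabulate g

  append-ˡ : ∀ {a m n} {A : Set a} (f : Fin m → A) (g : Fin n → A) i → Vec.lookup (append f g) (i ↑ˡ n) ≡ f i
  append-ˡ f g i = ≡.trans (Vec.lookup-++ˡ (Vec.tabulate f) (Vec.tabulate g) i) (Vec.lookup∘tabulate f i)

  append-ʳ : ∀ {a m n} {A : Set a} (f : Fin m → A) (g : Fin n → A) j → Vec.lookup (append f g) (m ↑ʳ j) ≡ g j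
  append-ʳ f g j = ≡.trans (Vec.lookup-++ʳ (Vec.tabulate f) (Vec.tabulate g) j) (Vec.lookup∘tabulate g j)

  ev-tabulate : ∀ {k n} (f : Fin k → Pol n) v i → Vec.lookup (evs (Vec.tabulate f) v) i ≈ ev (f i) v
  ev-tabulate f v i = F.reflexive (≡.trans (lookup-evs (Vec.tabulate f) v i)
      (≡.cong (λ g → ev g v) (Vec.lookup∘tabulate f i)))

  ev-append-ˡ : ∀ {m n k} (f : Fin m → Pol k) (g : Fin n → Pol k) v i → Vec.lookup (evs (append f g) v) (i ↑ˡ n) ≈ ev
      (f i) v
  ev-append-ˡ {n = n} f g v i = F.reflexive (≡.trans (lookup-evs (append f g) v (i ↑ˡ n))
      (≡.cong (λ h → ev h v) (append-ˡ f g i)))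

  ev-append-ʳ : ∀ {m n k} (f : Fin m → Pol k) (g : Fin n → Pol k) v j → Vec.lookup (evs (append f g) v) (m ↑ʳ j) ≈ ev
      (g j) v
  ev-append-ʳ {m} f g v j = F.reflexive (≡.trans (lookup-evs (append f g) v (m ↑ʳ j))
      (≡.cong (λ h → ev h v) (append-ʳ f g j)))

  weights : ∀ m n → Bool → Vec Bool (m ℕ.+ n)
  weights m n b = append {m = m} {n} (λ _ → b) (λ _ → if b then false else true)

  choose : ∀ {a} {A : Set a} {b b′} (x y : A) → b ≡ b′ → (if b then x else y) ≡ (if b′ then x else y)
  choose x y = ≡.cong (λ b → if b then x else y)

  module System (n₁ n₂ : ℕ) where

    N = n₁ ℕ.+ n₂

    x : Fin n₁ → Pol N
    x i = var (i ↑ˡ n₂)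

    y : Fin n₂ → Pol N
    y j = var (n₁ ↑ʳ j)

    xs : Vec (Pol N) n₁
    xs = Vec.tabulate x

    xForm : (Fin n₁ → Carrier) → Pol N
    xForm a = dot (λ i → constant (a i)) x

    yForm : (Fin n₂ → Pol n₁) → Pol N
    yForm r = dot (λ j → sub (r j) xs) y

    system : List (Fin n₁ → Carrier) → List (Fin n₂ → Pol n₁) → List (Pol N)
    system as rs = map xForm as ++ map yForm rs

    weight : Vec Bool N
    weight = weights n₁ n₂ false

    module Solve (as : List (Fin n₁ → Carrier)) (rs : List (Fin n₂ → Pol n₁)) where

      J = system as rs
      J-ideal = span-isIdeal J

      -- The coefficients of the forms in x are constants, so elimination takes place over `Pol 0`,
      -- where a nonzero denominator is invertible and is divided out in `κ`.
      xRows : List (Fin n₁ → Pol 0)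
      xRows = map (λ a i → con (a i)) as

      x-eliminated : ¬¬ (∃ λ m → n₁ ≤ m ℕ.+ length xRows × Solution [] J-ideal x xRows m)
      x-eliminated = eliminate [] J-ideal x xRows (All.map⁺ (All.tabulate (λ a∈ → gen (∈-++⁺ˡ (∈-map⁺ xForm a∈)))))

      module XSolved {m} (X : Solution [] J-ideal x xRows m) where
        private module X = Solution X

        d = ev X.denominator []
        d-inverse : ∃ λ e → d F.* e ≈ 1#
        d-inverse = inverse d (at-[] (X.nonzero))
          where
          at-[] : ∃ (NonZeroAt X.denominator) → ¬ (d ≈ 0#)
          at-[] ([] , nz) = nz
        d⁻¹ = proj₁ d-inverse
        d⁻¹d : d⁻¹ F.* d ≈ 1#
        d⁻¹d = F.trans (F.*-comm d⁻¹ d) (proj₂ d-inverse)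

        κ : Fin n₁ → Fin m → Carrier
        κ i l = d⁻¹ F.* ev (X.Φ i l) []

        line : Fin n₁ → Pol m
        line i = dot var (λ l → constant (κ i l))

        L : Vec (Pol m) n₁
        L = Vec.tabulate line

        xσ : Vec (Pol N) m
        xσ = Vec.tabulate (x ∘ X.τ)

        ev-line : ∀ i u → ev (line i) u ≈ SF.dot (Vec.lookup u) (κ i)
        ev-line i u = F.trans (ev-dot var _ u) (SF.dot-cong (λ l → ev-var l u) (λ l → ev-constant (κ i l) u))

        line-solves : All (λ a → ∀ u → SF.dot a (λ i → ev (line i) u) ≈ 0#) as
        line-solves = All.map (λ {a} zs u → F.trans (SF.dot-cong (λ _ → F.refl) (λ i → ev-line i u))
          (F.trans (SF.dot-sum a (Vec.lookup u) (λ l i → κ i l)) (SF.sum-0 (λ l → F.trans (F.*-congˡ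
            (F.trans (SF.dot-· a (λ i → ev (X.Φ i l) []) d⁻¹) (F.trans (F.*-congˡ
              (F.trans (F.sym (ev-dot (λ i → con (a i)) (λ i → X.Φ i l) [])) (at (zs l) []))) (F.zeroʳ d⁻¹))))
                  (F.zeroʳ _)))))
          (All.map⁻ X.solves)

        line-selects : ∀ l u → ev (line (X.τ l)) u ≈ Vec.lookup u l
        line-selects l u = F.trans (ev-line (X.τ l) u) (F.trans (SF.dot-comm (Vec.lookup u) _)
          (F.trans (SF.dot-cong (λ k → F.trans
              (F.*-congˡ (F.trans (at (X.selects l k) []) (ev-* X.denominator (δ l k) [])))
              (F.trans (F.sym (F.*-assoc d⁻¹ d _)) (F.trans (F.*-cong d⁻¹d (ev-δ l k [])) (F.*-identityˡ _))))
                  (λ _ → F.refl))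
            (SF.sum-δ l (Vec.lookup u))))

        line-inverts : ∀ i → ⟨ J ⟩ (x i ⊖ sub (line i) xσ)
        line-inverts i = resp (pw λ v → F.trans (ev-* (constant d⁻¹) _ v) (F.trans (F.*-cong (ev-constant d⁻¹ v)
            (F.trans (ev-- _ _ v) (F.+-cong (F.trans (ev-* _ (x i) v) (F.*-congʳ (ev-sub X.denominator [] v)))
              (F.-‿cong (F.trans (ev-dot (x ∘ X.τ) _ v)
                  (SF.dot-cong (λ _ → F.refl) (λ l → ev-sub (X.Φ i l) [] v)))))))
          (F.trans (solveF 4 (λ e d x s → e F:* (d F:* x F:- s) F:= (e F:* d) F:* x F:- e F:* s) F.refl d⁻¹ d
              (ev (x i) v) _)
          (F.sym (F.trans (ev-- (x i) _ v) (F.+-cong (F.sym (F.trans (F.*-congʳ d⁻¹d) (F.*-identityˡ _)))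
            (F.-‿cong (F.trans (ev-sub (line i) xσ v) (F.trans (ev-line i (evs xσ v))
              (F.trans (SF.dot-cong (ev-tabulate (x ∘ X.τ) v) (λ _ → F.refl))
                  (SF.dot-· _ (λ l → ev (X.Φ i l) []) d⁻¹)))))))))))
          (scale (constant d⁻¹) (X.inverts i))
          where open RingSolver F.commutativeRing renaming (solve to solveF; _:*_ to _F:*_; _:-_ to _F:-_; _:=_ to _F:=_) hiding (_:+_; :-_; con)

        yRows : List (Fin n₂ → Pol m)
        yRows = map (λ r j → sub (r j) L) rs

        -- Modulo `J` each x equals its linear expression in the selected x, so replacing x by
        -- `line` in a form linear in y changes it by a member of the ideal only.
        y-eliminated : ¬¬ (∃ λ n → n₂ ≤ n ℕ.+ length yRows × Solution xσ J-ideal y yRows n)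
        y-eliminated = eliminate xσ J-ideal y yRows (All.map⁺ (All.tabulate (λ {r} r∈ → resp
            (P.trans (P.+-congˡ (P.-‿cong
                (P.trans (PS.sum-cong (λ j → solve 3 (λ a b y → y :* (a :- b) := a :* y :- b :* y) P.refl
                (sub (r j) xs) (sub (sub (r j) L) xσ) (y j))) (PS.sum-- _ _))))
                (solve 2 (λ a b → a :- (a :- b) := b) P.refl (yForm r) _))
            (ideal-- J-ideal (gen (∈-++⁺ʳ (map xForm as) (∈-map⁺ yForm r∈)))
              (ideal-sum J-ideal (λ j → scale (y j) (resp (P.+-congˡ (P.-‿cong (P.sym (sub-sub (r j) L xσ))))
                (sub-congruence J-ideal (r j) {xs} {Vec.map (λ g → sub g xσ) L} (λ i → resp
                  (P.+-cong (P.reflexive (≡.sym (Vec.lookup∘tabulate x i))) (P.-‿cong (P.reflexive (≡.sym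
                    (≡.trans (Vec.lookup-map i (λ g → sub g xσ) L)
                        (≡.cong (λ g → sub g xσ) (Vec.lookup∘tabulate line i)))))))
                  (line-inverts i))))))))))

        module YSolved {n} (Y : Solution xσ J-ideal y yRows n) where
          private module Y = Solution Y

          D = n ℕ.+ m

          w : Fin n → Pol D
          w l = var (l ↑ˡ m)

          us : Vec (Pol D) m
          us = Vec.tabulate (λ l → var (n ↑ʳ l))

          φx : Fin n₁ → Pol D
          φx i = sub (line i) us

          φy : Fin n₂ → Pol D
          φy j = dot w (λ l → sub (Y.Φ j l) us)

          φ : Vec (Pol D) N
          φ = append φx φy

          sel : Vec (Pol N) D
          sel = append (y ∘ Y.τ) (x ∘ X.τ)

          Δ : Pol N
          Δ = sub Y.denominator xσ

          u₀ = proj₁ Y.nonzero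

          -- The linear parameters w start at 0, the fixed point of scaling; the parameters u start
          -- where the denominator is known to be nonzero.
          base : Vec Carrier D
          base = append {m = n} (λ _ → 0#) (Vec.lookup u₀)

          weight′ : Vec Bool D
          weight′ = weights n m true

          value-u : ∀ q l → Vec.lookup (evs us q) l ≈ Vec.lookup q (n ↑ʳ l)
          value-u q l = F.trans (ev-tabulate _ q l) (ev-var (n ↑ʳ l) q)

          value-φx : ∀ q i → ev (φx i) q ≈ ev (line i) (evs us q)
          value-φx q i = ev-sub (line i) us q

          value-φy : ∀ q j → ev (φy j) q ≈ SF.dot (λ l → Vec.lookup q (l ↑ˡ m)) (λ l → ev (Y.Φ j l) (evs us q))
          value-φy q j = F.trans (ev-dot w _ q) (SF.dot-cong (λ l → ev-var (l ↑ˡ m) q) (λ l → ev-sub (Y.Φ j l) us q))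

          x-at-φ : ∀ q i → ev (x i) (evs φ q) ≈ ev (line i) (evs us q)
          x-at-φ q i = F.trans (ev-var (i ↑ˡ n₂) (evs φ q)) (F.trans (ev-append-ˡ φx φy q i) (value-φx q i))

          y-at-φ : ∀ q j → ev (y j) (evs φ q) ≈ SF.dot (λ l → Vec.lookup q (l ↑ˡ m)) (λ l → ev (Y.Φ j l) (evs us q))
          y-at-φ q j = F.trans (ev-var (n₁ ↑ʳ j) (evs φ q)) (F.trans (ev-append-ʳ φx φy q j) (value-φy q j))

          xσ-at-φ : ∀ q → evs xσ (evs φ q) ≈ᵥ evs us q
          xσ-at-φ q l = F.trans (ev-tabulate _ (evs φ q) l) (F.trans (x-at-φ q (X.τ l)) (line-selects l (evs us q)))

          Δ-at-φ : ∀ q → ev Δ (evs φ q) ≈ ev Y.denominator (evs us q)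
          Δ-at-φ q = F.trans (ev-sub Y.denominator xσ (evs φ q)) (ev-cong Y.denominator (xσ-at-φ q))

          us-at-sel : ∀ v → evs us (evs sel v) ≈ᵥ evs xσ v
          us-at-sel v l = F.trans (value-u (evs sel v) l) (F.trans (ev-append-ʳ (y ∘ Y.τ) (x ∘ X.τ) v l)
              (F.sym (ev-tabulate _ v l)))

          inverts : ∀ k → ⟨ J ⟩ ((if Vec.lookup weight k then Δ ⊛ var k else var k) ⊖ sub (Vec.lookup φ k) sel)
          inverts k with split n₁ k
          ... | inj₁ (i , ≡.refl) = resp (P.+-cong (P.reflexive (≡.sym (choose _ _ (append-ˡ {m = n₁} {n₂} _ _ i))))
              (P.-‿cong (P.trans (pw λ v → F.trans (ev-sub (line i) xσ v) (F.sym (F.trans (ev-sub (φx i) sel v)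
                  (F.trans (value-φx (evs sel v) i) (ev-cong (line i) (us-at-sel v))))))
                (P.reflexive (≡.cong (λ g → sub g sel) (≡.sym (append-ˡ φx φy i)))))))
            (line-inverts i)
          ... | inj₂ (j , ≡.refl) = resp (P.+-cong (P.reflexive (≡.sym (choose _ _ (append-ʳ {m = n₁} {n₂} _ _ j))))
              (P.-‿cong (P.trans (pw λ v → F.trans (ev-dot _ _ v)
                  (F.sym (F.trans (ev-sub (φy j) sel v) (F.trans (value-φy (evs sel v) j)
                  (SF.dot-cong (λ l → ev-append-ˡ (y ∘ Y.τ) (x ∘ X.τ) v l)
                    (λ l → F.trans (ev-cong (Y.Φ j l) (us-at-sel v)) (F.sym (ev-sub (Y.Φ j l) xσ v))))))))
                (P.reflexive (≡.cong (λ g → sub g sel) (≡.sym (append-ʳ φx φy j)))))))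
            (Y.inverts j)

          vanishes : All (λ f → sub f φ ≋ 0P) J
          vanishes = All.++⁺
            (All.map⁺ (All.map (λ {a} z → pw λ q → F.trans (ev-sub (xForm a) φ q) (F.trans (ev-dot _ x (evs φ q))
              (F.trans (SF.dot-cong (λ i → ev-constant (a i) (evs φ q)) (x-at-φ q))
                  (F.trans (z (evs us q)) (F.sym (ev-0 q)))))) line-solves))
            (All.map⁺ (All.map (λ {r} z → pw λ q → F.trans (ev-sub (yForm r) φ q) (F.trans (ev-dot _ y (evs φ q))
              (F.trans (SF.dot-cong (λ j → F.trans (ev-sub (r j) xs (evs φ q)) (F.trans (ev-cong (r j) (λ i →
                    F.trans (ev-tabulate x (evs φ q) i)
                        (F.trans (x-at-φ q i) (F.sym (ev-tabulate line (evs us q) i)))))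
                  (F.sym (ev-sub (r j) L (evs us q))))) (y-at-φ q))
              (F.trans (SF.dot-sum _ _ (λ l j → ev (Y.Φ j l) (evs us q)))
              (F.trans (SF.sum-0 (λ l → F.trans
                  (F.*-congˡ (F.trans (F.sym (ev-dot (λ j → sub (r j) L) (λ j → Y.Φ j l) (evs us q)))
                  (F.trans (at (z l) (evs us q)) (ev-0 (evs us q))))) (F.zeroʳ _))) (F.sym (ev-0 q)))))))
                      (All.map⁻ Y.solves)))

          rescale-u : ∀ t q → evs us (rescale weight′ t q) ≈ᵥ evs us q
          rescale-u t q l = F.trans (value-u (rescale weight′ t q) l) (F.trans
            (F.reflexive (≡.trans (lookup-rescale weight′ t q (n ↑ʳ l)) (choose _ _ (append-ʳ {m = n} {m} _ _ l))))
                (F.sym (value-u q l)))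

          rescale-w : ∀ t q l → Vec.lookup (rescale weight′ t q) (l ↑ˡ m) ≡ t F.* Vec.lookup q (l ↑ˡ m)
          rescale-w t q l = ≡.trans (lookup-rescale weight′ t q (l ↑ˡ m)) (choose _ _ (append-ˡ {m = n} {m} _ _ l))

          scales : ∀ t q → evs φ (rescale weight′ t q) ≈ᵥ rescale weight t (evs φ q)
          scales t q k with split n₁ k
          ... | inj₁ (i , ≡.refl) = F.trans (ev-append-ˡ φx φy _ i)
              (F.trans (value-φx _ i) (F.trans (ev-cong (line i) (rescale-u t q))
              (F.trans (F.sym (F.trans (ev-append-ˡ φx φy q i) (value-φx q i)))
              (F.reflexive (≡.sym (≡.trans (lookup-rescale weight t (evs φ q) (i ↑ˡ n₂))
                  (choose _ _ (append-ˡ {m = n₁} {n₂} _ _ i))))))))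
          ... | inj₂ (j , ≡.refl) = F.trans (ev-append-ʳ φx φy _ j) (F.trans (value-φy _ j) (F.trans
              (SF.dot-comm _ _) (F.trans (SF.dot-cong (λ l → ev-cong (Y.Φ j l) (rescale-u t q))
                  (λ l → F.reflexive (rescale-w t q l)))
              (F.trans (SF.dot-· _ _ t) (F.trans
                  (F.*-congˡ (F.trans (SF.dot-comm _ _) (F.sym (F.trans (ev-append-ʳ φx φy q j) (value-φy q j)))))
              (F.reflexive (≡.sym (≡.trans (lookup-rescale weight t (evs φ q) (n₁ ↑ʳ j))
                  (choose _ _ (append-ʳ {m = n₁} {n₂} _ _ j))))))))))

          selects : ∀ l q → ev (Vec.lookup sel l) (evs φ q) ≈
                    (if Vec.lookup weight′ l then ev Δ (evs φ q) F.* Vec.lookup q l else Vec.lookup q l)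
          selects k q with split n k
          ... | inj₁ (l , ≡.refl) = F.trans
              (F.reflexive (≡.cong (λ g → ev g (evs φ q)) (append-ˡ (y ∘ Y.τ) (x ∘ X.τ) l)))
              (F.trans (y-at-φ q (Y.τ l))
                  (F.trans (SF.dot-cong (λ _ → F.refl) (λ l′ → F.trans (at (Y.selects l l′) (evs us q))
                  (F.trans (ev-* Y.denominator (δ l l′) (evs us q)) (F.*-congˡ (ev-δ l l′ (evs us q))))))
              (F.trans (SF.dot-· _ (SF.δ l) _)
                  (F.trans (F.*-cong (F.sym (Δ-at-φ q)) (F.trans (SF.dot-comm _ (SF.δ l)) (SF.sum-δ l _)))
              (F.reflexive (≡.sym (choose _ _ (append-ˡ {m = n} {m} _ _ l))))))))
          ... | inj₂ (l , ≡.refl) = F.trans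
              (F.reflexive (≡.cong (λ g → ev g (evs φ q)) (append-ʳ (y ∘ Y.τ) (x ∘ X.τ) l)))
              (F.trans (x-at-φ q (X.τ l)) (F.trans (line-selects l (evs us q)) (F.trans (value-u q l)
              (F.reflexive (≡.sym (choose _ _ (append-ʳ {m = n} {m} _ _ l)))))))

          base-zero : ∀ k → Vec.lookup weight′ k ≡ true → Vec.lookup base k ≈ 0#
          base-zero k eq with split n k
          ... | inj₁ (l , ≡.refl) = F.reflexive (append-ˡ {m = n} _ _ l)
          ... | inj₂ (l , ≡.refl) = contradiction (≡.trans (≡.sym eq) (append-ʳ {m = n} {m} _ _ l)) (λ ())

          Δ-nonzero : ∀ q → (∀ k → Vec.lookup weight′ k ≡ false → Vec.lookup q k ≈ Vec.lookup base k) → ¬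
              (ev Δ (evs φ q) ≈ 0#)
          Δ-nonzero q agree z = proj₂ Y.nonzero (F.trans (ev-cong Y.denominator (λ l → F.sym (F.trans (value-u q l)
              (F.trans (agree (n ↑ʳ l) (append-ʳ {m = n} {m} _ _ l))
                  (F.reflexive (append-ʳ {m = n} _ (Vec.lookup u₀) l))))))
            (F.trans (F.sym (Δ-at-φ q)) z))

          parametrization : Parametrization weight J D
          parametrization = record
            { φ = φ ; sel = sel ; Δ = Δ ; weight′ = weight′ ; base = base ; inverts = inverts ; vanishes = vanishes
            ; scales = scales ; selects = selects ; base-zero = base-zero ; Δ-nonzero = Δ-nonzero }

      -- The two eliminations lose at most one parameter per row, the first among the x and the
      -- second among the y.
      parametrized : ¬¬ (∃ λ D → N ≤ D ℕ.+ (length as ℕ.+ length rs) × Parametrization weight J D)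
      parametrized = x-eliminated >>= λ { (m , m-le , X) → XSolved.y-eliminated X >>= λ { (n , n-le , Y) →
        return (n ℕ.+ m
          , ℕₚ.≤-trans (ℕₚ.+-mono-≤ m-le n-le) (ℕₚ.≤-reflexive (≡.trans
              (≡.cong₂ (λ a b → (m ℕ.+ a) ℕ.+ (n ℕ.+ b)) (List.length-map _ as) (List.length-map _ rs))
              (rearrange m (length as) n (length rs))))
          , XSolved.YSolved.parametrization X Y) }}
        where
        rearrange : ∀ m a n b → (m ℕ.+ a) ℕ.+ (n ℕ.+ b) ≡ (n ℕ.+ m) ℕ.+ (a ℕ.+ b)
        rearrange = solve-∀

-- From slices to forms.

module SliceRank {c ℓ} (F : Field c ℓ) (ac : FieldDefs.AlgebraicallyClosed F) where
  open Field F hiding (zero)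
  open FieldDefs F
  open InfiniteField F ac using (∑≈sum)
  open Sums commutativeRing
  open RingSolver commutativeRing

  eval-sumP : ∀ {n₁ n₂ n} (f : Fin n → Poly n₁ n₂) p → eval (sumP f) p ≈ sum (λ i → eval (f i) p)
  eval-sumP {n = zero}  f p = reflexive (≡.sym (sum-zero _))
  eval-sumP {n = suc n} f p = trans (+-congˡ (eval-sumP (f ∘ suc) p)) (reflexive (≡.sym (sum-suc _)))

  formValue : ∀ {n₁ n₂} → PForm n₁ n₂ → Point n₁ n₂ → Carrier
  formValue (linx a)  (x , y) = dot a x
  formValue (liny b)  (x , y) = dot b y
  formValue (bilin M) (x , y) = sum (λ i → sum (λ j → M i j * (x i * y j)))

  eval-form : ∀ {n₁ n₂} (f : PForm n₁ n₂) p → eval (toPoly f) p ≈ formValue f p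
  eval-form (linx a)  p = eval-sumP _ p
  eval-form (liny b)  p = eval-sumP _ p
  eval-form (bilin M) p = trans (eval-sumP (λ i → sumP λ j → const (M i j) ⊗ (varx i ⊗ vary j)) p)
    (sum-cong (λ i → eval-sumP (λ j → const (M i j) ⊗ (varx i ⊗ vary j)) p))

  *-distribʳ-sum : ∀ {n} x (f : Fin n → Carrier) → sum f * x ≈ sum (λ i → f i * x)
  *-distribʳ-sum x f = trans (*-comm _ x) (trans (*-distribˡ-sum x f) (sum-cong (λ i → *-comm x (f i))))

  module _ {n₁ n₂ n₃ : ℕ} where

    value : Tensor n₁ n₂ n₃ → (Fin n₁ → Carrier) → (Fin n₂ → Carrier) → (Fin n₃ → Carrier) → Carrier
    value T x y z = sum λ i → sum λ j → sum λ k → T i j k * (x i * (y j * z k))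

    trilinear-value : ∀ (T : Tensor n₁ n₂ n₃) x y z → trilinear T x y z ≈ value T x y z
    trilinear-value T x y z = trans (∑≈sum _) (sum-cong λ i → trans (∑≈sum _) (sum-cong λ j → ∑≈sum _))

    value-cong : ∀ {T U : Tensor n₁ n₂ n₃} → (∀ i j k → T i j k ≈ U i j k) → ∀ x y z → value T x y z ≈ value U x y z
    value-cong e x y z = sum-cong λ i → sum-cong λ j → sum-cong λ k → *-congʳ (e i j k)

    value-sum : ∀ {r} (S : Fin r → Tensor n₁ n₂ n₃) x y z →
                value (λ i j k → sum (λ t → S t i j k)) x y z ≈ sum (λ t → value (S t) x y z)
    value-sum S x y z = trans (sum-cong λ i → trans (sum-cong λ j → trans (sum-cong λ k → *-distribʳ-sum _ _)
      (sum-comm _)) (sum-comm _)) (sum-comm _)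

    sliceForm : SliceTerm n₁ n₂ n₃ → PForm n₁ n₂
    sliceForm (slice₁ u M) = linx u
    sliceForm (slice₂ u M) = liny u
    sliceForm (slice₃ u M) = bilin M

    -- The contraction of a slice is a product with the value of its form as one factor. For the
    -- second kind the sums over i and j are exchanged first, so that this factor can be pulled out.
    slice-vanishes : ∀ (t : SliceTerm n₁ n₂ n₃) x y z → formValue (sliceForm t) (x , y) ≈ 0# → value
        (sliceTensor t) x y z ≈ 0#
    slice-vanishes (slice₁ u M) x y z e = trans
      (trans (sum-cong λ i → trans (sum-cong λ j → trans (sum-cong λ k →
          solve 5 (λ u m x y z → (u :* m) :* (x :* (y :* z)) := (u :* x) :* (m :* (y :* z))) refl (u i) (M j k) (x i)
              (y j) (z k))
        (sym (*-distribˡ-sum _ _))) (sym (*-distribˡ-sum _ _))) (sym (*-distribʳ-sum _ _)))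
      (trans (*-congʳ e) (zeroˡ _))
    slice-vanishes (slice₂ u M) x y z e = trans (sum-comm _) (trans
      (trans (sum-cong λ j → trans (sum-cong λ i → trans (sum-cong λ k →
          solve 5 (λ u m x y z → (u :* m) :* (x :* (y :* z)) := (u :* y) :* (m :* (x :* z))) refl (u j) (M i k) (x i)
              (y j) (z k))
        (sym (*-distribˡ-sum _ _))) (sym (*-distribˡ-sum _ _))) (sym (*-distribʳ-sum _ _)))
      (trans (*-congʳ e) (zeroˡ _)))
    slice-vanishes (slice₃ u M) x y z e = trans
      (trans (sum-cong λ i → trans (sum-cong λ j → trans (sum-cong λ k →
          solve 5 (λ u m x y z → (u :* m) :* (x :* (y :* z)) := (m :* (x :* y)) :* (u :* z)) refl (u k) (M i j) (x i)
              (y j) (z k))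
        (sym (*-distribˡ-sum _ _))) (sym (*-distribʳ-sum _ _))) (sym (*-distribʳ-sum _ _)))
      (trans (*-congʳ e) (zeroˡ _))

    slices⇒forms : ∀ {T : Tensor n₁ n₂ n₃} {r} → SRWitness T r → ZRWitness T r
    slices⇒forms {T} (ts , T≈) = (λ t → sliceForm (ts t)) , λ { (x , y) (Level.lift vs) z →
      trans (trilinear-value T x y z) (trans (value-cong (λ i j k → trans (T≈ i j k) (∑≈sum _)) x y z)
        (trans (value-sum (λ t → sliceTensor (ts t)) x y z) (sum-0 (λ t → slice-vanishes (ts t) x y z
          (trans (sym (eval-form (sliceForm (ts t)) (x , y))) (vs t)))))) }

-- Chains of closed sets and the final inequalities.

module GeometricRank {c ℓ} (F : Field c ℓ) (ac : FieldDefs.AlgebraicallyClosed F) where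
  open Field F hiding (zero)
  open FieldDefs F
  open Polynomials F using (Pol; con; nil; _◂_; ev; evs; constant; var; ev-constant; ev-var; ev-sub; ev-*; ev-+; _⊛_; _≈ᵥ_; ev-cong; module PS) renaming (_⊕_ to _⊞_)
  open InfiniteField F ac using (VanishAt)
  open BilinearSystem F ac
  open Flags F ac
  open DoubleNegation
  open SliceRank F ac using (formValue; eval-form)
  open RingSolver commutativeRing
  private module SF = Sums commutativeRing

  module _ {n₁ n₂ : ℕ} where
    open System n₁ n₂

    toVec : Point n₁ n₂ → Vec Carrier N
    toVec (x , y) = append x y

    fromVec : Vec Carrier N → Point n₁ n₂
    fromVec v = (λ i → Vec.lookup v (i ↑ˡ n₂)) , (λ j → Vec.lookup v (n₁ ↑ʳ j))

    toVec-fromVec : ∀ v → toVec (fromVec v) ≈ᵥ v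
    toVec-fromVec v k with split n₁ k
    ... | inj₁ (i , ≡.refl) = reflexive (append-ˡ _ _ i)
    ... | inj₂ (j , ≡.refl) = reflexive (append-ʳ {m = n₁} _ _ j)

    toPol : Poly n₁ n₂ → Pol N
    toPol (const a) = constant a
    toPol (varx i)  = x i
    toPol (vary j)  = y j
    toPol (f ⊕ g)   = toPol f ⊞ toPol g
    toPol (f ⊗ g)   = toPol f ⊛ toPol g

    ev-x : ∀ p i → ev (x i) (toVec p) ≈ proj₁ p i
    ev-x p i = trans (ev-var _ (toVec p)) (reflexive (append-ˡ _ _ i))

    ev-y : ∀ p j → ev (y j) (toVec p) ≈ proj₂ p j
    ev-y p j = trans (ev-var _ (toVec p)) (reflexive (append-ʳ {m = n₁} _ _ j))

    ev-toPol : ∀ f p → ev (toPol f) (toVec p) ≈ eval f p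
    ev-toPol (const a) p = ev-constant a (toVec p)
    ev-toPol (varx i)  p = ev-x p i
    ev-toPol (vary j)  p = ev-y p j
    ev-toPol (f ⊕ g)   p = trans (ev-+ (toPol f) (toPol g) (toVec p)) (+-cong (ev-toPol f p) (ev-toPol g p))
    ev-toPol (f ⊗ g)   p = trans (ev-* (toPol f) (toPol g) (toVec p)) (*-cong (ev-toPol f p) (ev-toPol g p))

    substitute : ∀ {k} → Pol k → Vec (Poly n₁ n₂) k → Poly n₁ n₂
    substitute (con a) gs       = const a
    substitute nil     gs       = const 0#
    substitute (a ◂ f) (g ∷ gs) = substitute a gs ⊕ (g ⊗ substitute f (g ∷ gs))

    eval-substitute : ∀ {k} (f : Pol k) gs p → eval (substitute f gs) p ≈ ev f (Vec.map (λ g → eval g p) gs)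
    eval-substitute (con a) gs       p = refl
    eval-substitute nil     gs       p = refl
    eval-substitute (a ◂ f) (g ∷ gs) p = +-cong (eval-substitute a gs p) (*-congˡ (eval-substitute f (g ∷ gs) p))

    fromPol : Pol N → Poly n₁ n₂
    fromPol f = substitute f (append varx vary)

    eval-fromPol : ∀ f p → eval (fromPol f) p ≈ ev f (toVec p)
    eval-fromPol f p = trans (eval-substitute f _ p) (ev-cong f coordinates)
      where
      coordinates : Vec.map (λ g → eval g p) (append varx vary) ≈ᵥ toVec p
      coordinates k with split n₁ k
      ... | inj₁ (i , ≡.refl) = reflexive (≡.trans (Vec.lookup-map (i ↑ˡ n₂) (λ g → eval g p) (append varx vary))
          (≡.trans
        (≡.cong (λ g → eval g p) (append-ˡ varx vary i)) (≡.sym (append-ˡ _ _ i))))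
      ... | inj₂ (j , ≡.refl) = reflexive (≡.trans (Vec.lookup-map (n₁ ↑ʳ j) (λ g → eval g p) (append varx vary))
          (≡.trans
        (≡.cong (λ g → eval g p) (append-ʳ {m = n₁} varx vary j)) (≡.sym (append-ʳ {m = n₁} _ _ j))))

    xRows : List (PForm n₁ n₂) → List (Fin n₁ → Carrier)
    xRows []             = []
    xRows (linx a ∷ fs)  = a ∷ xRows fs
    xRows (liny b ∷ fs)  = xRows fs
    xRows (bilin M ∷ fs) = xRows fs

    -- A bilinear form is read as a form in y with coefficients linear in x; a form in y alone has
    -- constant coefficients. Both become rows for the second elimination.
    yRows : List (PForm n₁ n₂) → List (Fin n₂ → Pol n₁)
    yRows []             = []
    yRows (linx a ∷ fs)  = yRows fs
    yRows (liny b ∷ fs)  = (λ j → constant (b j)) ∷ yRows fs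
    yRows (bilin M ∷ fs) = (λ j → PS.dot (λ i → constant (M i j)) var) ∷ yRows fs

    length-rows : ∀ fs → length (xRows fs) ℕ.+ length (yRows fs) ≡ length fs
    length-rows []             = ≡.refl
    length-rows (linx a ∷ fs)  = ≡.cong suc (length-rows fs)
    length-rows (liny b ∷ fs)  = ≡.trans (ℕₚ.+-suc _ _) (≡.cong suc (length-rows fs))
    length-rows (bilin M ∷ fs) = ≡.trans (ℕₚ.+-suc _ _) (≡.cong suc (length-rows fs))

    forms-vanish : ∀ fs p → All (λ a → ev (xForm a) (toVec p) ≈ 0#) (xRows fs) → All
        (λ r → ev (yForm r) (toVec p) ≈ 0#) (yRows fs) →
                   All (λ f → formValue f p ≈ 0#) fs
    forms-vanish []             p as       rs       = []
    forms-vanish (linx a ∷ fs)  p (z ∷ as) rs       = trans (sym (trans (ev-dot _ x (toVec p))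
      (SF.dot-cong (λ i → ev-constant (a i) (toVec p)) (ev-x p)))) z ∷ forms-vanish fs p as rs
    forms-vanish (liny b ∷ fs)  p as       (z ∷ rs) = trans (sym (trans (ev-dot _ y (toVec p))
      (SF.dot-cong (λ j → trans (ev-sub (constant (b j)) xs (toVec p)) (ev-constant (b j) (evs xs (toVec p))))
          (ev-y p)))) z ∷ forms-vanish fs p as rs
    forms-vanish (bilin M ∷ fs) p as       (z ∷ rs) = trans (sym (trans (ev-dot _ y (toVec p)) (trans
        (SF.sum-cong (λ j → trans (*-cong (trans (ev-sub (PS.dot (λ i → constant (M i j)) var) xs (toVec p))
            (trans (ev-dot _ var (evs xs (toVec p)))
            (SF.dot-cong (λ i → ev-constant (M i j) (evs xs (toVec p)))
                (λ i → trans (ev-var i _) (trans (ev-tabulate x (toVec p) i) (ev-x p i))))))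
            (ev-y p j)) (trans (*-comm _ _) (trans (SF.*-distribˡ-sum _ _) (SF.sum-cong (λ i →
              solve 3 (λ m x y → y :* (m :* x) := m :* (x :* y)) refl (M i j) (proj₁ p i) (proj₂ p j)))))))
        (SF.sum-comm _)))) z ∷ forms-vanish fs p as rs

    module _ {J : List (Pol N)} {D} (π : Parametrization weight J D) where
      open Strata π
      open Stratum

      asClosed : ∀ {i} → Stratum i → Closed n₁ n₂
      asClosed s = closed (λ k → fromPol (lookup (equations s) k))

      closed⇒on : ∀ {i} (s : Stratum i) p → ⟦ asClosed s ⟧ p → OnStratum s (toVec p)
      closed⇒on s p (Level.lift h) = All.tabulate λ {g} g∈ → trans
        (reflexive (≡.cong (λ g → ev g (toVec p)) (lookup-index g∈)))
            (trans (sym (eval-fromPol (lookup (equations s) (index g∈)) p)) (h (index g∈)))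

      on⇒closed : ∀ {i} (s : Stratum i) p → OnStratum s (toVec p) → ⟦ asClosed s ⟧ p
      on⇒closed s p on = Level.lift λ k → trans (eval-fromPol (lookup (equations s) k) p) (All.lookup on (∈-lookup k))

      on⇒closed′ : ∀ {i} (s : Stratum i) v → OnStratum s v → ⟦ asClosed s ⟧ (fromVec v)
      on⇒closed′ s v on = on⇒closed s (fromVec v) (on-cong s (λ k → sym (toVec-fromVec v k)) on)

      stratum-isIrreducible : ∀ {i} (s : Stratum i) → Irreducible (asClosed s)
      stratum-isIrreducible {i} s = (_ , on⇒closed′ s _ (image-on s (Vec.replicate D 0#))) , λ { A B h →
          Data.Sum.map (contained A) (contained B) (stratum-irreducible s (polynomialsOf A) (polynomialsOf B)
            (λ v on → Data.Sum.map (vanish A v) (vanish B v) (h (fromVec v) (on⇒closed′ s v on)))) }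
        where
        polynomialsOf : Closed n₁ n₂ → List (Pol N)
        polynomialsOf (closed fs) = tabulate (toPol ∘ fs)
        vanish : ∀ A v → ⟦ A ⟧ (fromVec v) → VanishAt (polynomialsOf A) v
        vanish (closed fs) v (Level.lift z) = All.tabulate⁺
            (λ k → trans (ev-cong (toPol (fs k)) (λ i → sym (toVec-fromVec v i)))
          (trans (ev-toPol (fs k) (fromVec v)) (z k)))
        contained : ∀ A → (∀ v → OnStratum s v → VanishAt (polynomialsOf A) v) → ⟦ asClosed s ⟧ ⊆ ⟦ A ⟧
        contained (closed fs) h p on = Level.lift λ k → trans (sym (ev-toPol (fs k) p))
            (All.tabulate⁻ (h (toVec p) (closed⇒on s p on)) k)

      -- The strata run from no free coordinate to all D of them, giving D strict inclusions. Each
      -- exists up to double negation, and finitely many double negations combine into one.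
      chain : ∀ {W : Subset n₁ n₂} → (∀ p → VanishAt J (toVec p) → W p) → ¬¬ Chain W D
      chain J⊆W = ¬¬-Π (suc D) (λ i → stratum (toℕ i)) >>= λ s → return (record
        { Z = λ i → asClosed (s i)
        ; irred = λ i → stratum-isIrreducible (s i)
        ; inW = λ i p on → J⊆W p (on-J (s i) (closed⇒on (s i) p on))
        ; strict = λ i → (λ p on → on⇒closed (s (suc i)) p (strata-increase
              (ℕₚ.≤-trans (ℕₚ.≤-reflexive (Fin.toℕ-inject₁ i)) (ℕₚ.n≤1+n _)) (s (inject₁ i)) (s (suc i)) (toVec p)
                  (closed⇒on (s (inject₁ i)) p on)))
            , (let (v , on , off) = strata-strict i (Fin.toℕ-inject₁ i) (s (inject₁ i)) (s (suc i)) in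
               fromVec v , on⇒closed′ (s (suc i)) v on
               , λ on′ → off (on-cong (s (inject₁ i)) (toVec-fromVec v) (closed⇒on (s (inject₁ i)) (fromVec v) on′)))
                   })

    forms⇒chain : ∀ {n₃} {T : Tensor n₁ n₂ n₃} {s} → ZRWitness T s → ¬¬ (∃ λ D → N ≤ D ℕ.+ s × Chain (VT T) D)
    forms⇒chain {T = T} {s} (fs , V⊆VT) = Solve.parametrized (xRows forms) (yRows forms) >>= λ { (D , le , π) →
      chain π (λ p zs → V⊆VT p (Level.lift λ t → trans (eval-form (fs t) p) (All.tabulate⁻ (forms-vanish forms p
        (All.map⁻ (All.++⁻ˡ _ zs)) (All.map⁻ (All.++⁻ʳ (map xForm (xRows forms)) zs))) t))) >>= λ ch →
      return (D , ≡.subst (λ k → N ≤ D ℕ.+ k) (≡.trans (length-rows forms) (List.length-tabulate fs)) le , ch) }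
      where
      forms = tabulate fs

theorem7p1 : ∀ {c ℓ} (F : Field c ℓ) → FieldDefs.AlgebraicallyClosed F →
    ∀ {n₁ n₂ n₃} (T : FieldDefs.Tensor F n₁ n₂ n₃) (g z r : ℕ) →
    FieldDefs.IsGR F T g → FieldDefs.IsZR F T z → FieldDefs.IsSR F T r →
    (g ≤ z) × (z ≤ r)
theorem7p1 F ac {n₁} {n₂} T g z r (d , (_ , longest) , ≡.refl) (forms , fewest) (slices , _) =
    decidable-stable (_ ℕₚ.≤? z) (GeometricRank.forms⇒chain F ac forms >>= λ { (D , le , ch) →
      return (ℕₚ.m≤n+o⇒m∸n≤o (n₁ ℕ.+ n₂) d (ℕₚ.≤-trans le (ℕₚ.+-monoˡ-≤ z (longest D ch)))) })
  , fewest r (SliceRank.slices⇒forms F ac slices)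
  where open DoubleNegation
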